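{- For every integer $r\geq 2$ there exists $C\geq r$ such that, with $p=p(n)\in[0,1]$, the following hold asymptotically almost surely: (i) if $p\ge \left(\frac{27\log n}{n}\right)^{1/3}$, then $\mathrm{tp}_2(G(n,p)) \le 2$; (ii) if $p\geq \left(\frac{C\log n}{n}\right)^{1/(r+1)}$, then $\mathrm{tc}_r(G(n,p))\leq r^2$; (iii) if $p\ge \left(\frac{C\log n}{n}\right)^{1/r}$, then in every $r$-coloring of the edges of $G(n,p)$ there is a collection of $r$ vertex-disjoint monochromatic trees which cover all but at most $9r\log n /p=O\left(n^{1/r}(\log n)^{1-1/r}\right)$ vertices.
   Context: $G(n,p)$ is the binomial random graph on $n$ vertices in which each pair is an edge independently with probability $p=p(n)$. A sequence of events $A_n$ holds asymptotically almost surely (a.a.s.) if $\Pr[A_n]\to 1$ as $n\to\infty$. $\log$ is the natural logarithm. An $r$-coloring of a graph is an arbitrary assignment of one of $r$ colors to each edge. The $r$-color tree-partition number $\mathrm{tp}_r(G)$ (resp. tree-cover number $\mathrm{tc}_r(G)$) is the minimum $s$ such that for every $r$-coloring of the edges of $G$ there exists a collection of monochromatic connected subgraphs $\{H_1,\dots,H_t\}$ with $t\leq s$ such that $\{V(H_1),\dots,V(H_t)\}$ is a partition (resp. a cover) of $V(G)$. "A collection of $r$ trees" is to be understood as at most $r$ trees; a single vertex counts as a monochromatic tree. -}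

module Defs where

open import Level using (0ℓ)
open import Algebra.Bundles using (CommutativeRing)
open import Data.Bool.Base using (Bool; true; false)
open import Data.Fin.Base using (Fin; zero; suc)
open import Data.Fin.Subset using (Subset; Nonempty; Empty; _∈_; _∩_; ∁; ⋃; ⊤; ∣_∣)
open import Data.List.Base using (List; []; _∷_; _∷ʳ_; length; map)
open import Data.List.Relation.Unary.All using (All)
open import Data.List.Relation.Unary.AllPairs using (AllPairs)
open import Data.List.Relation.Unary.Linked using (Linked)
open import Data.List.Relation.Unary.Unique.Propositional using (Unique)
open import Data.Maybe.Base using (Maybe; just; nothing)
open import Data.Nat.Base as ℕ using (ℕ; zero; suc; _!)
open import Data.Product.Base using (Σ; ∃; _×_; _,_)
open import Data.Sum.Base using (_⊎_; inj₁; inj₂)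
open import Data.Vec.Base as Vec using (Vec; lookup)
open import Relation.Binary.Construct.Closure.ReflexiveTransitive using (Star)
open import Relation.Binary.Core using (Rel)
open import Relation.Binary.PropositionalEquality.Core using (_≡_)
open import Relation.Binary.Structures using (IsDecTotalOrder)
open import Relation.Nullary.Negation.Core using (¬_)

import Algebra.Properties.Semiring.Exp
import Algebra.Properties.Semiring.Mult
import Relation.Binary.Construct.NonStrictToStrict

------------------------------------------------------------------------
-- The real numbers

-- The classical axioms of ℝ, which determine it up to isomorphism.
-- _⁻¹ and sup are total functions: the value of _⁻¹ at 0, and of sup at a
-- set that is empty or unbounded above, is unspecified.
-- The Archimedean axiom follows from the others classically; it is listed
-- because the natural number cannot be extracted constructively.

record RealNumbers : Set₁ where
  infix  4 _≤_
  infix  8 _⁻¹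
  infixl 6 _-_
  infixl 7 _/_

  field
    commutativeRing : CommutativeRing 0ℓ 0ℓ

  open CommutativeRing commutativeRing public
    using (Carrier; _≈_; _+_; _*_; -_; 0#; 1#; semiring)

  field
    _≤_             : Rel Carrier 0ℓ
    isDecTotalOrder : IsDecTotalOrder _≈_ _≤_
    +-monoˡ-≤       : ∀ z {x y} → x ≤ y → x + z ≤ y + z
    *-nonNeg        : ∀ {x y} → 0# ≤ x → 0# ≤ y → 0# ≤ x * y
    0≉1             : ¬ (0# ≈ 1#)
    _⁻¹             : Carrier → Carrier
    ⁻¹-cong         : ∀ {x y} → x ≈ y → x ⁻¹ ≈ y ⁻¹
    ⁻¹-inverseʳ     : ∀ x → ¬ (x ≈ 0#) → x * x ⁻¹ ≈ 1#

  UpperBound : (Carrier → Set) → Carrier → Set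
  UpperBound S b = ∀ x → S x → x ≤ b

  open Algebra.Properties.Semiring.Mult semiring public
    using () renaming (_×_ to _·_)
  open Algebra.Properties.Semiring.Exp semiring public
    using (_^_)
  open Relation.Binary.Construct.NonStrictToStrict _≈_ _≤_ public
    using (_<_)
  open IsDecTotalOrder isDecTotalOrder public
    using (total)

  fromℕ : ℕ → Carrier
  fromℕ n = n · 1#

  field
    sup         : (Carrier → Set) → Carrier
    sup-upper   : ∀ S → ∃ S → ∃ (UpperBound S) → UpperBound S (sup S)
    sup-least   : ∀ S → ∃ S → ∀ b → UpperBound S b → sup S ≤ b
    archimedean : ∀ x → ∃ λ n → x ≤ fromℕ n

  _-_ : Carrier → Carrier → Carrier
  x - y = x + - y

  _/_ : Carrier → Carrier → Carrier
  x / y = x * y ⁻¹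

  abs : Carrier → Carrier
  abs x with total 0# x
  ... | inj₁ _ = x
  ... | inj₂ _ = - x

Eventually : (ℕ → Set) → Set
Eventually P = ∃ λ N → ∀ n → N ℕ.≤ n → P n

module Analysis (ℝ : RealNumbers) where
  open RealNumbers ℝ

  infix 4 _⟶_ _=O_

  _⟶_ : (ℕ → Carrier) → Carrier → Set
  a ⟶ l = ∀ ε → 0# < ε → Eventually λ n → abs (a n - l) < ε

  _=O_ : (ℕ → Carrier) → (ℕ → Carrier) → Set
  f =O g = ∃ λ K → Eventually λ n → abs (f n) ≤ K * abs (g n)

  expSum : Carrier → ℕ → Carrier
  expSum x zero    = 0#
  expSum x (suc k) = expSum x k + x ^ k / fromℕ (k !)

  -- log x is the largest y with exp y ≤ x, where exp y is the limit of its
  -- power series.  This is the natural logarithm for x > 0.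
  log : Carrier → Carrier
  log x = sup λ y → ∃ λ e → (expSum y ⟶ e) × e ≤ x

  -- x ^[ m / k ] is x to the rational power m/k, that is, the non-negative
  -- k-th root of x ^ m, for x ≥ 0 and k ≥ 1.
  _^[_/_] : Carrier → ℕ → ℕ → Carrier
  x ^[ m / k ] = sup λ y → 0# ≤ y × y ^ k ≤ x ^ m

------------------------------------------------------------------------
-- Graphs on the vertex set Fin n

-- A function from the unordered pairs of distinct elements of Fin n to A,
-- stored as the strict upper triangle of a symmetric n × n matrix.
data Pairs (A : Set) : ℕ → Set where
  []  : Pairs A zero
  _∷_ : ∀ {n} → Vec A n → Pairs A n → Pairs A (suc n)

at : ∀ {A n} → Pairs A n → Fin n → Fin n → Maybe A
at (v ∷ t) zero    zero    = nothing
at (v ∷ t) zero    (suc j) = just (lookup v j)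
at (v ∷ t) (suc i) zero    = just (lookup v i)
at (v ∷ t) (suc i) (suc j) = at t i j

Graph : ℕ → Set
Graph = Pairs Bool

Adj : ∀ {n} → Graph n → Fin n → Fin n → Set
Adj G i j = at G i j ≡ just true

-- Every pair receives a colour, but only the colours of the edges of the
-- graph at hand are ever consulted.
Colouring : ℕ → ℕ → Set
Colouring r n = Pairs (Fin r) n

record Subgraph {n : ℕ} (G : Graph n) : Set where
  field
    V    : Subset n
    E    : Graph n
    E⊆G  : ∀ {i j} → Adj E i j → Adj G i j
    ends : ∀ {i j} → Adj E i j → i ∈ V × j ∈ V

open Subgraph public

module _ {n : ℕ} {G : Graph n} where

  Connected : Subgraph G → Set
  Connected H = Nonempty (V H) ×
    (∀ {u v} → u ∈ V H → v ∈ V H → Star (Adj (E H)) u v)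

  -- The cycle v, w₁, …, wₖ, v has k + 1 ≥ 3 distinct vertices.
  Cycle : Subgraph G → Set
  Cycle H = Σ (Fin n) λ v → Σ (List (Fin n)) λ ws →
    2 ℕ.≤ length ws × Unique (v ∷ ws) × Linked (Adj (E H)) (v ∷ (ws ∷ʳ v))

  Tree : Subgraph G → Set
  Tree H = Connected H × ¬ Cycle H

  Monochromatic : ∀ {r} → Colouring r n → Subgraph G → Set
  Monochromatic {r} χ H = Σ (Fin r) λ c → ∀ {i j} → Adj (E H) i j → at χ i j ≡ just c

  covered : List (Subgraph G) → Subset n
  covered Hs = ⋃ (map V Hs)

  Covering : List (Subgraph G) → Set
  Covering Hs = covered Hs ≡ ⊤

  VertexDisjoint : List (Subgraph G) → Set
  VertexDisjoint = AllPairs λ H K → Empty (V H ∩ V K)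

CoverableBy : ∀ {n} → ℕ → Graph n → ℕ → Set
CoverableBy {n} r G s = (χ : Colouring r n) → Σ (List (Subgraph G)) λ Hs →
  length Hs ℕ.≤ s ×
  All (λ H → Connected H × Monochromatic χ H) Hs ×
  Covering Hs

PartitionableBy : ∀ {n} → ℕ → Graph n → ℕ → Set
PartitionableBy {n} r G s = (χ : Colouring r n) → Σ (List (Subgraph G)) λ Hs →
  length Hs ℕ.≤ s ×
  All (λ H → Connected H × Monochromatic χ H) Hs ×
  Covering Hs ×
  VertexDisjoint Hs

IsMinimum : (ℕ → Set) → ℕ → Set
IsMinimum P m = P m × (∀ k → P k → m ℕ.≤ k)

tp[_]_≤_ : ∀ {n} → ℕ → Graph n → ℕ → Set
tp[ r ] G ≤ s = ∃ λ m → IsMinimum (PartitionableBy r G) m × m ℕ.≤ s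

tc[_]_≤_ : ∀ {n} → ℕ → Graph n → ℕ → Set
tc[ r ] G ≤ s = ∃ λ m → IsMinimum (CoverableBy r G) m × m ℕ.≤ s

------------------------------------------------------------------------
-- The binomial random graph

module RandomGraph (ℝ : RealNumbers) where
  open RealNumbers ℝ
  open Analysis ℝ

  -- Expectation over a vector of m independent Bernoulli(p) bits.
  𝔼-bits : Carrier → ∀ m → (Vec Bool m → Carrier) → Carrier
  𝔼-bits p zero    f = f Vec.[]
  𝔼-bits p (suc m) f = p        * 𝔼-bits p m (λ v → f (true  Vec.∷ v))
                     + (1# - p) * 𝔼-bits p m (λ v → f (false Vec.∷ v))

  𝔼 : Carrier → ∀ n → (Graph n → Carrier) → Carrier
  𝔼 p zero    f = f []
  𝔼 p (suc n) f = 𝔼-bits p n λ v → 𝔼 p n λ G → f (v ∷ G)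

  -- The supremum is 1 if A holds and 0 otherwise; taking a supremum avoids
  -- asking for a decision procedure.
  𝟙 : Set → Carrier
  𝟙 A = sup λ x → x ≈ 0# ⊎ (x ≈ 1# × A)

  Pr : ∀ n → Carrier → (Graph n → Set) → Carrier
  Pr n p A = 𝔼 p n λ G → 𝟙 (A G)

  AAS : (ℕ → Carrier) → (∀ n → Graph n → Set) → Set
  AAS p A = (λ n → Pr n (p n) (A n)) ⟶ 1#

  AlmostCoveredByTrees : ∀ {n} → ℕ → Carrier → Graph n → Set
  AlmostCoveredByTrees {n} r b G = (χ : Colouring r n) → Σ (List (Subgraph G)) λ Ts →
    length Ts ℕ.≤ r ×
    All (λ T → Tree T × Monochromatic χ T) Ts ×
    VertexDisjoint Ts ×
    fromℕ ∣ ∁ (covered Ts) ∣ ≤ b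

{-# OPTIONS --safe #-}

module Submission where

-- The real numbers decide ≤, so every statement about probabilities is stable
-- under double negation and the combinatorics may be done classically.
--
-- Randomness enters through two first-moment estimates for sums of terms
-- 2 ^ (- N), whose means factorise over independent edges: almost surely any k
-- vertices have more than 2 log₂ n common neighbours if p ^ k n is a suitable
-- multiple of log n, and almost surely there are more than |B| log₂ n edges
-- between disjoint sets A and B with |A| ≈ 4 r log n / p and |B| ≥ 3 r |A|.
--
-- (ii) Of r + 1 vertices, two send edges of one colour to a common neighbour.
-- So a maximal set of vertices in pairwise different components has at most r
-- elements, and their components cover everything.
--
-- (i) By the same argument and König's theorem two components cover everything.
-- Two components of the same colour are disjoint.  If a red component of x and
-- a blue component of y are needed, then every common neighbour of x and y is
-- red to x and blue to y.  A suitable (random) distribution of the common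
-- neighbours over two stars at x and y catches every other vertex v, by an edge
-- from v to some w in the colour of the star of w.
--
-- (iii) Greedily find centres x₁, x₂, … and sets W ⊇ W′ ⊇ … such that the current
-- W is joined to the i-th centre in the i-th colour.  When few vertices send
-- almost no edges of these colours to W, distribute W over the stars as in (i).
-- Otherwise one of those vertices is the next centre.  When a single colour is
-- left, a reserved random part of W spans a giant component of this colour
-- together with the vertices that cannot be caught by the other colours.

-- Each sum runs over all vertex sets of a family at once, so a value below 1 forces the bound on N
-- in every term: Markov's inequality and the union bound are one step. A set is weighted by n^-2
-- per vertex. The total weight is then at most 2 and no binomial coefficient appears; the decay in
-- p only has to beat n^2 per vertex.
--
-- The scale log₂ n comes from distributing vertices over stars. Let 2^l ≤ n < 2^(1+l). A vertex
-- with r (2 + l) usable edges is missed by a uniform choice of r colours with probability at most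
-- 2^-(2+l), so the expected number of missed vertices is below one half. The other half pays for
-- the reserved part of W.
--
-- The exponent 1/r in (iii) is the price of the greedy rounds. A vertex with few usable edges but
-- average degree into W keeps, in its most frequent missing colour, a share of W of order log n /
-- |A|, which is of order p. After r - 1 rounds about p^(r-1) n vertices of W are left. The final
-- distribution and the giant component need a multiple of |A|, that is of log n / p, and this is
-- the hypothesis p^r n ≥ C log n.

open import Defs
open import Level using (0ℓ)
open import Algebra.Bundles using (CommutativeRing)
open import Data.Bool.Base using (Bool; true; false; not; _∧_; _∨_; if_then_else_)
open import Data.Bool.Properties using (∧-comm; ∧-zeroʳ; ∨-comm; ∨-identityʳ; ¬-not) renaming (_≟_ to _≟ᵇ_)
open import Data.Fin.Base using (Fin; zero; suc; remQuot; combine)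
open import Data.Fin.Properties using (_≟_; any?; all?; pigeonhole; remQuot-combine; <⇒≢; ¬∀⟶∃¬)
open import Data.Fin.Subset using (Subset; _∈_; ∁; _∩_; Empty; ∣_∣)
open import Data.Fin.Subset.Properties using (∈⊤; x∈p∪q⁺; x∈p∩q⁻; ⊆-antisym)
open import Data.List.Base as List using (List; []; _∷_; _∷ʳ_; length; map; allFin)
open import Data.List.Properties using (length-tabulate)
open import Data.List.Relation.Unary.All as All using (All; []; _∷_)
open import Data.List.Relation.Unary.All.Properties using (tabulate⁺)
open import Data.List.Relation.Unary.AllPairs using ([]; _∷_)
open import Data.List.Relation.Unary.Any using (here; there)
open import Data.List.Relation.Unary.Linked using (Linked; [-]; _∷_)
open import Data.List.Relation.Unary.Unique.Propositional using (Unique)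
open import Data.List.Relation.Unary.Unique.Propositional.Properties using (allFin⁺)
import Data.List.Membership.Propositional as List
open import Data.List.Membership.Propositional.Properties using (∈-allFin)
open import Data.Maybe.Base using (Maybe; just; nothing; is-just)
open import Data.Maybe.Properties using (just-injective)
open import Data.Nat.Base as ℕ using (ℕ; zero; suc; _!)
open import Data.Nat.Induction using (<-rec)
import Data.Nat.Properties as ℕ
open import Data.Nat.Solver using (module +-*-Solver)
open import Data.Product.Base using (Σ; ∃; _×_; _,_; proj₁; proj₂)
open import Data.Sum.Base as Sum using (_⊎_; inj₁; inj₂)
open import Data.Vec.Base as Vec using (Vec; []; _∷_; lookup)
open import Data.Vec.Functional as Vector using ()
open import Data.Vec.Properties using (lookup∘tabulate; lookup-map; []=⇒lookup; lookup⇒[]=)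
open import Function.Base using (id; _∘_)
open import Relation.Binary.Bundles using (DecTotalOrder)
open import Relation.Binary.Construct.Closure.ReflexiveTransitive as Star using (Star; ε; _◅_; _◅◅_)
open import Relation.Binary.PropositionalEquality.Core as ≡ using (_≡_; _≢_; cong; cong₂)
open import Relation.Nullary using (¬_; Dec; does; yes; no; contradiction)
open import Relation.Nullary.Decidable using (dec-true; dec-false; ¬¬-excluded-middle; _×-dec_; _⊎-dec_)
open import Algebra.Properties.CommutativeMonoid.Sum ℕ.+-0-commutativeMonoid using (sum; ∑-distrib-+; ∑-comm; sum-cong-≗)
open import Algebra.Properties.Semiring.Sum ℕ.+-*-semiring using (*-distribˡ-sum)
import Algebra.Properties.CommutativeSemiring.Exp
import Algebra.Properties.Ring
import Algebra.Properties.Semiring.Mult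
import Algebra.Solver.Ring.NaturalCoefficients.Default
import Relation.Binary.Properties.DecTotalOrder
import Relation.Binary.Properties.Poset
import Relation.Binary.Reasoning.PartialOrder

-- Ordered fields

module OrderedField (ℝ : RealNumbers) where
  open RealNumbers ℝ
  open CommutativeRing commutativeRing public
    using (refl; sym; trans; reflexive; commutativeSemiring; +-cong; +-congˡ; +-congʳ;
           *-cong; *-congˡ; *-congʳ; +-comm; +-assoc; *-comm; *-assoc; +-identityˡ; +-identityʳ;
           *-identityˡ; *-identityʳ; zeroˡ; zeroʳ; distribˡ; distribʳ; -‿inverseʳ; -‿inverseˡ; -‿cong)

  decTotalOrder : DecTotalOrder 0ℓ 0ℓ 0ℓ
  decTotalOrder = record { isDecTotalOrder = isDecTotalOrder }

  open DecTotalOrder decTotalOrder public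
    using (_≤?_; poset)
    renaming (refl to ≤-refl; trans to ≤-trans; antisym to ≤-antisym; reflexive to ≤-reflexive)
  open Relation.Binary.Properties.DecTotalOrder decTotalOrder public
    using (≰⇒>; ≮⇒≥)
  open Relation.Binary.Properties.Poset poset public
    using (<⇒≱)
  open Algebra.Properties.CommutativeSemiring.Exp commutativeSemiring public
    using (^-congˡ; ^-homo-*; ^-assocʳ; ^-distrib-*)
  open Algebra.Properties.Semiring.Mult semiring public
    using (×-homo-+; ×1-homo-*)
  module ≤-Reasoning = Relation.Binary.Reasoning.PartialOrder poset
  module Solver = Algebra.Solver.Ring.NaturalCoefficients.Default commutativeSemiring
  open Solver public using (solve; _:=_; _:+_; _:*_; con)

  <⇒≤ : ∀ {x y} → x < y → x ≤ y
  <⇒≤ = proj₁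

  ≤-resp : ∀ {x x′ y y′} → x ≈ x′ → y ≈ y′ → x ≤ y → x′ ≤ y′
  ≤-resp e f p = ≤-trans (≤-reflexive (sym e)) (≤-trans p (≤-reflexive f))

  <-≤-trans : ∀ {x y z} → x < y → y ≤ z → x < z
  <-≤-trans (p , q) r = ≤-trans p r , λ e → q (≤-antisym p (≤-trans r (≤-reflexive (sym e))))

  ≤-<-trans : ∀ {x y z} → x ≤ y → y < z → x < z
  ≤-<-trans r (p , q) = ≤-trans r p , λ e → q (≤-antisym p (≤-trans (≤-reflexive (sym e)) r))

  +-monoʳ-≤ : ∀ z {x y} → x ≤ y → z + x ≤ z + y
  +-monoʳ-≤ z p = ≤-resp (+-comm _ z) (+-comm _ z) (+-monoˡ-≤ z p)

  +-mono-≤ : ∀ {x y u v} → x ≤ y → u ≤ v → x + u ≤ y + v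
  +-mono-≤ p q = ≤-trans (+-monoˡ-≤ _ p) (+-monoʳ-≤ _ q)

  x-x+y : ∀ x y → (y - x) + x ≈ y
  x-x+y x y = trans (+-assoc y (- x) x) (trans (+-congˡ (-‿inverseˡ x)) (+-identityʳ y))

  x+y-x : ∀ x y → (y + x) - x ≈ y
  x+y-x x y = trans (+-assoc y x (- x)) (trans (+-congˡ (-‿inverseʳ x)) (+-identityʳ y))

  +-cancelʳ-≤ : ∀ z {x y} → x + z ≤ y + z → x ≤ y
  +-cancelʳ-≤ z p = ≤-resp (x+y-x z _) (x+y-x z _) (+-monoˡ-≤ (- z) p)

  +-cancelˡ-≤ : ∀ z {x y} → z + x ≤ z + y → x ≤ y
  +-cancelˡ-≤ z p = +-cancelʳ-≤ z (≤-resp (+-comm z _) (+-comm z _) p)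

  +-cancelʳ-≈ : ∀ z {x y} → x + z ≈ y + z → x ≈ y
  +-cancelʳ-≈ z e = ≤-antisym (+-cancelʳ-≤ z (≤-reflexive e)) (+-cancelʳ-≤ z (≤-reflexive (sym e)))

  +-monoˡ-< : ∀ z {x y} → x < y → x + z < y + z
  +-monoˡ-< z (p , q) = +-monoˡ-≤ z p , λ e → q (+-cancelʳ-≈ z e)

  +-monoʳ-< : ∀ z {x y} → x < y → z + x < z + y
  +-monoʳ-< z (p , q) = +-monoʳ-≤ z p , λ e → q (+-cancelʳ-≈ z (trans (+-comm _ z) (trans e (+-comm z _))))

  x≤y⇒0≤y-x : ∀ {x y} → x ≤ y → 0# ≤ y - x
  x≤y⇒0≤y-x {x} {y} p = ≤-resp (-‿inverseʳ x) refl (+-monoˡ-≤ (- x) p)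

  x<y⇒0<y-x : ∀ {x y} → x < y → 0# < y - x
  x<y⇒0<y-x {x} {y} p = ≤-<-trans (≤-reflexive (sym (-‿inverseʳ x))) (+-monoˡ-< (- x) p)

  x≤x+y : ∀ {x y} → 0# ≤ y → x ≤ x + y
  x≤x+y p = ≤-resp (+-identityʳ _) refl (+-monoʳ-≤ _ p)

  x≤y+x : ∀ {x y} → 0# ≤ y → x ≤ y + x
  x≤y+x p = ≤-resp (+-identityˡ _) refl (+-monoˡ-≤ _ p)

  +-nonNeg : ∀ {x y} → 0# ≤ x → 0# ≤ y → 0# ≤ x + y
  +-nonNeg p q = ≤-trans p (x≤x+y q)

  *-monoʳ-≤ : ∀ {z} → 0# ≤ z → ∀ {x y} → x ≤ y → z * x ≤ z * y
  *-monoʳ-≤ {z} p {x} {y} q = begin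
    z * x                    ≤⟨ x≤y+x (*-nonNeg p (x≤y⇒0≤y-x q)) ⟩
    z * (y - x) + z * x      ≈⟨ distribˡ z (y - x) x ⟨
    z * ((y - x) + x)        ≈⟨ *-congˡ (x-x+y x y) ⟩
    z * y                    ∎
    where open ≤-Reasoning

  *-monoˡ-≤ : ∀ {z} → 0# ≤ z → ∀ {x y} → x ≤ y → x * z ≤ y * z
  *-monoˡ-≤ p q = ≤-resp (*-comm _ _) (*-comm _ _) (*-monoʳ-≤ p q)

  *-mono-≤ : ∀ {x y u v} → 0# ≤ x → 0# ≤ v → x ≤ y → u ≤ v → x * u ≤ y * v
  *-mono-≤ p q r s = ≤-trans (*-monoʳ-≤ p s) (*-monoˡ-≤ q r)

  0≤1 : 0# ≤ 1#
  0≤1 with total 0# 1#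
  ... | inj₁ p = p
  ... | inj₂ p = ≤-resp refl (trans (-x*-y≈x*y 1# 1#) (*-identityˡ 1#)) (*-nonNeg q q)
    where
      open Algebra.Properties.Ring (CommutativeRing.ring commutativeRing)
      -x*-y≈x*y : ∀ x y → - x * - y ≈ x * y
      -x*-y≈x*y x y = trans (sym (-‿distribˡ-* x (- y)))
        (trans (-‿cong (sym (-‿distribʳ-* x y))) (-‿involutive (x * y)))
      q : 0# ≤ - 1#
      q = ≤-resp refl (+-identityˡ (- 1#)) (x≤y⇒0≤y-x p)

  0<1 : 0# < 1#
  0<1 = 0≤1 , 0≉1

  *-inverseˡ : ∀ {x} → 0# < x → x ⁻¹ * x ≈ 1#
  *-inverseˡ {x} p = trans (*-comm _ _) (⁻¹-inverseʳ x (λ e → proj₂ p (sym e)))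

  *-inverseʳ : ∀ {x} → 0# < x → x * x ⁻¹ ≈ 1#
  *-inverseʳ {x} p = ⁻¹-inverseʳ x (λ e → proj₂ p (sym e))

  ⁻¹-nonNeg : ∀ {x} → 0# < x → 0# ≤ x ⁻¹
  ⁻¹-nonNeg {x} p with total 0# (x ⁻¹)
  ... | inj₁ q = q
  ... | inj₂ q = contradiction
    (≤-resp (*-inverseʳ p) (zeroʳ x) (*-monoʳ-≤ (<⇒≤ p) q)) (<⇒≱ 0<1)

  ⁻¹-pos : ∀ {x} → 0# < x → 0# < x ⁻¹
  ⁻¹-pos {x} p = ⁻¹-nonNeg p ,
    λ e → 0≉1 (trans (sym (zeroʳ x)) (trans (*-congˡ e) (*-inverseʳ p)))

  x⁻¹*[x*y] : ∀ {x} → 0# < x → ∀ y → x ⁻¹ * (x * y) ≈ y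
  x⁻¹*[x*y] p y = trans (sym (*-assoc _ _ y)) (trans (*-congʳ (*-inverseˡ p)) (*-identityˡ y))

  x*[x⁻¹*y] : ∀ {x} → 0# < x → ∀ y → x * (x ⁻¹ * y) ≈ y
  x*[x⁻¹*y] p y = trans (sym (*-assoc _ _ y)) (trans (*-congʳ (*-inverseʳ p)) (*-identityˡ y))

  *-cancelˡ-≤ : ∀ {z} → 0# < z → ∀ {x y} → z * x ≤ z * y → x ≤ y
  *-cancelˡ-≤ p q = ≤-resp (x⁻¹*[x*y] p _) (x⁻¹*[x*y] p _) (*-monoʳ-≤ (⁻¹-nonNeg p) q)

  *-cancelʳ-≤ : ∀ {z} → 0# < z → ∀ {x y} → x * z ≤ y * z → x ≤ y
  *-cancelʳ-≤ p q = *-cancelˡ-≤ p (≤-resp (*-comm _ _) (*-comm _ _) q)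

  *-monoʳ-< : ∀ {z} → 0# < z → ∀ {x y} → x < y → z * x < z * y
  *-monoʳ-< p (q , r) = *-monoʳ-≤ (<⇒≤ p) q ,
    λ e → r (≤-antisym q (*-cancelˡ-≤ p (≤-reflexive (sym e))))

  *-monoˡ-< : ∀ {z} → 0# < z → ∀ {x y} → x < y → x * z < y * z
  *-monoˡ-< {z} p {x} {y} q = ≤-<-trans (≤-reflexive (*-comm x z))
    (<-≤-trans (*-monoʳ-< p q) (≤-reflexive (*-comm z y)))

  *-pos : ∀ {x y} → 0# < x → 0# < y → 0# < x * y
  *-pos {x} p q = ≤-<-trans (≤-reflexive (sym (zeroʳ x))) (*-monoʳ-< p q)

  +-pos : ∀ {x y} → 0# < x → 0# ≤ y → 0# < x + y
  +-pos p q = <-≤-trans p (x≤x+y q)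

  ^-nonNeg : ∀ {x} k → 0# ≤ x → 0# ≤ x ^ k
  ^-nonNeg zero    p = 0≤1
  ^-nonNeg (suc k) p = *-nonNeg p (^-nonNeg k p)

  ^-pos : ∀ {x} k → 0# < x → 0# < x ^ k
  ^-pos zero    p = 0<1
  ^-pos (suc k) p = *-pos p (^-pos k p)

  ^-monoˡ-≤ : ∀ {x y} k → 0# ≤ x → x ≤ y → x ^ k ≤ y ^ k
  ^-monoˡ-≤ zero    p q = ≤-refl
  ^-monoˡ-≤ (suc k) p q = *-mono-≤ p (^-nonNeg k (≤-trans p q)) q (^-monoˡ-≤ k p q)

  ^-monoˡ-< : ∀ {x y} k → 0# ≤ x → x < y → x ^ suc k < y ^ suc k
  ^-monoˡ-< k p q = ≤-<-trans (*-monoʳ-≤ p (^-monoˡ-≤ k p (<⇒≤ q)))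
    (*-monoˡ-< (^-pos k (≤-<-trans p q)) q)

  ^-cancelˡ-≤ : ∀ {x y} k → 0# ≤ y → x ^ suc k ≤ y ^ suc k → x ≤ y
  ^-cancelˡ-≤ {x} {y} k p q with x ≤? y
  ... | yes r = r
  ... | no r  = contradiction q (<⇒≱ (^-monoˡ-< k p (≰⇒> r)))

  1≤x^k : ∀ {x} k → 1# ≤ x → 1# ≤ x ^ k
  1≤x^k zero    p = ≤-refl
  1≤x^k (suc k) p = ≤-resp (*-identityˡ 1#) refl (*-mono-≤ 0≤1 (≤-trans 0≤1 (1≤x^k k p)) p (1≤x^k k p))

  x^k≤1 : ∀ {x} k → 0# ≤ x → x ≤ 1# → x ^ k ≤ 1#
  x^k≤1 zero    p q = ≤-refl
  x^k≤1 (suc k) p q = ≤-resp refl (*-identityˡ 1#) (*-mono-≤ p 0≤1 q (x^k≤1 k p q))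

  ^-monoʳ-≤ : ∀ {x} {j k} → 1# ≤ x → j ℕ.≤ k → x ^ j ≤ x ^ k
  ^-monoʳ-≤ {x} {_} {k} p ℕ.z≤n      = 1≤x^k k p
  ^-monoʳ-≤ {x} p (ℕ.s≤s q) = *-monoʳ-≤ (≤-trans 0≤1 p) (^-monoʳ-≤ p q)

  ^-antimonoʳ-≤ : ∀ {x} {j k} → 0# ≤ x → x ≤ 1# → j ℕ.≤ k → x ^ k ≤ x ^ j
  ^-antimonoʳ-≤ {x} {_} {k} p q ℕ.z≤n     = x^k≤1 k p q
  ^-antimonoʳ-≤ {x} p q (ℕ.s≤s r) = *-monoʳ-≤ p (^-antimonoʳ-≤ p q r)

  1^k≈1 : ∀ k → 1# ^ k ≈ 1#
  1^k≈1 zero    = refl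
  1^k≈1 (suc k) = trans (*-identityˡ _) (1^k≈1 k)

  fromℕ-+ : ∀ m n → fromℕ (m ℕ.+ n) ≈ fromℕ m + fromℕ n
  fromℕ-+ m n = ×-homo-+ 1# m n

  fromℕ-* : ∀ m n → fromℕ (m ℕ.* n) ≈ fromℕ m * fromℕ n
  fromℕ-* = ×1-homo-*

  fromℕ-1 : fromℕ 1 ≈ 1#
  fromℕ-1 = +-identityʳ 1#

  fromℕ-^ : ∀ m k → fromℕ (m ℕ.^ k) ≈ fromℕ m ^ k
  fromℕ-^ m zero    = fromℕ-1
  fromℕ-^ m (suc k) = trans (fromℕ-* m (m ℕ.^ k)) (*-congˡ (fromℕ-^ m k))

  fromℕ-nonNeg : ∀ n → 0# ≤ fromℕ n
  fromℕ-nonNeg zero    = ≤-refl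
  fromℕ-nonNeg (suc n) = +-nonNeg 0≤1 (fromℕ-nonNeg n)

  fromℕ-pos : ∀ n → 0# < fromℕ (suc n)
  fromℕ-pos n = +-pos 0<1 (fromℕ-nonNeg n)

  fromℕ-pos′ : ∀ {n} → 1 ℕ.≤ n → 0# < fromℕ n
  fromℕ-pos′ {suc n} _ = fromℕ-pos n

  fromℕ-mono-≤ : ∀ {m n} → m ℕ.≤ n → fromℕ m ≤ fromℕ n
  fromℕ-mono-≤ {n = n} ℕ.z≤n = fromℕ-nonNeg n
  fromℕ-mono-≤ (ℕ.s≤s p)     = +-monoʳ-≤ 1# (fromℕ-mono-≤ p)

  fromℕ-mono-< : ∀ {m n} → m ℕ.< n → fromℕ m < fromℕ n
  fromℕ-mono-< {m} p = <-≤-trans (≤-<-trans (≤-reflexive (sym (+-identityˡ _))) (+-monoˡ-< (fromℕ m) 0<1)) (fromℕ-mono-≤ p)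

  fromℕ-cancel-≤ : ∀ {m n} → fromℕ m ≤ fromℕ n → m ℕ.≤ n
  fromℕ-cancel-≤ {m} {n} p with m ℕ.≤? n
  ... | yes q = q
  ... | no q  = contradiction p (<⇒≱ (fromℕ-mono-< (ℕ.≰⇒> q)))

  ½ : Carrier
  ½ = fromℕ 2 ⁻¹

  ½+½≈1 : ½ + ½ ≈ 1#
  ½+½≈1 = trans (solve 1 (λ h → h :+ h := (con 1 :+ (con 1 :+ con 0)) :* h) refl ½) (*-inverseʳ (fromℕ-pos 1))

  0<½ : 0# < ½
  0<½ = ⁻¹-pos (fromℕ-pos 1)

  2*½≈1 : fromℕ 2 * ½ ≈ 1#
  2*½≈1 = *-inverseʳ (fromℕ-pos 1)

-- The exponential series and the logarithm

1≤k! : ∀ k → 1 ℕ.≤ k !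
1≤k! zero    = ℕ.≤-refl
1≤k! (suc k) = ℕ.≤-trans (1≤k! k) (ℕ.m≤m+n (k !) _)

n<2^n : ∀ n → n ℕ.< 2 ℕ.^ n
n<2^n zero    = ℕ.≤-refl
n<2^n (suc n) = ℕ.≤-trans (ℕ.+-mono-≤ (ℕ.≤-trans (ℕ.s≤s ℕ.z≤n) (n<2^n n)) (n<2^n n))
  (ℕ.+-monoʳ-≤ (2 ℕ.^ n) (ℕ.≤-reflexive (≡.sym (ℕ.+-identityʳ _))))

module ExponentialSeries (ℝ : RealNumbers) where
  open RealNumbers ℝ
  open Analysis ℝ
  open OrderedField ℝ
  open ≤-Reasoning

  abs-< : ∀ {x b} → x < b → - x < b → abs x < b
  abs-< {x} p q with total 0# x
  ... | inj₁ _ = p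
  ... | inj₂ _ = q

  abs-≤ : ∀ {x b} → x ≤ b → - x ≤ b → abs x ≤ b
  abs-≤ {x} p q with total 0# x
  ... | inj₁ _ = p
  ... | inj₂ _ = q

  x≤abs : ∀ x → x ≤ abs x
  x≤abs x with total 0# x
  ... | inj₁ _ = ≤-refl
  ... | inj₂ p = ≤-trans p (≤-resp refl (+-identityˡ (- x)) (x≤y⇒0≤y-x p))

  term : Carrier → ℕ → Carrier
  term y k = y ^ k / fromℕ (k !)

  private
    f! : ℕ → Carrier
    f! k = fromℕ (k !)

    f!-pos : ∀ k → 0# < f! k
    f!-pos k = fromℕ-pos′ (1≤k! k)

    term*k! : ∀ y k → term y k * f! k ≈ y ^ k
    term*k! y k = trans (*-assoc _ _ _) (trans (*-congˡ (*-inverseˡ (f!-pos k))) (*-identityʳ _))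

    f!-suc : ∀ k → f! (suc k) ≈ fromℕ (suc k) * f! k
    f!-suc k = fromℕ-* (suc k) (k !)

    term*[1+k]! : ∀ y k → term y k * f! (suc k) ≈ fromℕ (suc k) * y ^ k
    term*[1+k]! y k = begin-equality
      term y k * f! (suc k)               ≈⟨ *-congˡ (f!-suc k) ⟩
      term y k * (fromℕ (suc k) * f! k)   ≈⟨ solve 3 (λ t s f → t :* (s :* f) := s :* (t :* f)) refl _ _ _ ⟩
      fromℕ (suc k) * (term y k * f! k)   ≈⟨ *-congˡ (term*k! y k) ⟩
      fromℕ (suc k) * y ^ k               ∎

  term-nonNeg : ∀ {y} k → 0# ≤ y → 0# ≤ term y k
  term-nonNeg k p = *-nonNeg (^-nonNeg k p) (⁻¹-nonNeg (f!-pos k))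

  term-mono : ∀ {y z} k → 0# ≤ y → y ≤ z → term y k ≤ term z k
  term-mono k p q = *-monoˡ-≤ (⁻¹-nonNeg (f!-pos k)) (^-monoˡ-≤ k p q)

  term-suc : ∀ y k → fromℕ (suc k) * term y (suc k) ≈ y * term y k
  term-suc y k = ≤-antisym (*-cancelʳ-≤ (f!-pos k) (≤-reflexive e)) (*-cancelʳ-≤ (f!-pos k) (≤-reflexive (sym e)))
    where
      e : fromℕ (suc k) * term y (suc k) * f! k ≈ y * term y k * f! k
      e = begin-equality
        fromℕ (suc k) * term y (suc k) * f! k   ≈⟨ solve 3 (λ s t f → s :* t :* f := t :* (s :* f)) refl _ _ _ ⟩
        term y (suc k) * (fromℕ (suc k) * f! k) ≈⟨ *-congˡ (f!-suc k) ⟨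
        term y (suc k) * f! (suc k)             ≈⟨ term*k! y (suc k) ⟩
        y * y ^ k                               ≈⟨ *-congˡ (term*k! y k) ⟨
        y * (term y k * f! k)                   ≈⟨ *-assoc _ _ _ ⟨
        y * term y k * f! k                     ∎

  expSum-mono : ∀ {y z} k → 0# ≤ y → y ≤ z → expSum y k ≤ expSum z k
  expSum-mono zero    p q = ≤-refl
  expSum-mono (suc k) p q = +-mono-≤ (expSum-mono k p q) (term-mono k p q)

  expSum-step : ∀ {y} k → 0# ≤ y → expSum y k ≤ expSum y (suc k)
  expSum-step k p = x≤x+y (term-nonNeg k p)

  expSum-monoʳ : ∀ {y j k} → 0# ≤ y → j ℕ.≤ k → expSum y j ≤ expSum y k
  expSum-monoʳ {y} {j} p q = go (ℕ.≤⇒≤′ q)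
    where
      go : ∀ {k} → j ℕ.≤′ k → expSum y j ≤ expSum y k
      go (ℕ.≤′-reflexive ≡.refl) = ≤-refl
      go {suc k} (ℕ.≤′-step r) = ≤-trans (go r) (expSum-step k p)

  -- The mean value inequality for a convex power, with the slope taken at the right end. Summed
  -- over the series it controls the exponential; for a single power it gives the continuity behind
  -- `root≤⇒≤^`.
  ^-upper-tangent : ∀ {a x} k → 0# ≤ a → 0# ≤ x →
    (a + x) ^ suc k ≤ a ^ suc k + x * (fromℕ (suc k) * (a + x) ^ k)
  ^-upper-tangent {a} {x} zero p q = ≤-reflexive
    (solve 2 (λ a x → (a :+ x) :* con 1 := a :* con 1 :+ x :* ((con 1 :+ con 0) :* con 1)) refl a x)
  ^-upper-tangent {a} {x} (suc k) p q = begin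
    z * z ^ suc k                                        ≈⟨ distribʳ _ _ _ ⟩
    a * z ^ suc k + x * z ^ suc k                        ≤⟨ +-monoˡ-≤ _ (*-monoʳ-≤ p (^-upper-tangent k p q)) ⟩
    a * (a ^ suc k + x * (s * z ^ k)) + x * z ^ suc k
      ≈⟨ solve 6 (λ a x u s w v → a :* (u :+ x :* (s :* w)) :+ x :* v
                   := a :* u :+ (x :* (s :* w) :* a :+ x :* v)) refl a x (a ^ suc k) s (z ^ k) (z ^ suc k) ⟩
    a * a ^ suc k + (x * (s * z ^ k) * a + x * z ^ suc k)
      ≤⟨ +-monoʳ-≤ _ (+-monoˡ-≤ _ (*-monoʳ-≤ (*-nonNeg q (*-nonNeg (fromℕ-nonNeg (suc k)) (^-nonNeg k 0≤z))) (x≤x+y q))) ⟩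
    a * a ^ suc k + (x * (s * z ^ k) * z + x * z ^ suc k)
      ≈⟨ +-congˡ (solve 4 (λ x s w z → x :* (s :* w) :* z :+ x :* (z :* w)
                   := x :* ((con 1 :+ s) :* (z :* w))) refl x s (z ^ k) z) ⟩
    a * a ^ suc k + x * (fromℕ (suc (suc k)) * z ^ suc k)  ∎
    where
      z = a + x
      s = fromℕ (suc k)
      0≤z : 0# ≤ z
      0≤z = +-nonNeg p q

  ^-lower-tangent : ∀ {a} k → 0# ≤ a → a ^ suc k + fromℕ (suc k) * a ^ k ≤ (a + 1#) ^ suc k
  ^-lower-tangent {a} zero p = ≤-reflexive
    (solve 1 (λ a → a :* con 1 :+ (con 1 :+ con 0) :* con 1 := (a :+ con 1) :* con 1) refl a)
  ^-lower-tangent {a} (suc k) p = begin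
    a * a ^ suc k + (1# + s) * (a * a ^ k)
      ≤⟨ x≤x+y (*-nonNeg (fromℕ-nonNeg (suc k)) (^-nonNeg k p)) ⟩
    a * a ^ suc k + (1# + s) * (a * a ^ k) + s * a ^ k
      ≈⟨ solve 3 (λ a s w → a :* (a :* w) :+ (con 1 :+ s) :* (a :* w) :+ s :* w
                   := (a :+ con 1) :* (a :* w :+ s :* w)) refl a s (a ^ k) ⟩
    (a + 1#) * (a ^ suc k + s * a ^ k)
      ≤⟨ *-monoʳ-≤ (+-nonNeg p 0≤1) (^-lower-tangent k p) ⟩
    (a + 1#) * (a + 1#) ^ suc k ∎
    where s = fromℕ (suc k)

  term-upper-tangent : ∀ {a x} k → 0# ≤ a → 0# ≤ x →
    term (a + x) (suc k) ≤ term a (suc k) + x * term (a + x) k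
  term-upper-tangent {a} {x} k p q = *-cancelʳ-≤ (f!-pos (suc k)) (begin
    term (a + x) (suc k) * F                      ≈⟨ term*k! _ (suc k) ⟩
    (a + x) ^ suc k                               ≤⟨ ^-upper-tangent k p q ⟩
    a ^ suc k + x * (fromℕ (suc k) * (a + x) ^ k) ≈⟨ +-cong (term*k! a (suc k)) (*-congˡ (term*[1+k]! (a + x) k)) ⟨
    term a (suc k) * F + x * (term (a + x) k * F) ≈⟨ solve 4 (λ t F x v → t :* F :+ x :* (v :* F) := (t :+ x :* v) :* F) refl _ _ _ _ ⟩
    (term a (suc k) + x * term (a + x) k) * F     ∎)
    where F = f! (suc k)

  term-lower-tangent : ∀ {a} k → 0# ≤ a → term a (suc k) + term a k ≤ term (a + 1#) (suc k)
  term-lower-tangent {a} k p = *-cancelʳ-≤ (f!-pos (suc k)) (begin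
    (term a (suc k) + term a k) * F       ≈⟨ distribʳ _ _ _ ⟩
    term a (suc k) * F + term a k * F     ≈⟨ +-cong (term*k! a (suc k)) (term*[1+k]! a k) ⟩
    a ^ suc k + fromℕ (suc k) * a ^ k     ≤⟨ ^-lower-tangent k p ⟩
    (a + 1#) ^ suc k                      ≈⟨ term*k! _ (suc k) ⟨
    term (a + 1#) (suc k) * F             ∎)
    where F = f! (suc k)

  expSum-upper-tangent : ∀ {a x} k → 0# ≤ a → 0# ≤ x →
    expSum (a + x) (suc k) ≤ expSum a (suc k) + x * expSum (a + x) k
  expSum-upper-tangent {a} {x} zero p q = x≤x+y (≤-reflexive (sym (zeroʳ x)))
  expSum-upper-tangent {a} {x} (suc k) p q = begin
    expSum z (suc k) + term z (suc k)
      ≤⟨ +-mono-≤ (expSum-upper-tangent k p q) (term-upper-tangent k p q) ⟩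
    (expSum a (suc k) + x * expSum z k) + (term a (suc k) + x * term z k)
      ≈⟨ solve 5 (λ A x Ex t v → (A :+ x :* Ex) :+ (t :+ x :* v) := (A :+ t) :+ x :* (Ex :+ v)) refl _ _ _ _ _ ⟩
    expSum a (suc (suc k)) + x * expSum z (suc k) ∎
    where z = a + x

  -- Here and below w stands for 1 - x, so that the semiring solver applies.
  expSum-decay : ∀ {a x w} k → 0# ≤ a → 0# ≤ x → x + w ≈ 1# → expSum (a + x) k * w ≤ expSum a k
  expSum-decay zero p q e = ≤-reflexive (zeroˡ _)
  expSum-decay {a} {x} {w} (suc k) p q e = +-cancelʳ-≤ (x * Ex) (begin
    Ex * w + x * Ex           ≈⟨ solve 3 (λ Ex w x → Ex :* w :+ x :* Ex := Ex :* (x :+ w)) refl Ex w x ⟩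
    Ex * (x + w)             ≈⟨ trans (*-congˡ e) (*-identityʳ Ex) ⟩
    Ex                       ≤⟨ expSum-upper-tangent k p q ⟩
    expSum a (suc k) + x * expSum (a + x) k
      ≤⟨ +-monoʳ-≤ _ (*-monoʳ-≤ q (expSum-step k (+-nonNeg p q))) ⟩
    expSum a (suc k) + x * Ex ∎)
    where Ex = expSum (a + x) (suc k)

  term-0 : ∀ y → term y 0 ≈ 1#
  term-0 y = trans (sym (*-identityʳ _)) (trans (*-congˡ (sym fromℕ-1)) (term*k! y 0))

  expSum-0 : ∀ k → expSum 0# (suc k) ≈ 1#
  expSum-0 zero    = trans (+-identityˡ _) (term-0 0#)
  expSum-0 (suc k) = trans (+-cong (expSum-0 k) (trans (*-congʳ (zeroˡ _)) (zeroˡ _))) (+-identityʳ 1#)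

  expSum-0≤1 : ∀ k → expSum 0# k ≤ 1#
  expSum-0≤1 zero    = 0≤1
  expSum-0≤1 (suc k) = ≤-reflexive (expSum-0 k)

  -- Each factor `w` = 1 - x undoes one shift of the argument by x (`expSum-decay`). So e^(mx) (1 -
  -- x)^m ≤ 1 is obtained without the functional equation of the exponential.
  expSum-upper : ∀ {x w} m k → 0# ≤ x → 0# ≤ w → x + w ≈ 1# → expSum (fromℕ m * x) k * w ^ m ≤ 1#
  expSum-upper {x} {w} zero k p q e = begin
    expSum (0# * x) k * 1#   ≈⟨ *-identityʳ _ ⟩
    expSum (0# * x) k        ≤⟨ expSum-mono k (≤-reflexive (sym (zeroˡ x))) (≤-reflexive (zeroˡ x)) ⟩
    expSum 0# k              ≤⟨ expSum-0≤1 k ⟩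
    1#                       ∎
  expSum-upper {x} {w} (suc m) k p q e = begin
    expSum ((1# + fromℕ m) * x) k * (w * w ^ m)
      ≤⟨ *-monoˡ-≤ (^-nonNeg (suc m) q) (expSum-mono k (*-nonNeg (fromℕ-nonNeg (suc m)) p)
           (≤-reflexive (solve 2 (λ m x → (con 1 :+ m) :* x := m :* x :+ x) refl _ _))) ⟩
    expSum (fromℕ m * x + x) k * (w * w ^ m) ≈⟨ *-assoc _ _ _ ⟨
    expSum (fromℕ m * x + x) k * w * w ^ m
      ≤⟨ *-monoˡ-≤ (^-nonNeg m q) (expSum-decay k (*-nonNeg (fromℕ-nonNeg m) p) p e) ⟩
    expSum (fromℕ m * x) k * w ^ m ≤⟨ expSum-upper m k p q e ⟩
    1# ∎

  -- The finite form of 2 e^a ≤ e^(a+1). The tangent bound shifts the index by one, hence the two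
  -- truncations on the left and the m + 1 terms in `2^m≤expSum`.
  expSum-double : ∀ {a} k → 0# ≤ a → expSum a (suc k) + expSum a k ≤ expSum (a + 1#) (suc k)
  expSum-double {a} zero p = ≤-reflexive (+-identityʳ _)
  expSum-double {a} (suc k) p = begin
    (expSum a (suc k) + term a (suc k)) + (expSum a k + term a k)
      ≈⟨ solve 4 (λ A B C D → (A :+ B) :+ (C :+ D) := (A :+ C) :+ (B :+ D)) refl _ _ _ _ ⟩
    (expSum a (suc k) + expSum a k) + (term a (suc k) + term a k)
      ≤⟨ +-mono-≤ (expSum-double k p) (term-lower-tangent k p) ⟩
    expSum (a + 1#) (suc (suc k)) ∎

  2^m≤expSum : ∀ m → fromℕ 2 ^ m ≤ expSum (fromℕ m) (suc m)
  2^m≤expSum zero    = ≤-reflexive (sym (expSum-0 0))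
  2^m≤expSum (suc m) = begin
    fromℕ 2 * fromℕ 2 ^ m              ≤⟨ *-monoʳ-≤ (fromℕ-nonNeg 2) (2^m≤expSum m) ⟩
    fromℕ 2 * Ex                        ≈⟨ solve 1 (λ Ex → (con 1 :+ (con 1 :+ con 0)) :* Ex := Ex :+ Ex) refl Ex ⟩
    Ex + Ex                              ≤⟨ +-monoˡ-≤ _ (expSum-step (suc m) (fromℕ-nonNeg m)) ⟩
    expSum (fromℕ m) (suc (suc m)) + Ex ≤⟨ expSum-double (suc m) (fromℕ-nonNeg m) ⟩
    expSum (fromℕ m + 1#) (suc (suc m))
      ≤⟨ expSum-mono (suc (suc m)) (+-nonNeg (fromℕ-nonNeg m) 0≤1) (≤-reflexive (+-comm _ _)) ⟩
    expSum (fromℕ (suc m)) (suc (suc m)) ∎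
    where Ex = expSum (fromℕ m) (suc m)

  -- Once k ≥ 2y the terms at least halve, so the tail is at most twice the last term.
  module _ {y} (0≤y : 0# ≤ y) (K : ℕ) (y≤K/2 : y + y ≤ fromℕ K) where

    term-halves : ∀ k → K ℕ.≤ k → term y (suc k) + term y (suc k) ≤ term y k
    term-halves k K≤k = *-cancelˡ-≤ (fromℕ-pos k) (begin
      s * (t′ + t′)   ≈⟨ distribˡ _ _ _ ⟩
      s * t′ + s * t′ ≈⟨ +-cong (term-suc y k) (term-suc y k) ⟩
      y * t + y * t   ≈⟨ distribʳ _ _ _ ⟨
      (y + y) * t     ≤⟨ *-monoˡ-≤ (term-nonNeg k 0≤y) (≤-trans y≤K/2 (fromℕ-mono-≤ (ℕ.m≤n⇒m≤1+n K≤k))) ⟩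
      s * t           ∎)
      where
        s = fromℕ (suc k)
        t = term y k
        t′ = term y (suc k)

    tail-bound : ∀ k j → K ℕ.≤ k → expSum y (j ℕ.+ k) + (term y (j ℕ.+ k) + term y (j ℕ.+ k)) ≤ expSum y k + (term y k + term y k)
    tail-bound k zero    p = ≤-refl
    tail-bound k (suc j) p = begin
      (expSum y i + term y i) + (term y (suc i) + term y (suc i))
        ≤⟨ +-monoʳ-≤ _ (term-halves i (ℕ.≤-trans p (ℕ.m≤n+m k j))) ⟩
      (expSum y i + term y i) + term y i   ≈⟨ +-assoc _ _ _ ⟩
      expSum y i + (term y i + term y i)   ≤⟨ tail-bound k j p ⟩
      expSum y k + (term y k + term y k)   ∎
      where i = j ℕ.+ k

    expSum-tail : ∀ k i → K ℕ.≤ k → expSum y i ≤ expSum y k + (term y k + term y k)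
    expSum-tail k i p = begin
      expSum y i            ≤⟨ expSum-monoʳ 0≤y (ℕ.m≤m+n i k) ⟩
      expSum y (i ℕ.+ k)    ≤⟨ x≤x+y (+-nonNeg (term-nonNeg (i ℕ.+ k) 0≤y) (term-nonNeg (i ℕ.+ k) 0≤y)) ⟩
      _                     ≤⟨ tail-bound k i p ⟩
      expSum y k + (term y k + term y k) ∎

    term-geometric : ∀ j → fromℕ (2 ℕ.^ j) * term y (j ℕ.+ K) ≤ term y K
    term-geometric zero = ≤-reflexive (trans (*-congʳ fromℕ-1) (*-identityˡ _))
    term-geometric (suc j) = begin
      fromℕ (2 ℕ.* 2 ℕ.^ j) * t′        ≈⟨ *-congʳ (fromℕ-* 2 (2 ℕ.^ j)) ⟩
      fromℕ 2 * P * t′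
        ≈⟨ solve 2 (λ P t → (con 1 :+ (con 1 :+ con 0)) :* P :* t := P :* (t :+ t)) refl P t′ ⟩
      P * (t′ + t′)                     ≤⟨ *-monoʳ-≤ (fromℕ-nonNeg (2 ℕ.^ j)) (term-halves (j ℕ.+ K) (ℕ.m≤n+m K j)) ⟩
      P * term y (j ℕ.+ K)              ≤⟨ term-geometric j ⟩
      term y K                          ∎
      where
        P = fromℕ (2 ℕ.^ j)
        t′ = term y (suc j ℕ.+ K)

  -- The limit is the supremum of the partial sums. That some partial sum comes close to it cannot
  -- be read off from `sup` constructively, so the rate of convergence is taken from the geometric
  -- decay of the terms.
  exp-exists : ∀ {y b} → 0# ≤ y → (∀ k → expSum y k ≤ b) → ∃ λ e → (expSum y ⟶ e) × e ≤ b
  exp-exists {y} {b} 0≤y bound = e , converges , sup-least S (0# , 0 , refl) b below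
    where
      S : Carrier → Set
      S x = ∃ λ k → x ≈ expSum y k
      below : UpperBound S b
      below x (k , q) = ≤-trans (≤-reflexive q) (bound k)
      e = sup S
      K = proj₁ (archimedean (y + y))
      t = term y K + term y K
      converges : expSum y ⟶ e
      converges η 0<η = j ℕ.+ K , λ k p →
        abs-< (≤-<-trans (≤-resp refl (-‿inverseʳ e) (+-monoˡ-≤ (- e) (sup-upper S (0# , 0 , refl) (b , below) _ (k , refl)))) 0<η)
          (≤-<-trans (≤-reflexive (negate k)) (difference k p))
        where
          j = proj₁ (archimedean (t * η ⁻¹))
          negate : ∀ k → - (expSum y k - e) ≈ e - expSum y k
          negate k = +-cancelʳ-≈ (expSum y k - e) (trans (-‿inverseˡ _)
            (sym (trans (sym (+-assoc _ _ _)) (trans (+-congʳ (x-x+y _ e)) (-‿inverseʳ e)))))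
          -- As j ≥ t / η and 2^j > j, 2^j η exceeds t, whereas 2^j times the doubled term is at
          -- most t.
          small : term y (j ℕ.+ K) + term y (j ℕ.+ K) < η
          small with η ≤? (term y (j ℕ.+ K) + term y (j ℕ.+ K))
          ... | no q  = ≰⇒> q
          ... | yes q = contradiction (begin
            fromℕ (2 ℕ.^ j) * η      ≤⟨ *-monoʳ-≤ (fromℕ-nonNeg (2 ℕ.^ j)) q ⟩
            fromℕ (2 ℕ.^ j) * (term y (j ℕ.+ K) + term y (j ℕ.+ K)) ≈⟨ distribˡ _ _ _ ⟩
            _                        ≤⟨ +-mono-≤ (term-geometric 0≤y K K-large j) (term-geometric 0≤y K K-large j) ⟩
            t                        ≈⟨ x*[x⁻¹*y] 0<η t ⟨
            η * (η ⁻¹ * t)           ≈⟨ solve 3 (λ a b c → a :* (b :* c) := c :* b :* a) refl _ _ _ ⟩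
            t * η ⁻¹ * η             ≤⟨ *-monoˡ-≤ (<⇒≤ 0<η) (proj₂ (archimedean (t * η ⁻¹))) ⟩
            fromℕ j * η              ∎)
            (<⇒≱ (*-monoˡ-< 0<η (fromℕ-mono-< (n<2^n j))))
            where K-large = proj₂ (archimedean (y + y))
          difference : ∀ k → j ℕ.+ K ℕ.≤ k → e - expSum y k < η
          difference k p = ≤-<-trans (+-cancelʳ-≤ (expSum y k) (begin
            (e - expSum y k) + expSum y k  ≈⟨ x-x+y _ e ⟩
            e ≤⟨ sup-least S (0# , 0 , refl) _ (λ x r → ≤-trans (≤-reflexive (proj₂ r))
                   (expSum-tail 0≤y K (proj₂ (archimedean (y + y))) (j ℕ.+ K) (proj₁ r) (ℕ.m≤n+m K j))) ⟩
            expSum y (j ℕ.+ K) + d         ≤⟨ +-monoˡ-≤ d (expSum-monoʳ 0≤y p) ⟩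
            expSum y k + d                 ≈⟨ +-comm _ _ ⟩
            d + expSum y k                 ∎)) small
            where d = term y (j ℕ.+ K) + term y (j ℕ.+ K)

  expSum≤limit : ∀ {y e} → 0# ≤ y → expSum y ⟶ e → ∀ k → expSum y k ≤ e
  expSum≤limit {y} {e} p lim k with expSum y k ≤? e
  ... | yes q = q
  ... | no q  = contradiction (≤-trans (+-monoˡ-≤ (- e) (expSum-monoʳ p (ℕ.m≤m⊔n k N))) (x≤abs _))
                  (<⇒≱ (proj₂ (lim _ (x<y⇒0<y-x (≰⇒> q))) (k ℕ.⊔ N) (ℕ.m≤n⊔m k N)))
    where N = proj₁ (lim _ (x<y⇒0<y-x (≰⇒> q)))

  ExpAtMost : Carrier → Carrier → Set
  ExpAtMost x y = ∃ λ e → (expSum y ⟶ e) × e ≤ x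

  -- The inequality e^m ≥ 2^m bounds the set whose supremum is the logarithm, and thereby puts `log`
  -- below the logarithm to base 2.
  ExpAtMost-bounded : ∀ {x} m → x < fromℕ 2 ^ m → UpperBound (ExpAtMost x) (fromℕ m)
  ExpAtMost-bounded {x} m p y (e , lim , e≤x) with y ≤? fromℕ m
  ... | yes q = q
  ... | no q  = contradiction (begin
    fromℕ 2 ^ m                ≤⟨ 2^m≤expSum m ⟩
    expSum (fromℕ m) (suc m)   ≤⟨ expSum-mono (suc m) (fromℕ-nonNeg m) m≤y ⟩
    expSum y (suc m)           ≤⟨ expSum≤limit (≤-trans (fromℕ-nonNeg m) m≤y) lim (suc m) ⟩
    e                          ≤⟨ e≤x ⟩
    x                          ∎) (<⇒≱ p)
    where m≤y = <⇒≤ (≰⇒> q)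

  log-lower : ∀ {x y} → 0# ≤ y → (∀ k → expSum y k ≤ x) → y ≤ log x
  log-lower {x} {y} p q = sup-upper (ExpAtMost x) (y , mem) (fromℕ m , ExpAtMost-bounded m (≤-<-trans (proj₂ (archimedean x))
      (<-≤-trans (fromℕ-mono-< (n<2^n m)) (≤-reflexive (fromℕ-^ 2 m))))) y mem
    where
      m = proj₁ (archimedean x)
      mem = exp-exists p q

  log-upper : ∀ {x} m → 1# ≤ x → x < fromℕ 2 ^ m → log x ≤ fromℕ m
  log-upper {x} m p q = sup-least (ExpAtMost x)
    (0# , exp-exists ≤-refl (λ k → ≤-trans (expSum-0≤1 k) p)) (fromℕ m) (ExpAtMost-bounded m q)

  -- The factor ½ in place of log 2 comes from e^(1/2) ≤ 2, which is `expSum-upper` at x = ½.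
  log-lower-2^ : ∀ {x} m → fromℕ 2 ^ m ≤ x → fromℕ m * ½ ≤ log x
  log-lower-2^ {x} m p = log-lower (*-nonNeg (fromℕ-nonNeg m) (<⇒≤ 0<½)) λ k → ≤-trans (begin
    Ex k                           ≈⟨ *-identityʳ _ ⟨
    Ex k * 1#                      ≈⟨ *-congˡ (trans (sym (^-distrib-* ½ (fromℕ 2) m)) (trans (^-congˡ m (trans (*-comm _ _) 2*½≈1)) (1^k≈1 m))) ⟨
    Ex k * (½ ^ m * fromℕ 2 ^ m)   ≈⟨ *-assoc _ _ _ ⟨
    Ex k * ½ ^ m * fromℕ 2 ^ m     ≤⟨ *-monoˡ-≤ (^-nonNeg m (fromℕ-nonNeg 2)) (expSum-upper m k (<⇒≤ 0<½) (<⇒≤ 0<½) ½+½≈1) ⟩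
    1# * fromℕ 2 ^ m              ≈⟨ *-identityˡ _ ⟩
    fromℕ 2 ^ m                   ∎) p
    where Ex = expSum (fromℕ m * ½)

-- Roots, and powers of n against exponential decay

module RootsAndLogarithms (ℝ : RealNumbers) where
  open RealNumbers ℝ
  open Analysis ℝ
  open OrderedField ℝ
  open ExponentialSeries ℝ
  open ≤-Reasoning

  root-nonNeg-bounded : ∀ {x} k → 0# ≤ x → UpperBound (λ y → 0# ≤ y × y ^ suc k ≤ x) (1# + x)
  root-nonNeg-bounded {x} k p y (q , r) with y ≤? (1# + x)
  ... | yes s = s
  ... | no s  = contradiction (begin
    1# + x         ≤⟨ 1+x≤y ⟩
    y              ≈⟨ *-identityʳ y ⟨
    y * 1#         ≤⟨ *-monoʳ-≤ q (1≤x^k k (≤-trans (x≤x+y p) 1+x≤y)) ⟩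
    y ^ suc k      ≤⟨ r ⟩
    x              ∎) (<⇒≱ (≤-<-trans (≤-reflexive (sym (+-identityˡ x))) (+-monoˡ-< x 0<1)))
    where 1+x≤y = <⇒≤ (≰⇒> s)

  root-upper : ∀ {x y} m k → 0# ≤ x ^ m → 0# ≤ y → y ^ suc k ≤ x ^ m → y ≤ x ^[ m / suc k ]
  root-upper {x} {y} m k p q r = sup-upper _ (y , q , r) (1# + x ^ m , root-nonNeg-bounded k p) y (q , r)

  root-nonNeg : ∀ {x} m k → 0# ≤ x ^ m → 0# ≤ x ^[ m / suc k ]
  root-nonNeg m k p = root-upper m k p ≤-refl (≤-trans (≤-reflexive (zeroˡ _)) p)

  -- If z ^ (k + 1) < x ^ m then z + δ is still a member of the set whose
  -- supremum is the root, for the δ below.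
  root≤⇒≤^ : ∀ {x z} m k → 0# ≤ x ^ m → x ^[ m / suc k ] ≤ z → x ^ m ≤ z ^ suc k
  root≤⇒≤^ {x} {z} m k p q with x ^ m ≤? z ^ suc k
  ... | yes r = r
  ... | no r  = contradiction (≤-trans (root-upper m k p (+-nonNeg 0≤z (<⇒≤ 0<δ)) power) q)
    (<⇒≱ (≤-<-trans (≤-reflexive (sym (+-identityʳ z))) (+-monoʳ-< z 0<δ)))
    where
      0≤z : 0# ≤ z
      0≤z = ≤-trans (root-nonNeg m k p) q
      d = x ^ m - z ^ suc k
      0<d : 0# < d
      0<d = x<y⇒0<y-x (≰⇒> r)
      B = fromℕ (suc k) * (z + 1#) ^ k
      0≤B : 0# ≤ B
      0≤B = *-nonNeg (fromℕ-nonNeg (suc k)) (^-nonNeg k (+-nonNeg 0≤z 0≤1))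
      -- The summand `d` ensures `δ ≤ 1`, so that `z + δ` may be replaced by `z + 1` in the slope;
      -- the summand `B` ensures δ B ≤ d.
      M = d + B
      0<M : 0# < M
      0<M = +-pos 0<d 0≤B
      δ = d * M ⁻¹
      0<δ : 0# < δ
      0<δ = *-pos 0<d (⁻¹-pos 0<M)
      δM≈d : δ * M ≈ d
      δM≈d = trans (*-assoc _ _ _) (trans (*-congˡ (*-inverseˡ 0<M)) (*-identityʳ d))
      δ≤1 : δ ≤ 1#
      δ≤1 = *-cancelʳ-≤ 0<M (≤-resp (sym δM≈d) (sym (*-identityˡ M)) (x≤x+y 0≤B))
      power : (z + δ) ^ suc k ≤ x ^ m
      power = begin
        (z + δ) ^ suc k                                  ≤⟨ ^-upper-tangent k 0≤z (<⇒≤ 0<δ) ⟩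
        z ^ suc k + δ * (fromℕ (suc k) * (z + δ) ^ k)
          ≤⟨ +-monoʳ-≤ _ (*-monoʳ-≤ (<⇒≤ 0<δ) (*-monoʳ-≤ (fromℕ-nonNeg (suc k))
               (^-monoˡ-≤ k (+-nonNeg 0≤z (<⇒≤ 0<δ)) (+-monoʳ-≤ z δ≤1)))) ⟩
        z ^ suc k + δ * B                                ≤⟨ +-monoʳ-≤ _ (*-monoʳ-≤ (<⇒≤ 0<δ) (x≤y+x (<⇒≤ 0<d))) ⟩
        z ^ suc k + δ * M                                ≈⟨ +-congˡ δM≈d ⟩
        z ^ suc k + d                                    ≈⟨ +-comm _ _ ⟩
        d + z ^ suc k                                    ≈⟨ x-x+y _ _ ⟩
        x ^ m                                            ∎

  bernoulli : ∀ {x v} j → 0# ≤ x → 0# ≤ v → x + v ≈ 1# → 1# ≤ v ^ j + fromℕ j * x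
  bernoulli {x} {v} zero    p q e = x≤x+y (≤-reflexive (sym (zeroˡ x)))
  bernoulli {x} {v} (suc j) p q e = begin
    1#                                   ≤⟨ bernoulli j p q e ⟩
    v ^ j + fromℕ j * x                  ≈⟨ +-congʳ (trans (*-congˡ e) (*-identityʳ _)) ⟨
    v ^ j * (x + v) + fromℕ j * x        ≈⟨ solve 4 (λ w x v f → w :* (x :+ v) :+ f :* x := w :* x :+ (v :* w :+ f :* x)) refl _ _ _ _ ⟩
    v ^ j * x + (v ^ suc j + fromℕ j * x) ≤⟨ +-monoˡ-≤ _ (*-monoˡ-≤ p (x^k≤1 j q (≤-trans (x≤y+x p) (≤-reflexive e)))) ⟩
    1# * x + (v ^ suc j + fromℕ j * x)
      ≈⟨ solve 3 (λ x w f → con 1 :* x :+ (w :+ f :* x) := w :+ (con 1 :+ f) :* x) refl x _ _ ⟩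
    v ^ suc j + fromℕ (suc j) * x ∎

  -- By contraposition, since a lower bound for `log` only asks for a member of its set. With x = q
  -- / (c + 1), Bernoulli gives w ≤ (1 - x)^(c+1). If the conclusion failed, then n (1 - x)^m > 1,
  -- so the partial sums of e^(mx) stay below n and mx ≤ log n. Splitting q into equal parts
  -- replaces the rule for logarithms of powers.
  decay : ∀ {q w} m c n → 0# ≤ q → 0# ≤ w → q + w ≈ 1# → fromℕ (suc c) * log (fromℕ n) < fromℕ m * q →
    fromℕ n ^ suc c * w ^ m ≤ 1#
  decay {q} {w} m c n 0≤q 0≤w q+w≈1 large with fromℕ n ^ suc c * w ^ m ≤? 1#
  ... | yes r = r
  ... | no r  = contradiction (begin
    fromℕ m * q                       ≈⟨ *-congˡ cx≈q ⟨
    fromℕ m * (fromℕ (suc c) * x)     ≈⟨ solve 3 (λ m c x → m :* (c :* x) := c :* (m :* x)) refl _ _ _ ⟩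
    fromℕ (suc c) * (fromℕ m * x)     ≤⟨ *-monoʳ-≤ (fromℕ-nonNeg (suc c)) (log-lower (*-nonNeg (fromℕ-nonNeg m) 0≤x) exp-small) ⟩
    fromℕ (suc c) * log (fromℕ n)     ∎) (<⇒≱ large)
    where
      x = fromℕ (suc c) ⁻¹ * q
      v = 1# - x
      cx≈q : fromℕ (suc c) * x ≈ q
      cx≈q = x*[x⁻¹*y] (fromℕ-pos c) q
      0≤x : 0# ≤ x
      0≤x = *-nonNeg (⁻¹-nonNeg (fromℕ-pos c)) 0≤q
      x≤1 : x ≤ 1#
      x≤1 = begin
        x                    ≤⟨ x≤x+y (*-nonNeg (fromℕ-nonNeg c) 0≤x) ⟩
        x + fromℕ c * x      ≈⟨ solve 2 (λ x f → x :+ f :* x := (con 1 :+ f) :* x) refl x _ ⟩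
        fromℕ (suc c) * x    ≈⟨ cx≈q ⟩
        q                    ≤⟨ x≤x+y 0≤w ⟩
        q + w                ≈⟨ q+w≈1 ⟩
        1#                   ∎
      0≤v : 0# ≤ v
      0≤v = x≤y⇒0≤y-x x≤1
      x+v≈1 : x + v ≈ 1#
      x+v≈1 = trans (+-comm _ _) (x-x+y x 1#)
      w≤v^c : w ≤ v ^ suc c
      w≤v^c = +-cancelˡ-≤ q (begin
        q + w                          ≈⟨ q+w≈1 ⟩
        1#                             ≤⟨ bernoulli (suc c) 0≤x 0≤v x+v≈1 ⟩
        v ^ suc c + fromℕ (suc c) * x  ≈⟨ trans (+-congˡ cx≈q) (+-comm _ _) ⟩
        q + v ^ suc c                  ∎)
      1<nv^m : 1# < fromℕ n * v ^ m
      1<nv^m = ≰⇒> λ small → r (begin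
        fromℕ n ^ suc c * w ^ m           ≤⟨ *-monoʳ-≤ (^-nonNeg (suc c) (fromℕ-nonNeg n)) (^-monoˡ-≤ m 0≤w w≤v^c) ⟩
        fromℕ n ^ suc c * (v ^ suc c) ^ m ≈⟨ *-congˡ (trans (^-assocʳ v (suc c) m) (trans (reflexive (≡.cong (v ^_) (ℕ.*-comm (suc c) m))) (sym (^-assocʳ v m (suc c))))) ⟩
        fromℕ n ^ suc c * (v ^ m) ^ suc c ≈⟨ ^-distrib-* _ _ (suc c) ⟨
        (fromℕ n * v ^ m) ^ suc c         ≤⟨ x^k≤1 (suc c) (*-nonNeg (fromℕ-nonNeg n) (^-nonNeg m 0≤v)) small ⟩
        1#                                ∎)
      exp-small : ∀ k → expSum (fromℕ m * x) k ≤ fromℕ n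
      exp-small k with expSum (fromℕ m * x) k ≤? fromℕ n
      ... | yes s = s
      ... | no s  = contradiction (≤-trans (*-monoˡ-≤ (^-nonNeg m 0≤v) (<⇒≤ (≰⇒> s))) (expSum-upper m k 0≤x 0≤v x+v≈1)) (<⇒≱ 1<nv^m)

-- Finite counting

⟦_⟧ : Bool → ℕ
⟦ true  ⟧ = 1
⟦ false ⟧ = 0

# : ∀ {n} → (Fin n → Bool) → ℕ
# f = sum λ i → ⟦ f i ⟧

sum-mono : ∀ {n} {f g : Fin n → ℕ} → (∀ i → f i ℕ.≤ g i) → sum f ℕ.≤ sum g
sum-mono {zero}  p = ℕ.z≤n
sum-mono {suc n} p = ℕ.+-mono-≤ (p zero) (sum-mono (λ i → p (suc i)))

sum-const : ∀ n c → sum {n} (λ _ → c) ≡ n ℕ.* c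
sum-const zero    c = ≡.refl
sum-const (suc n) c = cong (c ℕ.+_) (sum-const n c)

⟦⟧-mono : ∀ a b → (a ≡ true → b ≡ true) → ⟦ a ⟧ ℕ.≤ ⟦ b ⟧
⟦⟧-mono false b p = ℕ.z≤n
⟦⟧-mono true  b p rewrite p ≡.refl = ℕ.≤-refl

#-mono : ∀ {n} {f g : Fin n → Bool} → (∀ i → f i ≡ true → g i ≡ true) → # f ℕ.≤ # g
#-mono p = sum-mono λ i → ⟦⟧-mono _ _ (p i)

#-cong : ∀ {n} {f g : Fin n → Bool} → (∀ i → f i ≡ g i) → # f ≡ # g
#-cong p = sum-cong-≗ (λ i → cong ⟦_⟧ (p i))

∧-trueˡ : ∀ {a b} → a ∧ b ≡ true → a ≡ true
∧-trueˡ {true} _ = ≡.refl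

∧-trueʳ : ∀ {a b} → a ∧ b ≡ true → b ≡ true
∧-trueʳ {true} p = p

∧-true : ∀ {a b} → a ≡ true → b ≡ true → a ∧ b ≡ true
∧-true ≡.refl p = p

term≤sum : ∀ {n} (f : Fin n → ℕ) i → f i ℕ.≤ sum f
term≤sum {suc n} f zero    = ℕ.m≤m+n (f zero) _
term≤sum {suc n} f (suc i) = ℕ.≤-trans (term≤sum (λ j → f (suc j)) i) (ℕ.m≤n+m _ (f zero))

sum-zero : ∀ n → sum {n} (λ _ → 0) ≡ 0
sum-zero n = ≡.trans (sum-const n 0) (ℕ.*-zeroʳ n)

#-≟ : ∀ {n} (i : Fin n) → # (λ j → does (i ≟ j)) ≡ 1
#-≟ {suc n} zero    = cong suc (sum-zero n)
#-≟ {suc n} (suc i) = #-≟ i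

#-image : ∀ {k n} (f : Fin k → Fin n) → # (λ v → does (any? λ i → f i ≟ v)) ℕ.≤ k
#-image {k} {n} f = begin
  # (λ v → does (any? λ i → f i ≟ v))                ≤⟨ sum-mono pointwise ⟩
  sum (λ v → # (λ i → does (f i ≟ v)))               ≡⟨ ∑-comm (λ v i → ⟦ does (f i ≟ v) ⟧) ⟩
  sum (λ i → # (λ v → does (f i ≟ v)))               ≡⟨ sum-cong-≗ (λ i → #-≟ (f i)) ⟩
  sum {k} (λ _ → 1)                                  ≡⟨ ≡.trans (sum-const k 1) (ℕ.*-identityʳ k) ⟩
  k                                                  ∎
  where
    open ℕ.≤-Reasoning
    pointwise : ∀ v → ⟦ does (any? λ i → f i ≟ v) ⟧ ℕ.≤ # (λ i → does (f i ≟ v))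
    pointwise v with any? (λ i → f i ≟ v)
    ... | no _        = ℕ.z≤n
    ... | yes (i , e) = ℕ.≤-trans (ℕ.≤-reflexive (≡.sym (cong ⟦_⟧ (dec-true (f i ≟ v) e)))) (term≤sum _ i)

floorLog : ∀ n → 1 ℕ.≤ n → ∃ λ l → 2 ℕ.^ l ℕ.≤ n × n ℕ.< 2 ℕ.^ suc l
floorLog (suc zero)    _ = 0 , ℕ.≤-refl , ℕ.≤-refl
floorLog (suc (suc n)) _ with floorLog (suc n) (ℕ.s≤s ℕ.z≤n)
... | l , lo , hi with suc (suc n) ℕ.<? 2 ℕ.^ suc l
...   | yes p = l , ℕ.m≤n⇒m≤1+n lo , p
...   | no p  = suc l , ℕ.≮⇒≥ p , ℕ.≤-<-trans hi (ℕ.^-monoʳ-< 2 ℕ.≤-refl (ℕ.n<1+n (suc l)))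

sum-mono-< : ∀ {n} {f g : Fin n → ℕ} → (∀ i → f i ℕ.≤ g i) → ∀ i → f i ℕ.< g i → sum f ℕ.< sum g
sum-mono-< {suc n} p zero    q = ℕ.+-mono-<-≤ q (sum-mono (λ i → p (suc i)))
sum-mono-< {suc n} p (suc i) q = ℕ.+-mono-≤-< (p zero) (sum-mono-< (λ i → p (suc i)) i q)

#-mono-< : ∀ {n} {f g : Fin n → Bool} → (∀ i → f i ≡ true → g i ≡ true) → ∀ i → f i ≡ false → g i ≡ true → # f ℕ.< # g
#-mono-< p i q r = sum-mono-< (λ j → ⟦⟧-mono _ _ (p j)) i (ℕ.≤-reflexive (≡.trans (cong (λ b → suc ⟦ b ⟧) q) (cong ⟦_⟧ (≡.sym r))))

true≢false : ∀ {b} {A : Set} → b ≡ true → b ≡ false → A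
true≢false ≡.refl ()

≡-from-⇔ : ∀ {a b} → (a ≡ true → b ≡ true) → (b ≡ true → a ≡ true) → a ≡ b
≡-from-⇔ {true}  {_}     f g = ≡.sym (f ≡.refl)
≡-from-⇔ {false} {false} f g = ≡.refl
≡-from-⇔ {false} {true}  f g = g ≡.refl

abstract
  #>0⇒∃ : ∀ {n} (f : Fin n → Bool) → 0 ℕ.< # f → ∃ λ i → f i ≡ true
  #>0⇒∃ {suc n} f p with f zero in e
  ... | true  = zero , e
  ... | false with #>0⇒∃ (λ i → f (suc i)) p
  ...   | i , q = suc i , q

#-∨ : ∀ {n} (f g : Fin n → Bool) → # (λ i → f i ∨ g i) ℕ.≤ # f ℕ.+ # g
#-∨ f g = ℕ.≤-trans (sum-mono λ i → pointwise (f i) (g i)) (ℕ.≤-reflexive (∑-distrib-+ (λ i → ⟦ f i ⟧) (λ i → ⟦ g i ⟧)))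
  where
    pointwise : ∀ a b → ⟦ a ∨ b ⟧ ℕ.≤ ⟦ a ⟧ ℕ.+ ⟦ b ⟧
    pointwise true  b = ℕ.s≤s ℕ.z≤n
    pointwise false b = ℕ.≤-refl

#-split : ∀ {n} (f g : Fin n → Bool) → # f ≡ # (λ i → f i ∧ g i) ℕ.+ # (λ i → f i ∧ not (g i))
#-split f g = ≡.trans (sum-cong-≗ λ i → pointwise (f i) (g i)) (∑-distrib-+ (λ i → ⟦ f i ∧ g i ⟧) (λ i → ⟦ f i ∧ not (g i) ⟧))
  where
    pointwise : ∀ a b → ⟦ a ⟧ ≡ ⟦ a ∧ b ⟧ ℕ.+ ⟦ a ∧ not b ⟧
    pointwise false b     = ≡.refl
    pointwise true  true  = ≡.refl
    pointwise true  false = ≡.refl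

#-all : ∀ n → # {n} (λ _ → true) ≡ n
#-all n = ≡.trans (sum-const n 1) (ℕ.*-identityʳ n)

#-insert : ∀ {n} (S : Fin n → Bool) c → S c ≡ false →
  # (λ i → not (S i)) ≡ suc (# (λ i → not (S i ∨ does (c ≟ i))))
#-insert {suc n} S zero    e rewrite e = cong suc (sum-cong-≗ {n} λ i → cong (λ b → ⟦ not b ⟧) (≡.sym (∨-identityʳ (S (suc i)))))
#-insert {suc n} S (suc c) e = ≡.trans (cong₂ ℕ._+_ (cong (λ b → ⟦ not b ⟧) (≡.sym (∨-identityʳ (S zero)))) (#-insert (λ i → S (suc i)) c e))
  (ℕ.+-suc _ _)

abstract
  shrink : ∀ {n} (A : Fin n → Bool) {a} → a ℕ.≤ # A → ∃ λ A′ → (∀ i → A′ i ≡ true → A i ≡ true) × # A′ ≡ a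
  shrink {zero}  A ℕ.z≤n = A , (λ _ p → p) , ≡.refl
  shrink {suc n} A {a} p with A zero in e
  shrink {suc n} A {zero} p | true = (λ _ → false) , (λ _ ()) , sum-zero (suc n)
  shrink {suc n} A {suc a} (ℕ.s≤s p) | true =
    let (A′ , sub , q) = shrink (λ i → A (suc i)) p
    in (λ { zero → true ; (suc i) → A′ i }) , (λ { zero _ → e ; (suc i) → sub i }) , cong suc q
  shrink {suc n} A {a} p | false =
    let (A′ , sub , q) = shrink (λ i → A (suc i)) p
    in (λ { zero → false ; (suc i) → A′ i }) , (λ { zero () ; (suc i) → sub i }) , q

abstract
  exceedsAverage : ∀ {n} (A : Fin n → Bool) (F : Fin n → ℕ) {m} → 1 ℕ.≤ # A → (∀ u → A u ≡ false → F u ≡ 0) → m ℕ.< sum F →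
    ∃ λ u → A u ≡ true × m ℕ.< # A ℕ.* F u
  exceedsAverage {n} A F {m} 1≤a off m<ΣF = go (any? λ u → (A u ≟ᵇ true) ×-dec (m ℕ.<? # A ℕ.* F u))
    where
      go : Dec (∃ λ u → A u ≡ true × m ℕ.< # A ℕ.* F u) → ∃ λ u → A u ≡ true × m ℕ.< # A ℕ.* F u
      go (yes p) = p
      go (no ¬p) = contradiction (ℕ.*-cancelˡ-≤ (# A) {{ℕ.>-nonZero 1≤a}} (begin
        # A ℕ.* sum F               ≡⟨ *-distribˡ-sum (# A) F ⟩
        sum (λ u → # A ℕ.* F u)     ≤⟨ sum-mono pointwise ⟩
        sum (λ u → m ℕ.* ⟦ A u ⟧)   ≡⟨ ≡.sym (*-distribˡ-sum m (λ u → ⟦ A u ⟧)) ⟩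
        m ℕ.* # A                   ≡⟨ ℕ.*-comm m (# A) ⟩
        # A ℕ.* m                   ∎)) (ℕ.<⇒≱ m<ΣF)
        where
          open ℕ.≤-Reasoning
          pointwise : ∀ u → # A ℕ.* F u ℕ.≤ m ℕ.* ⟦ A u ⟧
          pointwise u with A u in e
          ... | true  = ℕ.≤-trans (ℕ.≮⇒≥ λ q → ¬p (u , e , q)) (ℕ.≤-reflexive (≡.sym (ℕ.*-identityʳ m)))
          ... | false = ℕ.≤-reflexive (≡.trans (cong (# A ℕ.*_) (off u e)) (≡.trans (ℕ.*-zeroʳ (# A)) (≡.sym (ℕ.*-zeroʳ m))))

abstract
  -- The average is over all r colours rather than over T. This costs a constant only, and the same
  -- factor r then serves in every round of the greedy procedure.
  majority : ∀ {r} (T : Fin r → Bool) (g : Fin r → ℕ) c₀ → T c₀ ≡ true → (∀ c → T c ≡ false → g c ≡ 0) →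
    ∃ λ c → T c ≡ true × sum g ℕ.≤ r ℕ.* g c
  majority {r} T g c₀ Tc₀ off = go (any? λ c → (T c ≟ᵇ true) ×-dec (sum g ℕ.≤? r ℕ.* g c))
    where
      go : Dec (∃ λ c → T c ≡ true × sum g ℕ.≤ r ℕ.* g c) → ∃ λ c → T c ≡ true × sum g ℕ.≤ r ℕ.* g c
      go (yes p) = p
      go (no ¬p) = contradiction (begin-strict
        r ℕ.* sum g                ≡⟨ *-distribˡ-sum r g ⟩
        sum (λ c → r ℕ.* g c)      <⟨ sum-mono-< pointwise c₀ (below c₀ Tc₀) ⟩
        sum {r} (λ _ → sum g)      ≡⟨ sum-const r (sum g) ⟩
        r ℕ.* sum g                ∎) (ℕ.<-irrefl ≡.refl)
        where
          open ℕ.≤-Reasoning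
          below : ∀ c → T c ≡ true → r ℕ.* g c ℕ.< sum g
          below c e = ℕ.≰⇒> λ q → ¬p (c , e , q)
          pointwise : ∀ c → r ℕ.* g c ℕ.≤ sum g
          pointwise c with T c in e
          ... | true  = ℕ.<⇒≤ (below c e)
          ... | false = ℕ.≤-trans (ℕ.≤-reflexive (≡.trans (cong (r ℕ.*_) (off c e)) (ℕ.*-zeroʳ r))) ℕ.z≤n

⟦⟧≤ : ∀ a {m} → (a ≡ true → 1 ℕ.≤ m) → ⟦ a ⟧ ℕ.≤ m
⟦⟧≤ true  p = p ≡.refl
⟦⟧≤ false p = ℕ.z≤n

-- Degrees and edge counts

-- A vector of roles encodes a pair of disjoint sets of vertices.
data Role : Set where
  left right outside : Role

isLeft isRight : Role → Bool
isLeft left  = true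
isLeft _     = false
isRight right = true
isRight _     = false

count : ∀ {n} → (Role → Bool) → Vec Role n → ℕ
count c σ = # λ i → c (lookup σ i)

countIn : ∀ {n} → (Role → Bool) → Vec Role n → Vec Bool n → ℕ
countIn c σ v = # λ i → lookup v i ∧ c (lookup σ i)

-- Once the row of a left vertex is revealed, the right vertices it misses can be discarded. This
-- lets `codegree` be computed row by row, in the order in which a graph is stored.
maskRole : Role → Bool → Role
maskRole right false = outside
maskRole x     _     = x

mask : ∀ {n} → Vec Role n → Vec Bool n → Vec Role n
mask = Vec.zipWith maskRole

leftWithin : ∀ {n} → Vec Role n → Vec Bool n → Bool
leftWithin []         []      = true
leftWithin (left ∷ σ) (b ∷ v) = b ∧ leftWithin σ v
leftWithin (_ ∷ σ)    (b ∷ v) = leftWithin σ v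

-- the number of right vertices adjacent to all left vertices
codegree : ∀ {n} → Vec Role n → Graph n → ℕ
codegree []            []      = 0
codegree (left ∷ σ)    (v ∷ G) = codegree (mask σ v) G
codegree (right ∷ σ)   (v ∷ G) = ⟦ leftWithin σ v ⟧ ℕ.+ codegree σ G
codegree (outside ∷ σ) (v ∷ G) = codegree σ G

edges : ∀ {n} → Vec Role n → Graph n → ℕ
edges []            []      = 0
edges (left ∷ σ)    (v ∷ G) = countIn isRight σ v ℕ.+ edges σ G
edges (right ∷ σ)   (v ∷ G) = countIn isLeft σ v ℕ.+ edges σ G
edges (outside ∷ σ) (v ∷ G) = edges σ G

isTrue : Maybe Bool → Bool
isTrue (just b) = b
isTrue nothing  = false

adj : ∀ {n} → Graph n → Fin n → Fin n → Bool
adj G i j = isTrue (at G i j)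

at-sym : ∀ {A n} (t : Pairs A n) i j → at t i j ≡ at t j i
at-sym (v ∷ t) zero    zero    = ≡.refl
at-sym (v ∷ t) zero    (suc j) = ≡.refl
at-sym (v ∷ t) (suc i) zero    = ≡.refl
at-sym (v ∷ t) (suc i) (suc j) = at-sym t i j

at-irrefl : ∀ {A n} (t : Pairs A n) i → at t i i ≡ nothing
at-irrefl (v ∷ t) zero    = ≡.refl
at-irrefl (v ∷ t) (suc i) = at-irrefl t i

adj-sym : ∀ {n} (G : Graph n) i j → adj G i j ≡ adj G j i
adj-sym G i j = cong isTrue (at-sym G i j)

leftWithin⇒ : ∀ {n} (σ : Vec Role n) v → leftWithin σ v ≡ true → ∀ u → lookup σ u ≡ left → lookup v u ≡ true
leftWithin⇒ (left ∷ σ)    (b ∷ v) p zero    _ = ∧-trueˡ p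
leftWithin⇒ (left ∷ σ)    (b ∷ v) p (suc u) e = leftWithin⇒ σ v (∧-trueʳ p) u e
leftWithin⇒ (right ∷ σ)   (b ∷ v) p (suc u) e = leftWithin⇒ σ v p u e
leftWithin⇒ (outside ∷ σ) (b ∷ v) p (suc u) e = leftWithin⇒ σ v p u e

mask-left : ∀ {n} (σ : Vec Role n) v u → lookup σ u ≡ left → lookup (mask σ v) u ≡ left
mask-left (left ∷ σ) (b ∷ v) zero    e = ≡.refl
mask-left (_ ∷ σ)    (b ∷ v) (suc u) e = mask-left σ v u e

mask-right : ∀ {n} (σ : Vec Role n) v w → lookup (mask σ v) w ≡ right → lookup σ w ≡ right × lookup v w ≡ true
mask-right (right ∷ σ) (true ∷ v) zero    e = ≡.refl , ≡.refl
mask-right (_ ∷ σ)     (b ∷ v)    (suc w) e = mask-right σ v w e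

codegree≤# : ∀ {n} (σ : Vec Role n) (G : Graph n) (c : Fin n → Bool) →
  (∀ w → lookup σ w ≡ right → (∀ u → lookup σ u ≡ left → adj G u w ≡ true) → c w ≡ true) → codegree σ G ℕ.≤ # c
codegree≤# []           []      c h = ℕ.z≤n
codegree≤# (left ∷ σ)   (v ∷ G) c h = ℕ.≤-trans
  (codegree≤# (mask σ v) G (λ w → c (suc w)) λ w e k → h (suc w) (proj₁ (mask-right σ v w e))
    λ { zero _ → proj₂ (mask-right σ v w e) ; (suc u) e′ → k u (mask-left σ v u e′) })
  (ℕ.m≤n+m _ ⟦ c zero ⟧)
codegree≤# (right ∷ σ)  (v ∷ G) c h = ℕ.+-mono-≤
  (⟦⟧-mono _ _ λ e → h zero ≡.refl λ { (suc u) e′ → leftWithin⇒ σ v e u e′ })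
  (codegree≤# σ G (λ w → c (suc w)) λ w e k → h (suc w) e λ { (suc u) e′ → k u e′ })
codegree≤# (outside ∷ σ) (v ∷ G) c h = ℕ.≤-trans
  (codegree≤# σ G (λ w → c (suc w)) λ w e k → h (suc w) e λ { (suc u) e′ → k u e′ })
  (ℕ.m≤n+m _ ⟦ c zero ⟧)

edgeSum : ∀ {n} → Graph n → (Fin n → Bool) → (Fin n → Bool) → ℕ
edgeSum G A B = sum λ u → # λ w → A u ∧ (B w ∧ adj G u w)

edges≤edgeSum : ∀ {n} (σ : Vec Role n) (G : Graph n) →
  edges σ G ℕ.≤ edgeSum G (λ u → isLeft (lookup σ u)) (λ w → isRight (lookup σ w))
edges≤edgeSum [] [] = ℕ.z≤n
edges≤edgeSum (left ∷ σ) (v ∷ G) = ℕ.+-mono-≤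
  (#-mono λ w e → ∧-true (∧-trueʳ {lookup v w} e) (∧-trueˡ e))
  (ℕ.≤-trans (edges≤edgeSum σ G) (sum-mono λ u → ℕ.m≤n+m _ ⟦ isLeft (lookup σ u) ∧ false ⟧))
edges≤edgeSum (right ∷ σ) (v ∷ G) = ℕ.≤-trans
  (ℕ.+-mono-≤ (#-mono λ u e → ∧-true (∧-trueʳ {lookup v u} e) (∧-trueˡ e)) (edges≤edgeSum σ G))
  (ℕ.≤-trans (ℕ.≤-reflexive (≡.sym (∑-distrib-+ _ (λ u → # λ w → isLeft (lookup σ u) ∧ (isRight (lookup σ w) ∧ adj G u w)))))
    (ℕ.m≤n+m _ _))
edges≤edgeSum (outside ∷ σ) (v ∷ G) = ℕ.≤-trans
  (ℕ.≤-trans (edges≤edgeSum σ G) (sum-mono λ u → ℕ.m≤n+m _ ⟦ isLeft (lookup σ u) ∧ false ⟧))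
  (ℕ.m≤n+m _ _)

-- Expectation and the first moment method

module Functionals (ℝ : RealNumbers) where
  open RealNumbers ℝ
  open Analysis ℝ
  open RandomGraph ℝ
  open OrderedField ℝ
  open ExponentialSeries ℝ
  open ≤-Reasoning

  -- A positive linear functional. Expectations and plain finite sums over vertex sets are both of
  -- this kind, so that the mean of a sum over vertex sets is an exchange of two functionals.
  record Functional (X : Set) : Set₁ where
    field
      int      : (X → Carrier) → Carrier
      int-mono : ∀ {f g} → (∀ x → f x ≤ g x) → int f ≤ int g
      int-+    : ∀ f g → int (λ x → f x + g x) ≈ int f + int g
      int-*    : ∀ c f → int (λ x → c * f x) ≈ c * int f

    int-cong : ∀ {f g} → (∀ x → f x ≈ g x) → int f ≈ int g
    int-cong p = ≤-antisym (int-mono λ x → ≤-reflexive (p x)) (int-mono λ x → ≤-reflexive (sym (p x)))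

    int-*ʳ : ∀ c f → int (λ x → f x * c) ≈ int f * c
    int-*ʳ c f = trans (int-cong λ x → *-comm _ _) (trans (int-* c f) (*-comm _ _))

    int-nonNeg : ∀ {f} → (∀ x → 0# ≤ f x) → 0# ≤ int f
    int-nonNeg {f} p = ≤-trans (≤-reflexive (trans (sym (zeroˡ _)) (sym (int-* 0# f))))
      (int-mono λ x → ≤-trans (≤-reflexive (zeroˡ _)) (p x))

  open Functional public

  Normalised : ∀ {X} → Functional X → Set
  Normalised M = int M (λ _ → 1#) ≈ 1#

  int-const : ∀ {X} (M : Functional X) → Normalised M → ∀ c → int M (λ _ → c) ≈ c
  int-const M e c = trans (int-cong M λ _ → sym (*-identityʳ c)) (trans (int-* M c _) (trans (*-congˡ e) (*-identityʳ c)))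

  point : ∀ {X} → X → Functional X
  point x = record { int = λ f → f x ; int-mono = λ p → p x ; int-+ = λ _ _ → refl ; int-* = λ _ _ → refl }

  product : ∀ {X Y Z : Set} → (X → Y → Z) → Functional X → Functional Y → Functional Z
  product _∙_ M N = record
    { int      = λ f → int M λ x → int N λ y → f (x ∙ y)
    ; int-mono = λ p → int-mono M λ x → int-mono N λ y → p (x ∙ y)
    ; int-+    = λ f g → trans (int-cong M λ x → int-+ N _ _) (int-+ M _ _)
    ; int-*    = λ c f → trans (int-cong M λ x → int-* N c _) (int-* M c _)
    }

  plus : ∀ {X} → Functional X → Functional X → Functional X
  plus M N = record
    { int      = λ f → int M f + int N f
    ; int-mono = λ p → +-mono-≤ (int-mono M p) (int-mono N p)
    ; int-+    = λ f g → trans (+-cong (int-+ M f g) (int-+ N f g))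
                   (solve 4 (λ a b c d → (a :+ b) :+ (c :+ d) := (a :+ c) :+ (b :+ d)) refl _ _ _ _)
    ; int-*    = λ c f → trans (+-cong (int-* M c f) (int-* N c f)) (sym (distribˡ c _ _))
    }

  scaled : ∀ {X} c → 0# ≤ c → Functional X → Functional X
  scaled c p M = record
    { int      = λ f → c * int M f
    ; int-mono = λ q → *-monoʳ-≤ p (int-mono M q)
    ; int-+    = λ f g → trans (*-congˡ (int-+ M f g)) (distribˡ c _ _)
    ; int-*    = λ d f → trans (*-congˡ (int-* M d f)) (solve 3 (λ c d i → c :* (d :* i) := d :* (c :* i)) refl _ _ _)
    }

  vec : ∀ {X} → Functional X → ∀ m → Functional (Vec X m)
  vec M zero    = point []
  vec M (suc m) = product _∷_ M (vec M m)

  graph : Functional Bool → ∀ n → Functional (Graph n)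
  graph M zero    = point []
  graph M (suc n) = product _∷_ (vec M n) (graph M n)

  vec-normalised : ∀ {X} {M : Functional X} → Normalised M → ∀ m → Normalised (vec M m)
  vec-normalised e zero    = refl
  vec-normalised {M = M} e (suc m) = trans (int-cong M λ _ → vec-normalised {M = M} e m) e

  graph-normalised : ∀ {M : Functional Bool} → Normalised M → ∀ n → Normalised (graph M n)
  graph-normalised e zero    = refl
  graph-normalised {M} e (suc n) = trans (int-cong (vec M n) λ _ → graph-normalised {M} e n) (vec-normalised {M = M} e n)

  coin : ∀ p → 0# ≤ p → p ≤ 1# → Functional Bool
  coin p 0≤p p≤1 = plus (scaled p 0≤p (point true)) (scaled (1# - p) (x≤y⇒0≤y-x p≤1) (point false))

  p+[1-p]≈1 : ∀ p → p + (1# - p) ≈ 1#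
  p+[1-p]≈1 p = trans (+-comm _ _) (x-x+y p 1#)

  coin-normalised : ∀ p 0≤p p≤1 → Normalised (coin p 0≤p p≤1)
  coin-normalised p _ _ = trans (+-cong (*-identityʳ _) (*-identityʳ _)) (p+[1-p]≈1 p)

  module _ (p : Carrier) (0≤p : 0# ≤ p) (p≤1 : p ≤ 1#) where

    𝔼-bits≈int : ∀ m f → 𝔼-bits p m f ≈ int (vec (coin p 0≤p p≤1) m) f
    𝔼-bits≈int zero    f = refl
    𝔼-bits≈int (suc m) f = +-cong (*-congˡ (𝔼-bits≈int m _)) (*-congˡ (𝔼-bits≈int m _))

    𝔼≈int : ∀ n f → 𝔼 p n f ≈ int (graph (coin p 0≤p p≤1) n) f
    𝔼≈int zero    f = refl
    𝔼≈int (suc n) f = trans (𝔼-bits≈int n _) (int-cong (vec (coin p 0≤p p≤1) n) λ v → 𝔼≈int n _)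

  -- Fubini is stated as a property of a pair because two arbitrary positive functionals need not
  -- commute. For a finite sum of point evaluations it is just additivity of the other functional,
  -- and it passes to vectors coordinate by coordinate.
  swapWith : ∀ {Y : Set} → Functional Y → ∀ {X} → Functional X → Set
  swapWith {Y} N {X} M = ∀ (f : X → Y → Carrier) → int N (λ y → int M (λ x → f x y)) ≈ int M (λ x → int N (f x))

  vec-swap : ∀ {Y} (N : Functional Y) {X} (M : Functional X) → swapWith N M → ∀ m → swapWith N (vec M m)
  vec-swap N M s zero    f = refl
  vec-swap N M s (suc m) f = trans (s _) (int-cong M λ x → vec-swap N M s m _)

  -- A sum, not an average: `vec three n` runs over all ordered pairs of disjoint vertex sets, as
  -- `vec pair n` below runs over all vertex sets.
  three : Functional Role
  three = plus (point left) (plus (point right) (point outside))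

  three-swap : ∀ {Y} (N : Functional Y) → swapWith N three
  three-swap N f = trans (int-+ N _ _) (+-congˡ (int-+ N _ _))

  pair : Functional Bool
  pair = plus (point true) (point false)

  pair-swap : ∀ {Y} (N : Functional Y) → swapWith N pair
  pair-swap N f = int-+ N _ _

  𝟙-bound : ∀ A → UpperBound (λ x → x ≈ 0# ⊎ (x ≈ 1# × A)) 1#
  𝟙-bound A x (inj₁ e)       = ≤-trans (≤-reflexive e) 0≤1
  𝟙-bound A x (inj₂ (e , _)) = ≤-reflexive e

  𝟙≤1 : ∀ A → 𝟙 A ≤ 1#
  𝟙≤1 A = sup-least _ (0# , inj₁ refl) 1# (𝟙-bound A)

  0≤𝟙 : ∀ A → 0# ≤ 𝟙 A
  0≤𝟙 A = sup-upper _ (0# , inj₁ refl) (1# , 𝟙-bound A) 0# (inj₁ refl)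

  -- The order is decidable, so the conclusion is stable under double negation.
  1≤𝟙 : ∀ {A} → ¬ ¬ A → 1# ≤ 𝟙 A
  1≤𝟙 {A} a with 1# ≤? 𝟙 A
  ... | yes p = p
  ... | no p  = contradiction (λ x → p (sup-upper _ (0# , inj₁ refl) (1# , 𝟙-bound A) 1# (inj₂ (refl , x)))) a

  -- The mean of Φ must be O(1/n) with a constant k common to all n; this makes the failure
  -- probability tend to 0 at an explicit rate. Φ < 1 yields the event only up to double negation,
  -- which `1≤𝟙` accepts.
  FirstMoment : ∀ (p : ℕ → Carrier) (h : ∀ n → 0# ≤ p n × p n ≤ 1#) (A : ∀ n → Graph n → Set) → ℕ → ℕ → Set
  FirstMoment p h A k n = ∃ λ (Φ : Graph n → Carrier) →
    (∀ G → 0# ≤ Φ G) × (∀ G → Φ G < 1# → ¬ ¬ A n G) ×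
    fromℕ n * int (graph (coin (p n) (proj₁ (h n)) (proj₂ (h n))) n) Φ ≤ fromℕ k

  -- Markov's inequality in the pointwise form 1 ≤ 𝟙 A + Φ. It follows by comparing Φ with 1 in the
  -- decidable order of the reals, so the event A itself is never decided.
  aas-firstMoment : ∀ (p : ℕ → Carrier) h A k → Eventually (FirstMoment p h A k) → AAS p A
  aas-firstMoment p h A k (N , good) η 0<η = M , λ n M≤n →
    abs-< (≤-<-trans (≤-trans (+-monoˡ-≤ (- 1#) (Pr≤1 n)) (≤-reflexive (-‿inverseʳ 1#))) 0<η)
          (≤-<-trans (1-Pr≤𝔼Φ n (N≤ M≤n)) (small n M≤n))
    where
      k′ = proj₁ (archimedean (fromℕ k * η ⁻¹))
      M = N ℕ.⊔ suc k′
      𝔾 : ∀ n → Functional (Graph n)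
      𝔾 n = graph (coin (p n) (proj₁ (h n)) (proj₂ (h n))) n
      N≤ : ∀ {n} → M ℕ.≤ n → N ℕ.≤ n
      N≤ = ℕ.≤-trans (ℕ.m≤m⊔n N _)
      Φ : ∀ n → N ℕ.≤ n → Graph n → Carrier
      Φ n N≤n = proj₁ (good n N≤n)
      Pr≈ : ∀ n → Pr n (p n) (A n) ≈ int (𝔾 n) (λ G → 𝟙 (A n G))
      Pr≈ n = 𝔼≈int (p n) (proj₁ (h n)) (proj₂ (h n)) n _
      unit : ∀ n → Normalised (𝔾 n)
      unit n = graph-normalised {coin (p n) (proj₁ (h n)) (proj₂ (h n))} (coin-normalised (p n) (proj₁ (h n)) (proj₂ (h n))) n
      Pr≤1 : ∀ n → Pr n (p n) (A n) ≤ 1#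
      Pr≤1 n = ≤-trans (≤-reflexive (Pr≈ n)) (≤-trans (int-mono (𝔾 n) λ G → 𝟙≤1 (A n G)) (≤-reflexive (unit n)))
      pointwise : ∀ n (N≤n : N ℕ.≤ n) G → 1# ≤ 𝟙 (A n G) + Φ n N≤n G
      pointwise n N≤n G with 1# ≤? Φ n N≤n G
      ... | yes q = ≤-trans q (x≤y+x (0≤𝟙 _))
      ... | no q  = ≤-trans (1≤𝟙 (proj₁ (proj₂ (proj₂ (good n N≤n))) G (≰⇒> q))) (x≤x+y (proj₁ (proj₂ (good n N≤n)) G))
      1≤Pr+𝔼Φ : ∀ n (N≤n : N ℕ.≤ n) → 1# ≤ Pr n (p n) (A n) + int (𝔾 n) (Φ n N≤n)
      1≤Pr+𝔼Φ n N≤n = begin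
        1#                                           ≈⟨ unit n ⟨
        int (𝔾 n) (λ _ → 1#)                         ≤⟨ int-mono (𝔾 n) (pointwise n N≤n) ⟩
        int (𝔾 n) (λ G → 𝟙 (A n G) + Φ n N≤n G)          ≈⟨ int-+ (𝔾 n) _ _ ⟩
        int (𝔾 n) (λ G → 𝟙 (A n G)) + int (𝔾 n) (Φ n N≤n) ≈⟨ +-congʳ (Pr≈ n) ⟨
        Pr n (p n) (A n) + int (𝔾 n) (Φ n N≤n)           ∎
      1-Pr≤𝔼Φ : ∀ n (N≤n : N ℕ.≤ n) → - (Pr n (p n) (A n) - 1#) ≤ int (𝔾 n) (Φ n N≤n)
      1-Pr≤𝔼Φ n N≤n = +-cancelʳ-≤ (P - 1#) (begin
        - (P - 1#) + (P - 1#)  ≈⟨ -‿inverseˡ _ ⟩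
        0#                     ≈⟨ -‿inverseʳ 1# ⟨
        1# - 1#                ≤⟨ +-monoˡ-≤ (- 1#) (1≤Pr+𝔼Φ n N≤n) ⟩
        (P + I) - 1#           ≈⟨ trans (+-congʳ (+-comm P I)) (+-assoc I P _) ⟩
        I + (P - 1#)           ∎)
        where
          P = Pr n (p n) (A n)
          I = int (𝔾 n) (Φ n N≤n)
      small : ∀ n (M≤n : M ℕ.≤ n) → int (𝔾 n) (Φ n (N≤ M≤n)) < η
      small n M≤n = ≰⇒> λ q → contradiction (begin
        fromℕ n * η               ≤⟨ *-monoʳ-≤ (fromℕ-nonNeg n) q ⟩
        fromℕ n * int (𝔾 n) (Φ n (N≤ M≤n)) ≤⟨ proj₂ (proj₂ (proj₂ (good n (N≤ M≤n)))) ⟩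
        fromℕ k                   ≈⟨ *-identityʳ _ ⟨
        fromℕ k * 1#              ≈⟨ *-congˡ (*-inverseˡ 0<η) ⟨
        fromℕ k * (η ⁻¹ * η)      ≈⟨ *-assoc _ _ _ ⟨
        fromℕ k * η ⁻¹ * η        ≤⟨ *-monoˡ-≤ (<⇒≤ 0<η) (proj₂ (archimedean (fromℕ k * η ⁻¹))) ⟩
        fromℕ k′ * η              ∎)
        (<⇒≱ (*-monoˡ-< 0<η (fromℕ-mono-< (ℕ.≤-trans (ℕ.m≤n⊔m N _) M≤n))))

-- Means of powers of one half

count-mask-left : ∀ {n} (σ : Vec Role n) v → count isLeft (mask σ v) ≡ count isLeft σ
count-mask-left []            []          = ≡.refl
count-mask-left (left ∷ σ)    (_ ∷ v)     = cong suc (count-mask-left σ v)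
count-mask-left (right ∷ σ)   (true ∷ v)  = count-mask-left σ v
count-mask-left (right ∷ σ)   (false ∷ v) = count-mask-left σ v
count-mask-left (outside ∷ σ) (_ ∷ v)     = count-mask-left σ v

count-mask-right : ∀ {n} (σ : Vec Role n) v → count isRight (mask σ v) ≡ countIn isRight σ v
count-mask-right []            []          = ≡.refl
count-mask-right (left ∷ σ)    (true ∷ v)  = count-mask-right σ v
count-mask-right (left ∷ σ)    (false ∷ v) = count-mask-right σ v
count-mask-right (right ∷ σ)   (true ∷ v)  = cong suc (count-mask-right σ v)
count-mask-right (right ∷ σ)   (false ∷ v) = count-mask-right σ v
count-mask-right (outside ∷ σ) (true ∷ v)  = count-mask-right σ v
count-mask-right (outside ∷ σ) (false ∷ v) = count-mask-right σ v

module Expectations (ℝ : RealNumbers) where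
  open RealNumbers ℝ
  open Analysis ℝ
  open RandomGraph ℝ
  open OrderedField ℝ
  open Functionals ℝ
  open ≤-Reasoning

  module _ (M : Functional Bool) (unit : Normalised M) where

    average : Carrier → Carrier
    average x = int M λ b → if b then x else 1#

    -- The mean of ½ ^ b, where b is the conjunction of k independent bits; the empty conjunction is
    -- true, hence the initial value ½.
    iterated : ℕ → Carrier
    iterated zero    = ½
    iterated (suc k) = average (iterated k)

    private
      average-split : ∀ {x P} {f : Bool → Carrier} → f true ≈ x * P → f false ≈ P → int M f ≈ average x * P
      average-split {x} {P} {f} e₁ e₀ = trans (int-cong M pointwise) (int-*ʳ M P _)
        where
          pointwise : ∀ b → f b ≈ (if b then x else 1#) * P
          pointwise true  = e₁
          pointwise false = trans e₀ (sym (*-identityˡ P))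

      ignored : ∀ {P} {f : Bool → Carrier} → (∀ b → f b ≈ P) → int M f ≈ P
      ignored e = trans (int-cong M e) (int-const M unit _)

    ∫-countIn : ∀ x c {m} (σ : Vec Role m) → int (vec M m) (λ v → x ^ countIn c σ v) ≈ average x ^ count c σ
    ∫-countIn x c []            = refl
    ∫-countIn x c {suc m} (τ ∷ σ) = step (c τ)
      where
        step : ∀ d → int M (λ b → int (vec M m) (λ v → x ^ (⟦ b ∧ d ⟧ ℕ.+ countIn c σ v)))
          ≈ average x ^ (⟦ d ⟧ ℕ.+ count c σ)
        step true  = average-split (trans (int-* (vec M m) x _) (*-congˡ (∫-countIn x c σ))) (∫-countIn x c σ)
        step false = ignored λ { true → ∫-countIn x c σ ; false → ∫-countIn x c σ }

    ∫-leftWithin : ∀ {m} (σ : Vec Role m) → int (vec M m) (λ v → ½ ^ ⟦ leftWithin σ v ⟧) ≈ iterated (count isLeft σ)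
    ∫-leftWithin []            = *-identityʳ ½
    ∫-leftWithin {suc m} (left ∷ σ)    = trans (average-split
      (trans (∫-leftWithin σ) (sym (*-identityʳ _))) (int-const (vec M m) (vec-normalised {M = M} unit m) 1#)) (*-identityʳ _)
    ∫-leftWithin (right ∷ σ)   = ignored λ _ → ∫-leftWithin σ
    ∫-leftWithin (outside ∷ σ) = ignored λ _ → ∫-leftWithin σ

    -- Induction over the rows. After the row of a left vertex only its right neighbours remain;
    -- averaging a power with this random exponent turns `iterated k` into `iterated (suc k)` in
    -- each factor. The row of a right vertex contributes one further independent factor.
    ∫-codegree : ∀ {n} (σ : Vec Role n) →
      int (graph M n) (λ G → ½ ^ codegree σ G) ≈ iterated (count isLeft σ) ^ count isRight σ
    ∫-codegree [] = refl
    ∫-codegree {suc n} (left ∷ σ) = trans (int-cong (vec M n) λ v → trans (∫-codegree (mask σ v))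
      (reflexive (cong₂ (λ l r → iterated l ^ r) (count-mask-left σ v) (count-mask-right σ v))))
      (∫-countIn (iterated (count isLeft σ)) isRight σ)
    ∫-codegree {suc n} (right ∷ σ) = trans (int-cong (vec M n) λ v →
      trans (trans (int-cong (graph M n) λ G → ^-homo-* ½ ⟦ leftWithin σ v ⟧ (codegree σ G)) (int-* (graph M n) _ _))
        (*-congˡ (∫-codegree σ)))
      (trans (int-*ʳ (vec M n) _ _) (*-congʳ (∫-leftWithin σ)))
    ∫-codegree {suc n} (outside ∷ σ) = trans (int-cong (vec M n) λ _ → ∫-codegree σ)
      (int-const (vec M n) (vec-normalised {M = M} unit n) _)

    -- Each pair of a left and a right vertex is a single entry of the triangle, stored in the row
    -- of whichever comes first, so there is one independent factor per pair.
    ∫-edges : ∀ {n} (σ : Vec Role n) →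
      int (graph M n) (λ G → ½ ^ edges σ G) ≈ average ½ ^ (count isLeft σ ℕ.* count isRight σ)

    private
      ∫-row : ∀ {n} (σ : Vec Role n) c → int (vec M n) (λ v → int (graph M n) λ G → ½ ^ (countIn c σ v ℕ.+ edges σ G))
        ≈ average ½ ^ count c σ * average ½ ^ (count isLeft σ ℕ.* count isRight σ)
      ∫-row {n} σ c = trans (int-cong (vec M n) λ v →
        trans (trans (int-cong (graph M n) λ G → ^-homo-* ½ (countIn c σ v) (edges σ G)) (int-* (graph M n) _ _))
          (*-congˡ (∫-edges σ)))
        (trans (int-*ʳ (vec M n) _ _) (*-congʳ (∫-countIn ½ c σ)))

    ∫-edges [] = refl
    ∫-edges {suc n} (outside ∷ σ) = trans (int-cong (vec M n) λ _ → ∫-edges σ)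
      (int-const (vec M n) (vec-normalised {M = M} unit n) _)
    ∫-edges (left ∷ σ) = trans (∫-row σ isRight) (sym (^-homo-* (average ½) (count isRight σ) _))
    ∫-edges (right ∷ σ) = trans (∫-row σ isLeft)
      (trans (sym (^-homo-* (average ½) (count isLeft σ) _))
        (reflexive (cong (average ½ ^_) (≡.sym (ℕ.*-suc (count isLeft σ) (count isRight σ))))))

  module _ {p} (0≤p : 0# ≤ p) (p≤1 : p ≤ 1#) where

    private
      M = coin p 0≤p p≤1
      unit = coin-normalised p 0≤p p≤1

    -- This is 1 - ½ p^k: the chance that a vertex is not a common neighbour of k given vertices
    -- when, in addition, each common neighbour is kept only with probability ½.
    missProbability : ℕ → Carrier
    missProbability = iterated M unit

    missProbability-compl : ∀ k → ½ * p ^ k + missProbability k ≈ 1#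
    missProbability-compl zero    = trans (+-congʳ (*-identityʳ ½)) ½+½≈1
    missProbability-compl (suc k) = begin-equality
      ½ * (p * p ^ k) + (p * missProbability k + (1# - p) * 1#)
        ≈⟨ solve 5 (λ h p w ρ q → h :* (p :* w) :+ (p :* ρ :+ q :* con 1) := p :* (h :* w :+ ρ) :+ q) refl ½ p (p ^ k) (missProbability k) (1# - p) ⟩
      p * (½ * p ^ k + missProbability k) + (1# - p)
        ≈⟨ +-congʳ (trans (*-congˡ (missProbability-compl k)) (*-identityʳ p)) ⟩
      p + (1# - p)   ≈⟨ p+[1-p]≈1 p ⟩
      1#             ∎

    missProbability-nonNeg : ∀ k → 0# ≤ missProbability k
    missProbability-nonNeg zero    = <⇒≤ 0<½
    missProbability-nonNeg (suc k) = int-nonNeg M {λ b → if b then missProbability k else 1#} λ { true → missProbability-nonNeg k ; false → 0≤1 }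

    missProbability-mono : ∀ {j k} → j ℕ.≤ k → missProbability j ≤ missProbability k
    missProbability-mono {j} {k} j≤k = +-cancelˡ-≤ (½ * p ^ k) (begin
      ½ * p ^ k + missProbability j ≤⟨ +-monoˡ-≤ _ (*-monoʳ-≤ (<⇒≤ 0<½) (^-antimonoʳ-≤ 0≤p p≤1 j≤k)) ⟩
      ½ * p ^ j + missProbability j ≈⟨ trans (missProbability-compl j) (sym (missProbability-compl k)) ⟩
      ½ * p ^ k + missProbability k ∎)

    missProbability≤1 : ∀ k → missProbability k ≤ 1#
    missProbability≤1 k = ≤-trans (x≤y+x (*-nonNeg (<⇒≤ 0<½) (^-nonNeg k 0≤p))) (≤-reflexive (missProbability-compl k))

  -- The induction carries (1 + y)^m ≤ 1 + 2 m y for m ≤ n: the quadratic term 2 m y * y that arises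
  -- is at most y, because 2 n y ≤ 1.
  growth : ∀ {y} n → 0# ≤ y → fromℕ n * (y + y) ≤ 1# → (y + 1#) ^ n ≤ fromℕ 2
  growth {y} n 0≤y small = ≤-trans (go n ℕ.≤-refl) (≤-trans (+-monoʳ-≤ 1# small) (≤-reflexive (+-congˡ (sym fromℕ-1))))
    where
      go : ∀ m → m ℕ.≤ n → (y + 1#) ^ m ≤ 1# + fromℕ m * (y + y)
      go zero    _ = x≤x+y (≤-reflexive (sym (zeroˡ _)))
      go (suc m) m<n = begin
        (y + 1#) * (y + 1#) ^ m              ≤⟨ *-monoʳ-≤ (+-nonNeg 0≤y 0≤1) (go m m≤n) ⟩
        (y + 1#) * (1# + fromℕ m * (y + y))
          ≈⟨ solve 2 (λ y t → (y :+ con 1) :* (con 1 :+ t) := con 1 :+ t :+ y :+ t :* y) refl y _ ⟩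
        1# + t + y + t * y                   ≤⟨ +-monoʳ-≤ _ (*-monoˡ-≤ 0≤y (≤-trans (*-monoˡ-≤ (+-nonNeg 0≤y 0≤y) (fromℕ-mono-≤ m≤n)) small)) ⟩
        1# + t + y + 1# * y
          ≈⟨ solve 2 (λ y f → con 1 :+ f :* (y :+ y) :+ y :+ con 1 :* y := con 1 :+ (con 1 :+ f) :* (y :+ y)) refl y (fromℕ m) ⟩
        1# + fromℕ (suc m) * (y + y)         ∎
        where
          t = fromℕ m * (y + y)
          m≤n = ℕ.≤-trans (ℕ.n≤1+n m) m<n

  Dominates : ∀ {X} → Functional X → X → Set
  Dominates M x = ∀ f → (∀ y → 0# ≤ f y) → f x ≤ int M f

  vec-dominates : ∀ {X} {M : Functional X} → (∀ x → Dominates M x) → ∀ {m} (v : Vec X m) → Dominates (vec M m) v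
  vec-dominates d []      f p = ≤-refl
  vec-dominates {M = M} d {suc m} (x ∷ v) f p = ≤-trans (vec-dominates {M = M} d v _ λ w → p (x ∷ w))
    (d x _ λ y → int-nonNeg (vec M m) λ w → p (y ∷ w))

  three-dominates : ∀ τ → Dominates three τ
  three-dominates left    f p = x≤x+y (+-nonNeg (p right) (p outside))
  three-dominates right   f p = ≤-trans (x≤x+y (p outside)) (x≤y+x (p left))
  three-dominates outside f p = ≤-trans (x≤y+x (p right)) (x≤y+x (p left))

  pair-dominates : ∀ b → Dominates pair b
  pair-dominates true  f p = x≤x+y (p false)
  pair-dominates false f p = x≤y+x (p true)

  -- The way back from the first moment to counting: a summand below 1 yields a strict bound for the
  -- counted quantity.
  exponent-compare : ∀ d c → fromℕ 2 ^ d * ½ ^ c < 1# → d ℕ.< c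
  exponent-compare d c small with c ℕ.≤? d
  ... | no q  = ℕ.≰⇒> q
  ... | yes q = contradiction (begin
    1#                    ≈⟨ trans (^-congˡ c 2*½≈1) (1^k≈1 c) ⟨
    (fromℕ 2 * ½) ^ c     ≈⟨ ^-distrib-* _ _ c ⟩
    fromℕ 2 ^ c * ½ ^ c   ≤⟨ *-monoˡ-≤ (^-nonNeg c (<⇒≤ 0<½)) (^-monoʳ-≤ (x≤x+y (fromℕ-nonNeg 1)) q) ⟩
    fromℕ 2 ^ d * ½ ^ c   ∎) (<⇒≱ small)

  gate : {P : Set} → Dec P → Carrier → Carrier
  gate (yes _) x = x
  gate (no  _) x = 0#

  gate-nonNeg : ∀ {P} (d : Dec P) {x} → 0# ≤ x → 0# ≤ gate d x
  gate-nonNeg (yes _) p = p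
  gate-nonNeg (no  _) p = ≤-refl

  gate-open : ∀ {P} (d : Dec P) → P → ∀ x → x ≤ gate d x
  gate-open (yes _) p x = ≤-refl
  gate-open (no ¬p) p x = contradiction p ¬p

  ∫-gate : ∀ {X P} {M : Functional X} → Normalised M → (d : Dec P) → ∀ {f b} → 0# ≤ b →
    (P → int M f ≤ b) → int M (λ x → gate d (f x)) ≤ b
  ∫-gate unit (yes p) 0≤b q = q p
  ∫-gate {M = M} unit (no _) 0≤b q = ≤-trans (≤-reflexive (int-const M unit 0#)) 0≤b

-- Common neighbours in G(n,p)

-- c is any upper bound of the common neighbourhood of the f i.
CommonNeighbours : ∀ {n} → ℕ → ℕ → Graph n → Set
CommonNeighbours {n} k d G = (f : Fin k → Fin n) (c : Fin n → Bool) →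
  (∀ w → (∀ i → adj G (f i) w ≡ true) → c w ≡ true) → d ℕ.< # c

side : Bool → Role
side true  = left
side false = right

-- All vertices outside K are right vertices, so `codegree` looks for common neighbours of K in the
-- whole graph.
sides : ∀ {n} → Vec Bool n → Vec Role n
sides = Vec.map side

count-sides : ∀ {n} (K : Vec Bool n) → count isLeft (sides K) ℕ.+ count isRight (sides K) ≡ n
count-sides []          = ≡.refl
count-sides (true ∷ K)  = cong suc (count-sides K)
count-sides (false ∷ K) = ≡.trans (ℕ.+-suc _ _) (cong suc (count-sides K))

module CommonNeighboursAAS (ℝ : RealNumbers) where
  open RealNumbers ℝ
  open Analysis ℝ
  open RandomGraph ℝ
  open OrderedField ℝ
  open ExponentialSeries ℝ
  open RootsAndLogarithms ℝ
  open Functionals ℝ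
  open Expectations ℝ
  open ≤-Reasoning

  Σpair : ∀ x n → int (vec pair n) (λ K → x ^ count isLeft (sides K)) ≈ (x + 1#) ^ n
  Σpair x zero    = refl
  Σpair x (suc n) = trans (+-cong (trans (int-* (vec pair n) x _) (*-congˡ (Σpair x n))) (Σpair x n))
    (solve 2 (λ x t → x :* t :+ t := (x :+ con 1) :* t) refl x _)

  floorLog-lower : ∀ {n l} → 2 ℕ.^ l ℕ.≤ n → fromℕ 2 ^ l ≤ fromℕ n
  floorLog-lower {n} {l} p = ≤-trans (≤-reflexive (sym (fromℕ-^ 2 l))) (fromℕ-mono-≤ p)

  log-half : ∀ {n} → 2 ℕ.≤ n → ½ ≤ log (fromℕ n)
  log-half p = ≤-trans (≤-reflexive (trans (sym (*-identityˡ ½)) (*-congʳ (sym fromℕ-1))))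
    (log-lower-2^ 1 (≤-trans (≤-reflexive (*-identityʳ _)) (fromℕ-mono-≤ p)))

  log-pos : ∀ {n} → 2 ℕ.≤ n → 0# < log (fromℕ n)
  log-pos p = <-≤-trans 0<½ (log-half p)

  -- Twice the exponent 4 + 2k of the decay, plus 2k to make up for the k
  -- vertices that are not candidates.  It is 27 for k = 3.
  threshold : ℕ → ℕ
  threshold k = suc (((4 ℕ.+ (k ℕ.+ k)) ℕ.+ (4 ℕ.+ (k ℕ.+ k))) ℕ.+ (k ℕ.+ k))

  module _ (k n l : ℕ) (2≤n : 2 ℕ.≤ n) (k≤n : k ℕ.≤ n) (2^l≤n : 2 ℕ.^ l ℕ.≤ n)
    (p : Carrier) (0≤p : 0# ≤ p) (p≤1 : p ≤ 1#)
    (dense : fromℕ (threshold k) * log (fromℕ n) ≤ p ^ k * fromℕ n) where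

    private
      -- Twice 2 + l is the number of usable edges per vertex that `assignment` asks for with two
      -- colours.
      d = (2 ℕ.+ l) ℕ.+ (2 ℕ.+ l)
      M = coin p 0≤p p≤1
      unit = coin-normalised p 0≤p p≤1
      ρ = missProbability 0≤p p≤1
      N² = fromℕ n * fromℕ n
      -- The weight of one vertex of K. All K together weigh (1 + x)^n ≤ 2, and the price N² ^ k for
      -- a set of at most k vertices is paid by the decay.
      x = N² ⁻¹
      0<n : 0# < fromℕ n
      0<n = fromℕ-pos′ (ℕ.≤-trans (ℕ.s≤s ℕ.z≤n) 2≤n)
      0<N² : 0# < N²
      0<N² = *-pos 0<n 0<n
      0<x : 0# < x
      0<x = ⁻¹-pos 0<N²
      1≤n : 1# ≤ fromℕ n
      1≤n = ≤-trans (≤-reflexive (sym fromℕ-1)) (fromℕ-mono-≤ (ℕ.≤-trans (ℕ.s≤s ℕ.z≤n) 2≤n))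
      1≤N² : 1# ≤ N²
      1≤N² = ≤-trans (≤-reflexive (sym (*-identityˡ 1#))) (*-mono-≤ 0≤1 (<⇒≤ 0<n) 1≤n 1≤n)

      summand : Graph n → Vec Bool n → Carrier
      -- The family `f` may have repetitions, so its image K can be any set of at most k vertices.
      summand G K = gate (count isLeft (sides K) ℕ.≤? k) (fromℕ 2 ^ d * ½ ^ codegree (sides K) G)

      summand-nonNeg : ∀ G K → 0# ≤ summand G K
      summand-nonNeg G K = gate-nonNeg (count isLeft (sides K) ℕ.≤? k)
        (*-nonNeg (^-nonNeg d (fromℕ-nonNeg 2)) (^-nonNeg (codegree (sides K) G) (<⇒≤ 0<½)))

    Φ-common : Graph n → Carrier
    Φ-common G = int (vec pair n) (summand G)

    Φ-common-nonNeg : ∀ G → 0# ≤ Φ-common G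
    Φ-common-nonNeg G = int-nonNeg (vec pair n) (summand-nonNeg G)

    Φ-common<1 : ∀ G → Φ-common G < 1# → CommonNeighbours k d G
    Φ-common<1 G small f c h = ℕ.<-≤-trans d<codegree (codegree≤# (sides K) G c λ w _ k → h w λ i → k (f i) (isLeft-f i))
      where
        b : Fin n → Bool
        b v = does (any? λ i → f i ≟ v)
        K : Vec Bool n
        K = Vec.tabulate b
        lookup-K : ∀ v → lookup (sides K) v ≡ side (b v)
        lookup-K v = ≡.trans (lookup-map v side K) (cong side (lookup∘tabulate b v))
        isLeft-f : ∀ i → lookup (sides K) (f i) ≡ left
        isLeft-f i = ≡.trans (lookup-K (f i)) (cong side (dec-true (any? λ j → f j ≟ f i) (i , ≡.refl)))
        isLeft-side : ∀ b → isLeft (side b) ≡ b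
        isLeft-side true  = ≡.refl
        isLeft-side false = ≡.refl
        K≤k : count isLeft (sides K) ℕ.≤ k
        K≤k = ℕ.≤-trans (ℕ.≤-reflexive (#-cong λ v → ≡.trans (cong isLeft (lookup-K v)) (isLeft-side (b v)))) (#-image f)
        d<codegree : d ℕ.< codegree (sides K) G
        d<codegree = exponent-compare d (codegree (sides K) G) (≤-<-trans
          (≤-trans (gate-open (count isLeft (sides K) ℕ.≤? k) K≤k _)
            (vec-dominates {M = pair} pair-dominates K (summand G) (summand-nonNeg G))) small)

    private
      ℓ = log (fromℕ n)
      -- Powers of n to be outweighed: one for the rate 1/n, two for 2^d ≤ (4n)^2, and 2k for the
      -- weights.
      c = 3 ℕ.+ (k ℕ.+ k)
      m = n ℕ.∸ k
      h = ½ * p ^ k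

      m+k : fromℕ m + fromℕ k ≈ fromℕ n
      m+k = trans (sym (fromℕ-+ m k)) (reflexive (cong fromℕ (ℕ.m∸n+n≡m k≤n)))

      -- Only n - k vertices are candidates. The deficit k p^k ≤ k is charged to the logarithm by
      -- means of log n ≥ ½.
      k*p^k : fromℕ k * p ^ k ≤ fromℕ (k ℕ.+ k) * ℓ
      k*p^k = begin
        fromℕ k * p ^ k           ≤⟨ *-monoʳ-≤ (fromℕ-nonNeg k) (x^k≤1 k 0≤p p≤1) ⟩
        fromℕ k * 1#              ≈⟨ *-congˡ ½+½≈1 ⟨
        fromℕ k * (½ + ½)         ≤⟨ *-monoʳ-≤ (fromℕ-nonNeg k) (+-mono-≤ (log-half 2≤n) (log-half 2≤n)) ⟩
        fromℕ k * (ℓ + ℓ)         ≈⟨ solve 2 (λ k l → k :* (l :+ l) := (k :+ k) :* l) refl _ _ ⟩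
        (fromℕ k + fromℕ k) * ℓ   ≈⟨ *-congʳ (fromℕ-+ k k) ⟨
        fromℕ (k ℕ.+ k) * ℓ       ∎

      exponent : fromℕ (suc c) * ℓ < fromℕ m * h
      exponent with (fromℕ m * h) ≤? (fromℕ (suc c) * ℓ)
      ... | no q  = ≰⇒> q
      ... | yes q = contradiction (begin
        fromℕ (threshold k) * ℓ     ≤⟨ dense ⟩
        p ^ k * fromℕ n             ≈⟨ *-congˡ m+k ⟨
        p ^ k * (fromℕ m + fromℕ k) ≈⟨ distribˡ _ _ _ ⟩
        p ^ k * fromℕ m + p ^ k * fromℕ k
          ≈⟨ +-cong (trans (sym (*-identityʳ _)) (*-congˡ (sym ½+½≈1))) (*-comm _ _) ⟩
        p ^ k * fromℕ m * (½ + ½) + fromℕ k * p ^ k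
          ≈⟨ +-congʳ (solve 3 (λ P m h → P :* m :* (h :+ h) := m :* (h :* P) :+ m :* (h :* P)) refl _ _ _) ⟩
        (fromℕ m * h + fromℕ m * h) + fromℕ k * p ^ k  ≤⟨ +-mono-≤ (+-mono-≤ q q) k*p^k ⟩
        (fromℕ (suc c) * ℓ + fromℕ (suc c) * ℓ) + fromℕ (k ℕ.+ k) * ℓ
          ≈⟨ +-congʳ (trans (*-congʳ (fromℕ-+ (suc c) (suc c))) (distribʳ ℓ _ _)) ⟨
        fromℕ (suc c ℕ.+ suc c) * ℓ + fromℕ (k ℕ.+ k) * ℓ
          ≈⟨ trans (*-congʳ (fromℕ-+ (suc c ℕ.+ suc c) (k ℕ.+ k))) (distribʳ ℓ _ _) ⟨
        fromℕ ((suc c ℕ.+ suc c) ℕ.+ (k ℕ.+ k)) * ℓ ∎)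
        -- The outer `suc` of `threshold` supplies the strictness.
        (<⇒≱ (*-monoˡ-< (log-pos 2≤n) (fromℕ-mono-< {(suc c ℕ.+ suc c) ℕ.+ (k ℕ.+ k)} ℕ.≤-refl)))

      n^c : fromℕ n ^ suc c * ρ k ^ m ≤ 1#
      n^c = decay m c n (*-nonNeg (<⇒≤ 0<½) (^-nonNeg k 0≤p)) (missProbability-nonNeg 0≤p p≤1 k)
        (missProbability-compl 0≤p p≤1 k) exponent

      B : Carrier
      B = fromℕ 2 ^ d * (N² ^ k * ρ k ^ m)

      0≤ρ^ : ∀ j i → 0# ≤ ρ j ^ i
      0≤ρ^ j i = ^-nonNeg i (missProbability-nonNeg 0≤p p≤1 j)

      0≤B : 0# ≤ B
      0≤B = *-nonNeg (^-nonNeg d (fromℕ-nonNeg 2)) (*-nonNeg (^-nonNeg k (<⇒≤ 0<N²)) (0≤ρ^ k m))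

      summand-bound : ∀ K → int (graph M n) (λ G → summand G K) ≤ B * x ^ count isLeft (sides K)
      summand-bound K = ∫-gate {M = graph M n} (graph-normalised {M} unit n) (i ℕ.≤? k)
        (*-nonNeg 0≤B (^-nonNeg i (<⇒≤ 0<x))) λ q → begin
        int (graph M n) (λ G → fromℕ 2 ^ d * ½ ^ codegree (sides K) G) ≈⟨ int-* (graph M n) _ _ ⟩
        fromℕ 2 ^ d * int (graph M n) (λ G → ½ ^ codegree (sides K) G) ≈⟨ *-congˡ (∫-codegree M unit (sides K)) ⟩
        fromℕ 2 ^ d * ρ i ^ j
          ≤⟨ *-monoʳ-≤ (^-nonNeg d (fromℕ-nonNeg 2)) (begin
            ρ i ^ j                          ≤⟨ ^-antimonoʳ-≤ (missProbability-nonNeg 0≤p p≤1 i) (missProbability≤1 0≤p p≤1 i) (m≤j q) ⟩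
            ρ i ^ m                          ≤⟨ ^-monoˡ-≤ m (missProbability-nonNeg 0≤p p≤1 i) (missProbability-mono 0≤p p≤1 q) ⟩
            ρ k ^ m                          ≈⟨ *-identityˡ _ ⟨
            -- Inserting 1 = (N² x)^i leaves the weight x^i in place, while N² ^ i is raised to N² ^
            -- k, which no longer depends on K.
            1# * ρ k ^ m                     ≈⟨ *-congʳ (trans (sym (^-distrib-* _ _ i)) (trans (^-congˡ i (*-inverseʳ 0<N²)) (1^k≈1 i))) ⟨
            N² ^ i * x ^ i * ρ k ^ m         ≤⟨ *-monoˡ-≤ (0≤ρ^ k m) (*-monoˡ-≤ (^-nonNeg i (<⇒≤ 0<x)) (^-monoʳ-≤ 1≤N² q)) ⟩
            N² ^ k * x ^ i * ρ k ^ m         ∎) ⟩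
        fromℕ 2 ^ d * (N² ^ k * x ^ i * ρ k ^ m)
          ≈⟨ solve 4 (λ t a y r → t :* (a :* y :* r) := t :* (a :* r) :* y) refl _ _ _ _ ⟩
        B * x ^ i ∎
        where
          i = count isLeft (sides K)
          j = count isRight (sides K)
          m≤j : i ℕ.≤ k → m ℕ.≤ j
          m≤j q = ℕ.≤-trans (ℕ.∸-monoʳ-≤ n q) (ℕ.≤-reflexive (≡.trans (cong (ℕ._∸ i) (≡.sym (count-sides K))) (ℕ.m+n∸m≡n i j)))

      2x-small : fromℕ n * (x + x) ≤ 1#
      2x-small = begin
        fromℕ n * (x + x)        ≈⟨ solve 2 (λ n x → n :* (x :+ x) := n :* ((con 1 :+ (con 1 :+ con 0)) :* x)) refl _ x ⟩
        fromℕ n * (fromℕ 2 * x)  ≤⟨ *-monoʳ-≤ (<⇒≤ 0<n) (*-monoˡ-≤ (<⇒≤ 0<x) (fromℕ-mono-≤ 2≤n)) ⟩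
        fromℕ n * (fromℕ n * x)  ≈⟨ *-assoc _ _ _ ⟨
        N² * x                   ≈⟨ *-inverseʳ 0<N² ⟩
        1#                       ∎

      2^[2+l]≤4n : fromℕ 2 ^ (2 ℕ.+ l) ≤ fromℕ 4 * fromℕ n
      2^[2+l]≤4n = begin
        fromℕ 2 * (fromℕ 2 * fromℕ 2 ^ l)   ≤⟨ *-monoʳ-≤ (fromℕ-nonNeg 2) (*-monoʳ-≤ (fromℕ-nonNeg 2) (floorLog-lower {n} {l} 2^l≤n)) ⟩
        fromℕ 2 * (fromℕ 2 * fromℕ n)       ≈⟨ *-assoc _ _ _ ⟨
        fromℕ 2 * fromℕ 2 * fromℕ n         ≈⟨ *-congʳ (fromℕ-* 2 2) ⟨
        fromℕ 4 * fromℕ n                   ∎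

      2^d≤ : fromℕ 2 ^ d ≤ fromℕ 4 * fromℕ n * (fromℕ 4 * fromℕ n)
      2^d≤ = ≤-trans (≤-reflexive (^-homo-* (fromℕ 2) (2 ℕ.+ l) (2 ℕ.+ l)))
        (*-mono-≤ (^-nonNeg (2 ℕ.+ l) (fromℕ-nonNeg 2)) (*-nonNeg (fromℕ-nonNeg 4) (<⇒≤ 0<n)) 2^[2+l]≤4n 2^[2+l]≤4n)

    Φ-common-mean : fromℕ n * int (graph M n) Φ-common ≤ fromℕ 32
    Φ-common-mean = begin
      N * int (graph M n) Φ-common
        ≈⟨ *-congˡ (vec-swap (graph M n) pair (pair-swap (graph M n)) n (λ K G → summand G K)) ⟩
      N * int (vec pair n) (λ K → int (graph M n) (λ G → summand G K))
        ≤⟨ *-monoʳ-≤ (<⇒≤ 0<n) (int-mono (vec pair n) summand-bound) ⟩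
      N * int (vec pair n) (λ K → B * x ^ count isLeft (sides K))
        ≈⟨ *-congˡ (trans (int-* (vec pair n) B _) (*-congˡ (Σpair x n))) ⟩
      N * (B * (x + 1#) ^ n)
        ≤⟨ *-monoʳ-≤ (<⇒≤ 0<n) (*-monoʳ-≤ 0≤B (growth n (<⇒≤ 0<x) 2x-small)) ⟩
      N * (B * fromℕ 2)
        ≤⟨ *-monoʳ-≤ (<⇒≤ 0<n) (*-monoˡ-≤ (fromℕ-nonNeg 2) (*-monoˡ-≤ (*-nonNeg (^-nonNeg k (<⇒≤ 0<N²)) (0≤ρ^ k m)) 2^d≤)) ⟩
      N * (four * N * (four * N) * (N² ^ k * ρ k ^ m) * fromℕ 2)
        ≈⟨ *-congˡ (*-congʳ (*-congˡ (*-congʳ (trans (^-distrib-* N N k) (sym (^-homo-* N k k)))))) ⟩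
      N * (four * N * (four * N) * (N ^ (k ℕ.+ k) * ρ k ^ m) * fromℕ 2)
        ≈⟨ solve 5 (λ N f P r t → N :* (f :* N :* (f :* N) :* (P :* r) :* t) := (f :* f :* t) :* (N :* (N :* (N :* P)) :* r)) refl N four _ _ _ ⟩
      (four * four * fromℕ 2) * (N ^ c * ρ k ^ m)
        ≤⟨ *-monoʳ-≤ (*-nonNeg (*-nonNeg (fromℕ-nonNeg 4) (fromℕ-nonNeg 4)) (fromℕ-nonNeg 2))
             (*-monoˡ-≤ (0≤ρ^ k m) (^-monoʳ-≤ 1≤n (ℕ.n≤1+n c))) ⟩
      (four * four * fromℕ 2) * (N ^ suc c * ρ k ^ m)
        ≤⟨ *-monoʳ-≤ (*-nonNeg (*-nonNeg (fromℕ-nonNeg 4) (fromℕ-nonNeg 4)) (fromℕ-nonNeg 2)) n^c ⟩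
      (four * four * fromℕ 2) * 1#   ≈⟨ *-identityʳ _ ⟩
      four * four * fromℕ 2          ≈⟨ trans (fromℕ-* 16 2) (*-congʳ (fromℕ-* 4 4)) ⟨
      fromℕ 32 ∎
      where
        N = fromℕ n
        four = fromℕ 4

  aas-commonNeighbours : ∀ k p (h : ∀ n → 0# ≤ p n × p n ≤ 1#) (A : ∀ n → Graph n → Set) →
    Eventually (λ n → fromℕ (threshold k) * log (fromℕ n) ≤ p n ^ k * fromℕ n) →
    (∀ n l (G : Graph n) → n ℕ.< 2 ℕ.^ suc l → CommonNeighbours k ((2 ℕ.+ l) ℕ.+ (2 ℕ.+ l)) G → ¬ ¬ A n G) →
    AAS p A
  aas-commonNeighbours k p h A (N , dense) good = aas-firstMoment p h A 32 (N ℕ.⊔ (k ℕ.⊔ 2) , λ n large →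
    let N≤n = ℕ.≤-trans (ℕ.m≤m⊔n N _) large
        k≤n = ℕ.≤-trans (ℕ.≤-trans (ℕ.m≤m⊔n k 2) (ℕ.m≤n⊔m N _)) large
        2≤n = ℕ.≤-trans (ℕ.≤-trans (ℕ.m≤n⊔m k 2) (ℕ.m≤n⊔m N _)) large
        (l , 2^l≤n , n<2^[1+l]) = floorLog n (ℕ.≤-trans (ℕ.s≤s ℕ.z≤n) 2≤n)
        (0≤p , p≤1) = h n
    in Φ-common k n l 2≤n k≤n 2^l≤n (p n) 0≤p p≤1 (dense n N≤n)
     , Φ-common-nonNeg k n l 2≤n k≤n 2^l≤n (p n) 0≤p p≤1 (dense n N≤n)
     , (λ G small → good n l G n<2^[1+l] (Φ-common<1 k n l 2≤n k≤n 2^l≤n (p n) 0≤p p≤1 (dense n N≤n) G small))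
     , Φ-common-mean k n l 2≤n k≤n 2^l≤n (p n) 0≤p p≤1 (dense n N≤n))

-- Expansion of G(n,p)

-- With the size of A fixed, the single inequality n^4 w^a ≤ 1 for w = 1 - p/2 is enough: the bound
-- on the number of edges is proportional to the size of B, so this inequality may be raised to the
-- power |B|.
Expanding : ∀ {n} → ℕ → ℕ → ℕ → Graph n → Set
Expanding {n} l a b G = (A B : Fin n → Bool) → (∀ i → A i ≡ true → B i ≡ false) →
  # A ≡ a → b ℕ.≤ # B → l ℕ.* # B ℕ.< edgeSum G A B

roleOf : Bool → Bool → Role
roleOf true  _     = left
roleOf false true  = right
roleOf false false = outside

module ExpansionAAS (ℝ : RealNumbers) where
  open RealNumbers ℝ
  open Analysis ℝ
  open RandomGraph ℝ
  open OrderedField ℝ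
  open ExponentialSeries ℝ
  open RootsAndLogarithms ℝ
  open Functionals ℝ
  open Expectations ℝ
  open CommonNeighboursAAS ℝ using (floorLog-lower)
  open ≤-Reasoning

  Σthree : ∀ x n → int (vec three n) (λ σ → x ^ (count isLeft σ ℕ.+ count isRight σ)) ≈ ((x + x) + 1#) ^ n
  Σthree x zero    = refl
  Σthree x (suc n) = trans
    (+-cong (trans (int-* (vec three n) x _) (*-congˡ (Σthree x n)))
      (+-cong (trans (int-cong (vec three n) λ σ → reflexive (cong (x ^_) (ℕ.+-suc (count isLeft σ) (count isRight σ))))
        (trans (int-* (vec three n) x _) (*-congˡ (Σthree x n)))) (Σthree x n)))
    (solve 2 (λ x t → x :* t :+ (x :* t :+ t) := ((x :+ x) :+ con 1) :* t) refl x _)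

  module _ (n l a b : ℕ) (4≤n : 4 ℕ.≤ n) (2^l≤n : 2 ℕ.^ l ℕ.≤ n) (2a<b : a ℕ.+ a ℕ.< b)
    (p : Carrier) (0≤p : 0# ≤ p) (p≤1 : p ≤ 1#)
    (large : fromℕ 4 * log (fromℕ n) < fromℕ a * (½ * p ^ 1)) where

    private
      M = coin p 0≤p p≤1
      unit = coin-normalised p 0≤p p≤1
      w = missProbability 0≤p p≤1 1
      0≤w = missProbability-nonNeg 0≤p p≤1 1
      N = fromℕ n
      N² = N * N
      -- A vertex can join a pair of sets in two ways, so the total weight is (1 + 2x)^n; with 4 ≤ n
      -- it is still at most 2.
      x = N² ⁻¹
      1≤n : 1 ℕ.≤ n
      1≤n = ℕ.≤-trans (ℕ.s≤s ℕ.z≤n) 4≤n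
      0<N : 0# < N
      0<N = fromℕ-pos′ 1≤n
      0<N² : 0# < N²
      0<N² = *-pos 0<N 0<N
      0<x : 0# < x
      0<x = ⁻¹-pos 0<N²
      1≤N : 1# ≤ N
      1≤N = ≤-trans (≤-reflexive (sym fromℕ-1)) (fromℕ-mono-≤ 1≤n)

      Sized : Vec Role n → Set
      Sized σ = count isLeft σ ≡ a × b ℕ.≤ count isRight σ

      sized? : ∀ σ → Dec (Sized σ)
      sized? σ = (count isLeft σ ℕ.≟ a) ×-dec (b ℕ.≤? count isRight σ)

      summand : Graph n → Vec Role n → Carrier
      summand G σ = gate (sized? σ) (fromℕ 2 ^ (l ℕ.* count isRight σ) * ½ ^ edges σ G)

      summand-nonNeg : ∀ G σ → 0# ≤ summand G σ
      summand-nonNeg G σ = gate-nonNeg (sized? σ)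
        (*-nonNeg (^-nonNeg (l ℕ.* count isRight σ) (fromℕ-nonNeg 2)) (^-nonNeg (edges σ G) (<⇒≤ 0<½)))

    Φ-expanding : Graph n → Carrier
    Φ-expanding G = int (vec three n) (summand G)

    Φ-expanding-nonNeg : ∀ G → 0# ≤ Φ-expanding G
    Φ-expanding-nonNeg G = int-nonNeg (vec three n) (summand-nonNeg G)

    Φ-expanding<1 : ∀ G → Φ-expanding G < 1# → Expanding l a b G
    Φ-expanding<1 G small A B disjoint #A≡a b≤#B = ℕ.<-≤-trans
      (≡.subst (λ r → l ℕ.* r ℕ.< edges σ G) right≡ (exponent-compare (l ℕ.* count isRight σ) (edges σ G)
        (≤-<-trans (≤-trans (gate-open (sized? σ) (≡.trans left≡ #A≡a , ℕ.≤-trans b≤#B (ℕ.≤-reflexive (≡.sym right≡))) _)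
          (vec-dominates {M = three} three-dominates σ (summand G) (summand-nonNeg G))) small)))
      (ℕ.≤-trans (edges≤edgeSum σ G) (ℕ.≤-reflexive
        (sum-cong-≗ λ u → #-cong λ v → cong₂ (λ s t → s ∧ (t ∧ adj G u v)) (isLeft≡ u) (isRight≡ v))))
      where
        σ : Vec Role n
        σ = Vec.tabulate λ i → roleOf (A i) (B i)
        isLeft-roleOf : ∀ s t → isLeft (roleOf s t) ≡ s
        isLeft-roleOf true  _     = ≡.refl
        isLeft-roleOf false true  = ≡.refl
        isLeft-roleOf false false = ≡.refl
        isRight-roleOf : ∀ s t → (s ≡ true → t ≡ false) → isRight (roleOf s t) ≡ t
        isRight-roleOf true  t     q = ≡.sym (q ≡.refl)
        isRight-roleOf false true  q = ≡.refl
        isRight-roleOf false false q = ≡.refl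
        isLeft≡ : ∀ i → isLeft (lookup σ i) ≡ A i
        isLeft≡ i = ≡.trans (cong isLeft (lookup∘tabulate _ i)) (isLeft-roleOf (A i) (B i))
        isRight≡ : ∀ i → isRight (lookup σ i) ≡ B i
        isRight≡ i = ≡.trans (cong isRight (lookup∘tabulate _ i)) (isRight-roleOf (A i) (B i) (disjoint i))
        left≡ : count isLeft σ ≡ # A
        left≡ = #-cong isLeft≡
        right≡ : count isRight σ ≡ # B
        right≡ = #-cong isRight≡

    private
      N⁴w^a : N ^ 4 * w ^ a ≤ 1#
      N⁴w^a = decay a 3 n (*-nonNeg (<⇒≤ 0<½) (^-nonNeg 1 0≤p)) 0≤w (missProbability-compl 0≤p p≤1 1) large

      0≤rhs : ∀ i → 0# ≤ x ^ i * N ⁻¹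
      0≤rhs i = *-nonNeg (^-nonNeg i (<⇒≤ 0<x)) (⁻¹-nonNeg 0<N)

      -- Of the four powers n^r absorbed by n^4 w^a ≤ 1, one pays for 2^(l r) and three for the
      -- weights and the rate: 2 (a + r) + 1 ≤ 3 r because 2a < r. This is where B has to be more
      -- than twice as large as A.
      small-weight : ∀ r → a ℕ.+ a ℕ.< r → fromℕ 2 ^ (l ℕ.* r) * w ^ (a ℕ.* r) * (N² ^ (a ℕ.+ r) * N) ≤ 1#
      small-weight r 2a<r = begin
        fromℕ 2 ^ (l ℕ.* r) * w ^ (a ℕ.* r) * (N² ^ (a ℕ.+ r) * N)
          ≈⟨ *-cong (*-cong (sym (^-assocʳ (fromℕ 2) l r)) (sym (^-assocʳ w a r)))
               (trans (*-congʳ (trans (^-distrib-* N N (a ℕ.+ r)) (sym (^-homo-* N (a ℕ.+ r) (a ℕ.+ r))))) (*-comm _ _)) ⟩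
        (fromℕ 2 ^ l) ^ r * (w ^ a) ^ r * N ^ suc ((a ℕ.+ r) ℕ.+ (a ℕ.+ r))
          ≤⟨ *-mono-≤ (*-nonNeg (^-nonNeg r (^-nonNeg l (fromℕ-nonNeg 2))) 0≤w^) (^-nonNeg (3 ℕ.* r) (<⇒≤ 0<N))
               (*-monoˡ-≤ 0≤w^ (^-monoˡ-≤ r (^-nonNeg l (fromℕ-nonNeg 2)) (floorLog-lower {n} {l} 2^l≤n)))
               (^-monoʳ-≤ 1≤N exponents) ⟩
        N ^ r * (w ^ a) ^ r * N ^ (3 ℕ.* r)
          ≈⟨ solve 3 (λ s t u → s :* t :* u := (s :* u) :* t) refl _ _ _ ⟩
        N ^ r * N ^ (3 ℕ.* r) * (w ^ a) ^ r
          ≈⟨ *-congʳ (trans (sym (^-homo-* N r (3 ℕ.* r))) (sym (^-assocʳ N 4 r))) ⟩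
        (N ^ 4) ^ r * (w ^ a) ^ r     ≈⟨ ^-distrib-* _ _ r ⟨
        (N ^ 4 * w ^ a) ^ r           ≤⟨ x^k≤1 r (*-nonNeg (^-nonNeg 4 (<⇒≤ 0<N)) (^-nonNeg a 0≤w)) N⁴w^a ⟩
        1# ∎
        where
          0≤w^ : 0# ≤ (w ^ a) ^ r
          0≤w^ = ^-nonNeg r (^-nonNeg a 0≤w)
          exponents : suc ((a ℕ.+ r) ℕ.+ (a ℕ.+ r)) ℕ.≤ 3 ℕ.* r
          exponents = ℕ.≤-trans (ℕ.≤-reflexive (rearrange a r)) (ℕ.+-monoˡ-≤ (r ℕ.+ (r ℕ.+ 0)) 2a<r)
            where
              open +-*-Solver renaming (solve to solveℕ; _:=_ to _:≡_; _:+_ to _⊕_; con to conℕ)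
              rearrange : ∀ a r → suc ((a ℕ.+ r) ℕ.+ (a ℕ.+ r)) ≡ suc (a ℕ.+ a) ℕ.+ (r ℕ.+ (r ℕ.+ 0))
              rearrange = solveℕ 2 (λ a r → conℕ 1 ⊕ ((a ⊕ r) ⊕ (a ⊕ r)) :≡ (conℕ 1 ⊕ (a ⊕ a)) ⊕ (r ⊕ (r ⊕ conℕ 0))) ≡.refl

      -- The factor `N ⁻¹` is the rate demanded by `FirstMoment`; the power of x is the weight that
      -- `Σthree` sums up.
      summand-bound : ∀ σ → int (graph M n) (λ G → summand G σ) ≤ x ^ (count isLeft σ ℕ.+ count isRight σ) * N ⁻¹
      summand-bound σ = ∫-gate {M = graph M n} (graph-normalised {M} unit n) (sized? σ) (0≤rhs (count isLeft σ ℕ.+ r)) bound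
        where
          r = count isRight σ
          bound : Sized σ → int (graph M n) (λ G → fromℕ 2 ^ (l ℕ.* r) * ½ ^ edges σ G) ≤ x ^ (count isLeft σ ℕ.+ r) * N ⁻¹
          bound (#l≡a , b≤r) = begin
            int (graph M n) (λ G → fromℕ 2 ^ (l ℕ.* r) * ½ ^ edges σ G)  ≈⟨ int-* (graph M n) _ _ ⟩
            fromℕ 2 ^ (l ℕ.* r) * int (graph M n) (λ G → ½ ^ edges σ G)  ≈⟨ *-congˡ (trans (∫-edges M unit σ) (reflexive (cong (λ a → w ^ (a ℕ.* r)) #l≡a))) ⟩
            W                                                            ≈⟨ *-identityʳ _ ⟨
            W * 1#                                                       ≈⟨ *-congˡ (trans (*-cong inverse^ (*-inverseʳ 0<N)) (*-identityˡ 1#)) ⟨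
            W * (N² ^ i * x ^ i * (N * N ⁻¹)) ≈⟨ *-congˡ (*-identityʳ _) ⟨
            W * (N² ^ i * x ^ i * (N * N ⁻¹) * 1#)
              ≈⟨ solve 5 (λ W s t u v → W :* (s :* t :* (u :* v) :* con 1) := W :* (s :* u) :* (t :* v)) refl _ _ _ _ _ ⟩
            W * (N² ^ i * N) * (x ^ i * N ⁻¹)                            ≤⟨ *-monoˡ-≤ (0≤rhs i) (small-weight r (ℕ.<-≤-trans 2a<b b≤r)) ⟩
            1# * (x ^ i * N ⁻¹)                                          ≈⟨ *-identityˡ _ ⟩
            x ^ i * N ⁻¹                                                 ≈⟨ reflexive (cong (λ a → x ^ (a ℕ.+ r) * N ⁻¹) #l≡a) ⟨
            x ^ (count isLeft σ ℕ.+ r) * N ⁻¹                            ∎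
            where
              i = a ℕ.+ r
              W = fromℕ 2 ^ (l ℕ.* r) * w ^ (a ℕ.* r)
              inverse^ : N² ^ i * x ^ i ≈ 1#
              inverse^ = trans (sym (^-distrib-* _ _ i)) (trans (^-congˡ i (*-inverseʳ 0<N²)) (1^k≈1 i))

      4x-small : fromℕ n * ((x + x) + (x + x)) ≤ 1#
      4x-small = begin
        N * ((x + x) + (x + x))
          ≈⟨ solve 2 (λ n x → n :* ((x :+ x) :+ (x :+ x)) := n :* ((con 1 :+ (con 1 :+ (con 1 :+ (con 1 :+ con 0)))) :* x)) refl N x ⟩
        N * (fromℕ 4 * x)   ≤⟨ *-monoʳ-≤ (<⇒≤ 0<N) (*-monoˡ-≤ (<⇒≤ 0<x) (fromℕ-mono-≤ 4≤n)) ⟩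
        N * (N * x)         ≈⟨ *-assoc _ _ _ ⟨
        N² * x              ≈⟨ *-inverseʳ 0<N² ⟩
        1#                  ∎

    Φ-expanding-mean : fromℕ n * int (graph M n) Φ-expanding ≤ fromℕ 2
    Φ-expanding-mean = begin
      N * int (graph M n) Φ-expanding
        ≈⟨ *-congˡ (vec-swap (graph M n) three (three-swap (graph M n)) n (λ σ G → summand G σ)) ⟩
      N * int (vec three n) (λ σ → int (graph M n) (λ G → summand G σ))
        ≤⟨ *-monoʳ-≤ (<⇒≤ 0<N) (int-mono (vec three n) summand-bound) ⟩
      N * int (vec three n) (λ σ → x ^ (count isLeft σ ℕ.+ count isRight σ) * N ⁻¹)
        ≈⟨ *-congˡ (trans (int-*ʳ (vec three n) (N ⁻¹) _) (trans (*-congʳ (Σthree x n)) (*-comm _ _))) ⟩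
      N * (N ⁻¹ * ((x + x) + 1#) ^ n)   ≈⟨ x*[x⁻¹*y] 0<N _ ⟩
      ((x + x) + 1#) ^ n                ≤⟨ growth n (+-nonNeg (<⇒≤ 0<x) (<⇒≤ 0<x)) 4x-small ⟩
      fromℕ 2 ∎

  aas-expanding : ∀ p (h : ∀ n → 0# ≤ p n × p n ≤ 1#) (A : ∀ n → Graph n → Set) →
    Eventually (λ n → ∃ λ l → ∃ λ a → ∃ λ b → 4 ℕ.≤ n × 2 ℕ.^ l ℕ.≤ n × a ℕ.+ a ℕ.< b ×
      fromℕ 4 * log (fromℕ n) < fromℕ a * (½ * p n ^ 1) × (∀ (G : Graph n) → Expanding l a b G → ¬ ¬ A n G)) →
    AAS p A
  aas-expanding p h A (N , good) = aas-firstMoment p h A 2 (N , λ n N≤n →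
    let (l , a , b , 4≤n , 2^l≤n , 2a<b , large , imp) = good n N≤n
        (0≤p , p≤1) = h n
    in Φ-expanding n l a b 4≤n 2^l≤n 2a<b (p n) 0≤p p≤1 large
     , Φ-expanding-nonNeg n l a b 4≤n 2^l≤n 2a<b (p n) 0≤p p≤1 large
     , (λ G small → imp G (Φ-expanding<1 n l a b 4≤n 2^l≤n 2a<b (p n) 0≤p p≤1 large G small))
     , Φ-expanding-mean n l a b 4≤n 2^l≤n 2a<b (p n) 0≤p p≤1 large)

-- Random choices of colours

module Assignments (ℝ : RealNumbers) where
  open RealNumbers ℝ
  open OrderedField ℝ
  open Functionals ℝ
  open Expectations ℝ
  open ≤-Reasoning

  total# : ∀ r → Functional (Fin r)
  total# zero = record { int = λ _ → 0# ; int-mono = λ _ → ≤-refl ; int-+ = λ _ _ → sym (+-identityˡ 0#) ; int-* = λ c _ → sym (zeroʳ c) }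
  total# (suc r) = plus (point zero) (product {X = Fin 1} (λ _ i → suc i) (point zero) (total# r))

  total-swap : ∀ {Y} (N : Functional Y) → ∀ r → swapWith N (total# r)
  total-swap N zero f = trans (trans (int-cong N λ _ → sym (zeroˡ 0#)) (int-* N 0# (λ _ → 0#))) (zeroˡ _)
  total-swap N (suc r) f = trans (int-+ N _ _) (+-congˡ (total-swap N r _))

  total-dominates : ∀ {r} (i : Fin r) → Dominates (total# r) i
  total-dominates {suc r} zero    f p = x≤x+y (int-nonNeg (total# r) λ i → p (suc i))
  total-dominates (suc i) f p = ≤-trans (total-dominates i _ λ j → p (suc j)) (x≤y+x (p zero))

  total-const : ∀ r → int (total# r) (λ _ → 1#) ≈ fromℕ r
  total-const zero    = refl
  total-const (suc r) = +-congˡ (total-const r)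

  total-indicator : ∀ {r} (c : Fin r) α → int (total# r) (λ i → if does (c ≟ i) then α else 1#) + 1# ≈ α + fromℕ r
  total-indicator {suc r} zero    α = trans (+-congʳ (+-congˡ (total-const r)))
    (solve 2 (λ a s → (a :+ s) :+ con 1 := a :+ (con 1 :+ s)) refl α (fromℕ r))
  total-indicator {suc r} (suc c) α = trans (+-assoc 1# _ 1#) (trans (+-congˡ (total-indicator c α))
    (solve 2 (λ a s → con 1 :+ (a :+ s) := a :+ (con 1 :+ s)) refl α (fromℕ r)))

  -- From (1 + m x)(1 - x)^m ≤ 1, whose first factor is 2 when m x = 1. It plays the part of (1 -
  -- 1/m)^m ≤ 1/e.
  halving : ∀ {x w} m → 0# ≤ x → 0# ≤ w → x + w ≈ 1# → fromℕ m * x ≈ 1# → w ^ m ≤ ½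
  halving {x} {w} m 0≤x 0≤w x+w≈1 mx≈1 = *-cancelˡ-≤ (fromℕ-pos 1) (begin
    fromℕ 2 * w ^ m           ≈⟨ *-congʳ (+-congˡ (trans fromℕ-1 (sym mx≈1))) ⟩
    (1# + fromℕ m * x) * w ^ m ≤⟨ go m ⟩
    1#                        ≈⟨ 2*½≈1 ⟨
    fromℕ 2 * ½               ∎)
    where
      go : ∀ m → (1# + fromℕ m * x) * w ^ m ≤ 1#
      go zero    = ≤-reflexive (trans (*-identityʳ _) (trans (+-congˡ (zeroˡ x)) (+-identityʳ 1#)))
      go (suc m) = begin
        (1# + fromℕ (suc m) * x) * (w * w ^ m)  ≈⟨ *-assoc _ _ _ ⟨
        (1# + fromℕ (suc m) * x) * w * w ^ m    ≤⟨ *-monoˡ-≤ (^-nonNeg m 0≤w) (+-cancelʳ-≤ (1# * x) step) ⟩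
        (1# + fromℕ m * x) * w ^ m              ≤⟨ go m ⟩
        1#                                      ∎
        where
          t = 1# + fromℕ (suc m) * x
          step : t * w + 1# * x ≤ (1# + fromℕ m * x) + 1# * x
          step = begin
            t * w + 1# * x    ≤⟨ +-monoʳ-≤ _ (*-monoˡ-≤ 0≤x (x≤x+y (*-nonNeg (fromℕ-nonNeg (suc m)) 0≤x))) ⟩
            t * w + t * x     ≈⟨ trans (sym (distribˡ t w x)) (trans (*-congˡ (trans (+-comm w x) x+w≈1)) (*-identityʳ t)) ⟩
            t                 ≈⟨ solve 2 (λ m x → con 1 :+ (con 1 :+ m) :* x := (con 1 :+ m :* x) :+ con 1 :* x) refl _ x ⟩
            (1# + fromℕ m * x) + 1# * x ∎

  module _ (r′ : ℕ) where
    private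
      r = suc r′
      u = fromℕ r ⁻¹
      0<u : 0# < u
      0<u = ⁻¹-pos (fromℕ-pos r′)
      ru≈1 : fromℕ r * u ≈ 1#
      ru≈1 = *-inverseʳ (fromℕ-pos r′)

    uniform : Functional (Fin r)
    uniform = scaled u (<⇒≤ 0<u) (total# r)

    uniform-normalised : Normalised uniform
    uniform-normalised = trans (*-congˡ (total-const r)) (*-inverseˡ (fromℕ-pos r′))

    private
      mean : Carrier → Fin r → Carrier
      mean α c = int uniform λ i → if does (c ≟ i) then α else 1#

      mean-compl : ∀ α β → α + β ≈ 1# → ∀ c → β * u + mean α c ≈ 1#
      mean-compl α β e c = +-cancelʳ-≈ (u * α) (begin-equality
        (β * u + mean α c) + u * α   ≈⟨ solve 4 (λ b u m a → (b :* u :+ m) :+ u :* a := m :+ u :* (a :+ b)) refl _ _ _ _ ⟩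
        mean α c + u * (α + β)       ≈⟨ +-congˡ (*-congˡ e) ⟩
        u * I + u * 1# ≈⟨ distribˡ u _ _ ⟨
        u * (I + 1#)   ≈⟨ *-congˡ (total-indicator c α) ⟩
        u * (α + fromℕ r)            ≈⟨ solve 3 (λ u a r → u :* (a :+ r) := r :* u :+ u :* a) refl _ _ _ ⟩
        fromℕ r * u + u * α          ≈⟨ +-congʳ ru≈1 ⟩
        1# + u * α                   ∎)
        where I = int (total# r) λ i → if does (c ≟ i) then α else 1#

      compl-unique : ∀ {x v w} → x + v ≈ 1# → x + w ≈ 1# → v ≈ w
      compl-unique {x} e f = +-cancelʳ-≈ x (trans (+-comm _ x) (trans e (trans (sym f) (+-comm x _))))

      -- `ρ` = 1 - 1/r is the chance that a uniform colour differs from a given one. `ρ½` = 1 -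
      -- 1/(2r) is the mean of ½ to the indicator that it agrees.
      ρ ρ½ : Carrier
      ρ  = mean 0# zero
      ρ½ = mean ½ zero

      e₀ : 0# + 1# ≈ 1#
      e₀ = +-identityˡ 1#

      mean-0 : ∀ c → mean 0# c ≈ ρ
      mean-0 c = compl-unique (mean-compl 0# 1# e₀ c) (mean-compl 0# 1# e₀ zero)

      mean-½ : ∀ c → mean ½ c ≈ ρ½
      mean-½ c = compl-unique (mean-compl ½ ½ ½+½≈1 c) (mean-compl ½ ½ ½+½≈1 zero)

      indicator : Carrier → Bool → Carrier
      indicator α b = if b then α else 1#

      indicator-nonNeg : ∀ {α} b → 0# ≤ α → 0# ≤ (if b then α else 1#)
      indicator-nonNeg true  p = p
      indicator-nonNeg false p = 0≤1

      0≤ρ : 0# ≤ ρ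
      0≤ρ = int-nonNeg uniform {λ i → indicator 0# (does (zero ≟ i))} λ i → indicator-nonNeg (does (zero ≟ i)) ≤-refl

      0≤ρ½ : 0# ≤ ρ½
      0≤ρ½ = int-nonNeg uniform {λ i → indicator ½ (does (zero ≟ i))} λ i → indicator-nonNeg (does (zero ≟ i)) (<⇒≤ 0<½)

      ρ^r : ρ ^ r ≤ ½
      ρ^r = halving r (<⇒≤ 0<u) 0≤ρ (trans (+-congʳ (sym (*-identityˡ u))) (mean-compl 0# 1# e₀ zero)) ru≈1

      ρ½^2r : ρ½ ^ (2 ℕ.* r) ≤ ½
      ρ½^2r = halving (2 ℕ.* r) (*-nonNeg (<⇒≤ 0<½) (<⇒≤ 0<u)) 0≤ρ½ (mean-compl ½ ½ ½+½≈1 zero)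
        (begin-equality
          fromℕ (2 ℕ.* r) * (½ * u)       ≈⟨ *-congʳ (fromℕ-* 2 r) ⟩
          fromℕ 2 * fromℕ r * (½ * u)     ≈⟨ solve 4 (λ t r h u → t :* r :* (h :* u) := t :* h :* (r :* u)) refl _ _ _ _ ⟩
          fromℕ 2 * ½ * (fromℕ r * u)     ≈⟨ *-cong 2*½≈1 ru≈1 ⟩
          1# * 1#                         ≈⟨ *-identityˡ 1# ⟩
          1#                              ∎)

      power-bound : ∀ {w} k j t → 0# ≤ w → w ≤ 1# → w ^ k ≤ ½ → k ℕ.* j ℕ.≤ t → w ^ t ≤ ½ ^ j
      power-bound {w} k j t 0≤w w≤1 q p = begin
        w ^ t         ≤⟨ ^-antimonoʳ-≤ 0≤w w≤1 p ⟩
        w ^ (k ℕ.* j) ≈⟨ ^-assocʳ w k j ⟨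
        (w ^ k) ^ j   ≤⟨ ^-monoˡ-≤ j (^-nonNeg k 0≤w) q ⟩
        ½ ^ j         ∎

      miss : Maybe (Fin r) → Fin r → Carrier
      miss nothing  i = 1#
      miss (just c) i = if does (c ≟ i) then 0# else 1#

      fail : ∀ {n} → (Fin n → Maybe (Fin r)) → Vec (Fin r) n → Carrier
      fail g []      = 1#
      fail g (i ∷ s) = miss (g zero) i * fail (λ j → g (suc j)) s

      miss-nonNeg : ∀ m i → 0# ≤ miss m i
      miss-nonNeg nothing  i = 0≤1
      miss-nonNeg (just c) i = indicator-nonNeg (does (c ≟ i)) ≤-refl

      fail-nonNeg : ∀ {n} (g : Fin n → Maybe (Fin r)) s → 0# ≤ fail g s
      fail-nonNeg g []      = 0≤1
      fail-nonNeg g (i ∷ s) = *-nonNeg (miss-nonNeg (g zero) i) (fail-nonNeg _ s)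

      miss-cases : ∀ m i → m ≡ just i ⊎ miss m i ≈ 1#
      miss-cases nothing  i = inj₂ refl
      miss-cases (just c) i with c ≟ i
      ... | yes ≡.refl = inj₁ ≡.refl
      ... | no _       = inj₂ refl

      fail<1 : ∀ {n} (g : Fin n → Maybe (Fin r)) s → fail g s < 1# → ∃ λ w → g w ≡ just (lookup s w)
      fail<1 g []      q = contradiction ≤-refl (<⇒≱ q)
      fail<1 g (i ∷ s) q with miss-cases (g zero) i
      ... | inj₁ e = zero , e
      ... | inj₂ e with fail<1 (λ j → g (suc j)) s (≤-<-trans (≤-reflexive (trans (sym (*-identityˡ _)) (*-congʳ (sym e)))) q)
      ...   | w , e′ = suc w , e′

      ∫-fail : ∀ {n} (g : Fin n → Maybe (Fin r)) → int (vec uniform n) (fail g) ≈ ρ ^ # (λ w → is-just (g w))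
      ∫-fail {zero}  g = refl
      ∫-fail {suc n} g = trans (int-cong uniform λ i → trans (int-* (vec uniform n) (miss (g zero) i) _) (*-congˡ (∫-fail (λ j → g (suc j)))))
        (trans (int-*ʳ uniform P (miss (g zero))) (step (g zero)))
        where
          P = ρ ^ # (λ w → is-just (g (suc w)))
          step : ∀ m → int uniform (miss m) * P ≈ ρ ^ (⟦ is-just m ⟧ ℕ.+ # (λ w → is-just (g (suc w))))
          step nothing  = trans (*-congʳ uniform-normalised) (*-identityˡ P)
          step (just c) = *-congʳ (mean-0 c)

      ∫-reserve : ∀ {n} (W : Fin n → Bool) c → int (vec uniform n) (λ s → ½ ^ # (λ w → W w ∧ does (c ≟ lookup s w))) ≈ ρ½ ^ # W
      ∫-reserve {zero}  W c = refl
      ∫-reserve {suc n} W c = step (W zero)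
        where
          rest : Vec (Fin r) n → ℕ
          rest s = # (λ w → W (suc w) ∧ does (c ≟ lookup s w))
          split : ∀ b s → ½ ^ (⟦ b ⟧ ℕ.+ rest s) ≈ (if b then ½ else 1#) * ½ ^ rest s
          split true  s = refl
          split false s = sym (*-identityˡ _)
          step : ∀ d → int uniform (λ i → int (vec uniform n) λ s → ½ ^ (⟦ d ∧ does (c ≟ i) ⟧ ℕ.+ rest s))
            ≈ ρ½ ^ (⟦ d ⟧ ℕ.+ # (λ w → W (suc w)))
          step false = trans (int-const uniform uniform-normalised _) (∫-reserve (λ w → W (suc w)) c)
          step true  = trans (int-cong uniform λ i → trans (int-cong (vec uniform n) (split (does (c ≟ i))))
            (trans (int-* (vec uniform n) (indicator ½ (does (c ≟ i))) _) (*-congˡ (∫-reserve (λ w → W (suc w)) c))))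
            (trans (int-*ʳ uniform _ (λ i → indicator ½ (does (c ≟ i)))) (*-congʳ (mean-½ c)))

    -- First moment method for a uniformly random s.
    assignment : ∀ {m n} l (f : Fin m → Fin n → Maybe (Fin r)) (W : Fin n → Bool) c b →
      m ℕ.< 2 ℕ.^ suc l → (2 ℕ.* r) ℕ.* suc b ℕ.≤ # W →
      ¬ ¬ Σ (Fin n → Fin r) λ s →
        (∀ v → r ℕ.* (2 ℕ.+ l) ℕ.≤ # (λ w → is-just (f v w)) → ∃ λ w → f v w ≡ just (s w)) ×
        b ℕ.< # (λ w → W w ∧ does (c ≟ s w))
    assignment {m} {n} l f W c b m<2^ W-large none = contradiction
      (≤-trans (≤-trans (≤-reflexive (sym (vec-normalised {M = uniform} uniform-normalised n)))
        (int-mono S λ s → ≮⇒≥ λ Ψ<1 → none (lookup s , satisfied s Ψ<1 , reserved s Ψ<1))) (≤-reflexive ∫Ψ))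
      (<⇒≱ (<-≤-trans (≤-<-trans (+-monoʳ-≤ _ second) (+-monoˡ-< ½ first)) (≤-reflexive ½+½≈1)))
      where
        S = vec uniform n
        t = r ℕ.* (2 ℕ.+ l)
        enough : ∀ v → Dec (t ℕ.≤ # (λ w → is-just (f v w)))
        enough v = t ℕ.≤? # (λ w → is-just (f v w))
        clause : Fin m → Vec (Fin r) n → Carrier
        clause v s = gate (enough v) (fail (f v) s)
        clause-nonNeg : ∀ s v → 0# ≤ clause v s
        clause-nonNeg s v = gate-nonNeg (enough v) (fail-nonNeg (f v) s)
        reserve : Vec (Fin r) n → ℕ
        reserve s = # (λ w → W w ∧ does (c ≟ lookup s w))
        -- The first part has mean below ½: there are fewer than 2^(1+l) clauses, each failing with
        -- probability at most 2^-(2+l). The second has mean at most ½ because W has at least 2 r (b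
        -- + 1) vertices. So some s has Ψ s < 1, and it satisfies both demands.
        Ψ : Vec (Fin r) n → Carrier
        Ψ s = int (total# m) (λ v → clause v s) + fromℕ 2 ^ b * ½ ^ reserve s
        ∫Ψ : int S Ψ ≈ int (total# m) (λ v → int S (clause v)) + fromℕ 2 ^ b * ρ½ ^ # W
        ∫Ψ = trans (int-+ S _ _) (+-cong (total-swap S m clause)
          (trans (int-* S _ _) (*-congˡ (∫-reserve W c))))
        reserved : ∀ s → Ψ s < 1# → b ℕ.< reserve s
        reserved s q = exponent-compare b (reserve s)
          (≤-<-trans (x≤y+x (int-nonNeg (total# m) (clause-nonNeg s))) q)
        satisfied : ∀ s → Ψ s < 1# → ∀ v → t ℕ.≤ # (λ w → is-just (f v w)) → ∃ λ w → f v w ≡ just (lookup s w)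
        satisfied s q v big = fail<1 (f v) s (≤-<-trans (≤-trans (gate-open (enough v) big _)
          (≤-trans (total-dominates v _ (clause-nonNeg s))
            (x≤x+y (*-nonNeg (^-nonNeg b (fromℕ-nonNeg 2)) (^-nonNeg (reserve s) (<⇒≤ 0<½)))))) q)
        ρ≤1 : ρ ≤ 1#
        ρ≤1 = ≤-trans (x≤y+x (*-nonNeg 0≤1 (<⇒≤ 0<u))) (≤-reflexive (mean-compl 0# 1# e₀ zero))
        ρ½≤1 : ρ½ ≤ 1#
        ρ½≤1 = ≤-trans (x≤y+x (*-nonNeg (<⇒≤ 0<½) (<⇒≤ 0<u))) (≤-reflexive (mean-compl ½ ½ ½+½≈1 zero))
        2^k½^k : ∀ k → fromℕ 2 ^ k * ½ ^ k ≈ 1#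
        2^k½^k k = trans (sym (^-distrib-* _ _ k)) (trans (^-congˡ k 2*½≈1) (1^k≈1 k))
        0<½^ : ∀ k → 0# < ½ ^ k
        0<½^ k = ^-pos k 0<½
        first : int (total# m) (λ v → int S (clause v)) < ½
        first = ≤-<-trans (begin
          int (total# m) (λ v → int S (clause v))
            ≤⟨ int-mono (total# m) (λ v → ∫-gate {M = S} (vec-normalised {M = uniform} uniform-normalised n) (enough v)
                 (<⇒≤ (0<½^ (2 ℕ.+ l))) λ big → ≤-trans (≤-reflexive (∫-fail (f v)))
                   (power-bound r (2 ℕ.+ l) (# (λ w → is-just (f v w))) 0≤ρ ρ≤1 ρ^r big)) ⟩
          int (total# m) (λ v → ½ ^ (2 ℕ.+ l))
            ≈⟨ trans (int-cong (total# m) λ _ → sym (*-identityʳ _)) (trans (int-* (total# m) _ _) (trans (*-congˡ (total-const m)) (*-comm _ _))) ⟩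
          fromℕ m * (½ * ½ ^ suc l)   ≈⟨ solve 3 (λ m h P → m :* (h :* P) := h :* (m :* P)) refl _ _ _ ⟩
          ½ * (fromℕ m * ½ ^ suc l)   ∎)
          (<-≤-trans (*-monoʳ-< 0<½ (<-≤-trans (*-monoˡ-< (0<½^ (suc l)) (fromℕ-mono-< m<2^))
            (≤-reflexive (trans (*-congʳ (fromℕ-^ 2 (suc l))) (2^k½^k (suc l)))))) (≤-reflexive (*-identityʳ ½)))
        second : fromℕ 2 ^ b * ρ½ ^ # W ≤ ½
        second = begin
          fromℕ 2 ^ b * ρ½ ^ # W
            ≤⟨ *-monoʳ-≤ (^-nonNeg b (fromℕ-nonNeg 2)) (power-bound (2 ℕ.* r) (suc b) (# W) 0≤ρ½ ρ½≤1 ρ½^2r W-large) ⟩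
          fromℕ 2 ^ b * (½ * ½ ^ b)   ≈⟨ solve 3 (λ t h P → t :* (h :* P) := h :* (t :* P)) refl _ _ _ ⟩
          ½ * (fromℕ 2 ^ b * ½ ^ b)   ≈⟨ trans (*-congˡ (2^k½^k b)) (*-identityʳ ½) ⟩
          ½                           ∎

-- Monochromatic subgraphs

-- The double negation shift, which holds for finite types. Classical arguments are carried out for
-- each colouring or vertex separately and then gathered under one double negation.
FiniteShift : Set → Set₁
FiniteShift A = (P : A → Set) → (∀ a → ¬ ¬ P a) → ¬ ¬ (∀ a → P a)

Fin-shift : ∀ n → FiniteShift (Fin n)
Fin-shift zero    P f k = k λ ()
Fin-shift (suc n) P f k = f zero λ p → Fin-shift n (λ i → P (suc i)) (λ i → f (suc i))
  λ q → k λ { zero → p ; (suc i) → q i }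

Vec-shift : ∀ {A} → FiniteShift A → ∀ m → FiniteShift (Vec A m)
Vec-shift S zero    P f k = f [] λ p → k λ { [] → p }
Vec-shift S (suc m) P f k = S (λ a → ∀ v → P (a ∷ v)) (λ a → Vec-shift S m (λ v → P (a ∷ v)) λ v → f (a ∷ v))
  λ q → k λ { (a ∷ v) → q a v }

Pairs-shift : ∀ {A} → FiniteShift A → ∀ n → FiniteShift (Pairs A n)
Pairs-shift S zero    P f k = f [] λ p → k λ { [] → p }
Pairs-shift S (suc n) P f k = Vec-shift S n (λ v → ∀ t → P (v ∷ t)) (λ v → Pairs-shift S n (λ t → P (v ∷ t)) λ t → f (v ∷ t))
  λ q → k λ { (v ∷ t) → q v t }

decidable₂ : ∀ {m n} (R : Fin m → Fin n → Set) → ¬ ¬ (∀ i j → Dec (R i j))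
decidable₂ {m} {n} R = Fin-shift m _ λ i → Fin-shift n _ λ j → ¬¬-excluded-middle

-- The least number principle. For an undecided P it holds up to double negation, which is all that
-- the probability of the event requires.
minimum : ∀ {P : ℕ → Set} {s} → P s → ¬ ¬ ∃ λ m → IsMinimum P m × m ℕ.≤ s
minimum {P} {s} p none = <-rec (λ m → m ℕ.≤ s → ¬ P m)
  (λ m smaller m≤s q → none (m , (q , λ k Pk → ℕ.≮⇒≥ λ k<m → smaller k<m (ℕ.≤-trans (ℕ.<⇒≤ k<m) m≤s) Pk) , m≤s)) s ℕ.≤-refl p

table : ∀ {A : Set} {n} → (Fin n → Fin n → A) → Pairs A n
table {n = zero}  f = []
table {n = suc n} f = Vec.tabulate (λ j → f zero (suc j)) ∷ table (λ i j → f (suc i) (suc j))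

at-table : ∀ {A : Set} {n} (f : Fin n → Fin n → A) → (∀ i j → f i j ≡ f j i) → ∀ i j → i ≢ j → at (table f) i j ≡ just (f i j)
at-table f f-sym zero    zero    i≢j = contradiction ≡.refl i≢j
at-table f f-sym zero    (suc j) i≢j = cong just (lookup∘tabulate _ j)
at-table f f-sym (suc i) zero    i≢j = ≡.trans (cong just (lookup∘tabulate _ i)) (cong just (f-sym zero (suc i)))
at-table f f-sym (suc i) (suc j) i≢j = at-table _ (λ k l → f-sym (suc k) (suc l)) i j (λ e → i≢j (cong suc e))

Adj⇒adj : ∀ {n} (G : Graph n) {i j} → Adj G i j → adj G i j ≡ true
Adj⇒adj G e = cong isTrue e

adj⇒Adj : ∀ {n} (G : Graph n) {i j} → adj G i j ≡ true → Adj G i j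
adj⇒Adj G {i} {j} e with at G i j
... | just true = ≡.refl

Adj-sym : ∀ {n} (G : Graph n) {i j} → Adj G i j → Adj G j i
Adj-sym G {i} {j} e = ≡.trans (at-sym G j i) e

Adj⇒≢ : ∀ {n} (G : Graph n) {i j} → Adj G i j → i ≢ j
Adj⇒≢ G {i} e ≡.refl with ≡.trans (≡.sym e) (at-irrefl G i)
... | ()

module _ {n} (f : Fin n → Fin n → Bool) (f-sym : ∀ i j → f i j ≡ f j i) where

  table-Adj⁺ : ∀ {i j} → i ≢ j → f i j ≡ true → Adj (table f) i j
  table-Adj⁺ {i} {j} i≢j e = ≡.trans (at-table f f-sym i j i≢j) (cong just e)

  table-Adj⁻ : ∀ {i j} → Adj (table f) i j → f i j ≡ true
  table-Adj⁻ {i} {j} e = just-injective (≡.trans (≡.sym (at-table f f-sym i j (Adj⇒≢ (table f) e))) e)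

hasLabel : ∀ {s} → Fin s → Maybe (Fin s) → Bool
hasLabel i (just j) = does (i ≟ j)
hasLabel i nothing  = false

hasLabel⁺ : ∀ {s} (i : Fin s) {m} → m ≡ just i → hasLabel i m ≡ true
hasLabel⁺ i ≡.refl = dec-true (i ≟ i) ≡.refl

hasLabel⁻ : ∀ {s} (i : Fin s) m → hasLabel i m ≡ true → m ≡ just i
hasLabel⁻ i (just j) e with i ≟ j
... | yes ≡.refl = ≡.refl

∈-tabulate⁺ : ∀ {n} (D : Fin n → Bool) {v} → D v ≡ true → v ∈ Vec.tabulate D
∈-tabulate⁺ D {v} e = lookup⇒[]= v _ (≡.trans (lookup∘tabulate D v) e)

∈-tabulate⁻ : ∀ {n} (D : Fin n → Bool) {v} → v ∈ Vec.tabulate D → D v ≡ true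
∈-tabulate⁻ D {v} e = ≡.trans (≡.sym (lookup∘tabulate D v)) ([]=⇒lookup e)

∣∣≡# : ∀ {n} (p : Subset n) → ∣ p ∣ ≡ # (lookup p)
∣∣≡# []          = ≡.refl
∣∣≡# (true ∷ p)  = cong suc (∣∣≡# p)
∣∣≡# (false ∷ p) = ∣∣≡# p

module _ {n r : ℕ} (G : Graph n) (χ : Colouring r n) where

  joined : Fin r → Fin n → Fin n → Bool
  joined c u w = adj G u w ∧ hasLabel c (at χ u w)

  joined-sym : ∀ c u w → joined c u w ≡ joined c w u
  joined-sym c u w = cong₂ (λ a m → a ∧ hasLabel c m) (adj-sym G u w) (at-sym χ u w)

  joined⇒≢ : ∀ {c u w} → joined c u w ≡ true → u ≢ w
  joined⇒≢ {c} e = Adj⇒≢ G (adj⇒Adj G (∧-trueˡ e))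

  joined⁺ : ∀ {u w} → adj G u w ≡ true → ∃ λ c → joined c u w ≡ true × at χ u w ≡ just c
  joined⁺ {u} {w} e = go (at χ u w) ≡.refl
    where
      at-just : ∀ {A n} (t : Pairs A n) i j → i ≢ j → ∃ λ a → at t i j ≡ just a
      at-just (v ∷ t) zero    zero    p = contradiction ≡.refl p
      at-just (v ∷ t) zero    (suc j) p = lookup v j , ≡.refl
      at-just (v ∷ t) (suc i) zero    p = lookup v i , ≡.refl
      at-just (v ∷ t) (suc i) (suc j) p = at-just t i j (λ e → p (cong suc e))
      go : ∀ m → at χ u w ≡ m → ∃ λ c → joined c u w ≡ true × at χ u w ≡ just c
      go _ _ with at-just χ u w (Adj⇒≢ G (adj⇒Adj G e))
      ... | c , q = c , ∧-true e (hasLabel⁺ c q) , q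

  joined-unique : ∀ {c d u w} → joined c u w ≡ true → joined d u w ≡ true → c ≡ d
  joined-unique {c} {d} {u} {w} p q = just-injective (≡.trans (≡.sym (hasLabel⁻ c (at χ u w) (∧-trueʳ {adj G u w} p))) (hasLabel⁻ d (at χ u w) (∧-trueʳ {adj G u w} q)))

  Link : Fin r → (Fin n → Bool) → Fin n → Fin n → Set
  Link c D u w = D u ≡ true × D w ≡ true × joined c u w ≡ true

  Link-sym : ∀ {c D u w} → Link c D u w → Link c D w u
  Link-sym {c} {D} {u} {w} (p , q , e) = q , p , ≡.trans (joined-sym c w u) e

  -- Paths from a single root suffice for connectedness, because links are symmetric. All paths stay
  -- inside D.
  Rooted : Fin r → (Fin n → Bool) → Set
  Rooted c D = Σ (Fin n) λ x → D x ≡ true × (∀ v → D v ≡ true → Star (Link c D) x v)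

  piece : ∀ c D → Rooted c D → Σ (Subgraph G) λ H → (Connected H × Monochromatic χ H) × V H ≡ Vec.tabulate D
  piece c D (x , x∈D , reach) = H , (((x , ∈-tabulate⁺ D x∈D) , connected) , c , colour) , ≡.refl
    where
      f : Fin n → Fin n → Bool
      f u w = D u ∧ (D w ∧ joined c u w)
      f-sym : ∀ u w → f u w ≡ f w u
      f-sym u w with D u | D w
      ... | true  | true  = joined-sym c u w
      ... | true  | false = ≡.refl
      ... | false | true  = ≡.refl
      ... | false | false = ≡.refl
      edge⁻ : ∀ {u w} → Adj (table f) u w → Link c D u w
      edge⁻ {u} {w} e = ∧-trueˡ q , ∧-trueˡ (∧-trueʳ {D u} q) , ∧-trueʳ {D w} (∧-trueʳ {D u} q)
        where q = table-Adj⁻ f f-sym e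
      H : Subgraph G
      H = record
        { V    = Vec.tabulate D
        ; E    = table f
        ; E⊆G  = λ e → adj⇒Adj G (∧-trueˡ (proj₂ (proj₂ (edge⁻ e))))
        ; ends = λ e → ∈-tabulate⁺ D (proj₁ (edge⁻ e)) , ∈-tabulate⁺ D (proj₁ (proj₂ (edge⁻ e)))
        }
      colour : ∀ {u w} → Adj (table f) u w → at χ u w ≡ just c
      colour {u} {w} e = hasLabel⁻ c (at χ u w) (∧-trueʳ {adj G u w} (proj₂ (proj₂ (edge⁻ e))))
      link⇒Adj : ∀ {u w} → Link c D u w → Adj (table f) u w
      link⇒Adj (p , q , e) = table-Adj⁺ f f-sym (joined⇒≢ {c} e) (∧-true p (∧-true q e))
      connected : ∀ {u v} → u ∈ V H → v ∈ V H → Star (Adj (E H)) u v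
      connected u∈ v∈ = Star.map link⇒Adj
        (Star.reverse (λ {u} {w} → Link-sym {c} {D} {u} {w}) (reach _ (∈-tabulate⁻ D u∈)) ◅◅ reach _ (∈-tabulate⁻ D v∈))

  module _ (Q : Subgraph G → Set) {s} (ℓ : Fin n → Maybe (Fin s)) where

    class : Fin s → Subset n
    class i = Vec.tabulate λ v → hasLabel i (ℓ v)

    -- A labelling makes disjointness automatic. An empty class has to be skipped, as a connected
    -- subgraph is nonempty; hence at most s subgraphs rather than exactly s.
    assemble : (∀ i → (∀ v → ℓ v ≢ just i) ⊎ Σ (Subgraph G) λ H → Q H × V H ≡ class i) →
      Σ (List (Subgraph G)) λ Hs → length Hs ℕ.≤ s × All Q Hs × VertexDisjoint Hs ×
        (∀ v i → ℓ v ≡ just i → v ∈ covered Hs)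
    assemble classes with go (allFin s) (allFin⁺ s)
      where
        go : ∀ is → Unique is → Σ (List (Subgraph G)) λ Hs → length Hs ℕ.≤ length is ×
          All Q Hs × All (λ H → ∃ λ i → i List.∈ is × V H ≡ class i) Hs × VertexDisjoint Hs ×
          (∀ v i → i List.∈ is → ℓ v ≡ just i → v ∈ covered Hs)
        go []       []         = [] , ℕ.z≤n , [] , [] , [] , λ v i ()
        go (i ∷ is) (i∉ ∷ is!) with go is is! | classes i
        ... | Hs , len , q , labels , disjoint , cover | inj₁ empty =
          Hs , ℕ.m≤n⇒m≤1+n len , q , All.map (λ { (j , j∈ , e) → j , there j∈ , e }) labels , disjoint ,
          λ { v j (here ≡.refl) e → contradiction e (empty v) ; v j (there j∈) e → cover v j j∈ e }
        ... | Hs , len , q , labels , disjoint , cover | inj₂ (H , QH , VH≡) =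
          H ∷ Hs , ℕ.s≤s len , QH ∷ q , (i , here ≡.refl , VH≡) ∷ All.map (λ { (j , j∈ , e) → j , there j∈ , e }) labels ,
          All.map (λ {K} → apart {K}) labels ∷ disjoint ,
          λ { v j (here ≡.refl) e → x∈p∪q⁺ (inj₁ (≡.subst (v ∈_) (≡.sym VH≡) (∈-tabulate⁺ _ (hasLabel⁺ i e))))
            ; v j (there j∈) e → x∈p∪q⁺ (inj₂ (cover v j j∈ e)) }
          where
            label : ∀ {v j K} → V K ≡ class j → v ∈ V K → ℓ v ≡ just j
            label {v} {j} e v∈ = hasLabel⁻ j (ℓ v) (∈-tabulate⁻ (λ v → hasLabel j (ℓ v)) (≡.subst (v ∈_) e v∈))
            apart : ∀ {K} → (∃ λ j → j List.∈ is × V K ≡ class j) → Empty (V H ∩ V K)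
            apart {K} (j , j∈ , e) (v , v∈) = All.lookup i∉ j∈
              (just-injective (≡.trans (≡.sym (label {K = H} VH≡ (proj₁ (x∈p∩q⁻ (V H) (V K) v∈)))) (label {K = K} e (proj₂ (x∈p∩q⁻ (V H) (V K) v∈)))))
    ... | Hs , len , q , _ , disjoint , cover =
      Hs , ℕ.≤-trans len (ℕ.≤-reflexive (length-tabulate {n = s} id)) , q , disjoint , λ v i → cover v i (∈-allFin i)

covering : ∀ {n} {G : Graph n} (Hs : List (Subgraph G)) → (∀ v → v ∈ covered Hs) → Covering Hs
covering Hs p = ⊆-antisym (λ _ → ∈⊤) (λ {v} _ → p v)

-- Spanning trees

module _ {n : ℕ} {G : Graph n} where

  edgeCount : Graph n → ℕ
  edgeCount F = sum λ i → # (adj F i)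

  private
    eq : Fin n → Fin n → Bool
    eq i j = does (i ≟ j)

    isPair : Fin n → Fin n → Fin n → Fin n → Bool
    isPair v w i j = (eq i v ∧ eq j w) ∨ (eq i w ∧ eq j v)

    isPair-sym : ∀ v w i j → isPair v w i j ≡ isPair v w j i
    isPair-sym v w i j = ≡.trans (∨-comm (eq i v ∧ eq j w) _) (cong₂ _∨_ (∧-comm (eq i w) (eq j v)) (∧-comm (eq i v) (eq j w)))

    isPair⁻ : ∀ v w i j → isPair v w i j ≡ true → (i ≡ v × j ≡ w) ⊎ (i ≡ w × j ≡ v)
    isPair⁻ v w i j e with i ≟ v | j ≟ w | i ≟ w | j ≟ v
    ... | yes p | yes q | _     | _     = inj₁ (p , q)
    ... | yes p | no q  | yes s | yes t = inj₂ (s , t)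
    ... | no p  | yes q | yes s | yes t = inj₂ (s , t)
    ... | no p  | no q  | yes s | yes t = inj₂ (s , t)
    ... | yes p | no q  | yes s | no t  with e
    ...   | ()
    isPair⁻ v w i j () | yes p | no q  | no s | _
    isPair⁻ v w i j () | no p  | yes q | yes s | no t
    isPair⁻ v w i j () | no p  | yes q | no s | _
    isPair⁻ v w i j () | no p  | no q  | yes s | no t
    isPair⁻ v w i j () | no p  | no q  | no s | _

  -- A connected subgraph with fewest edges is a tree: deleting the first
  -- edge of a cycle preserves connectedness, because the rest of the cycle
  -- avoids that edge.
  spanningTree : ∀ {r} {χ : Colouring r n} (H : Subgraph G) → Connected H × Monochromatic χ H →
    ¬ ¬ Σ (Subgraph G) λ T → (Tree T × Monochromatic χ T) × V T ≡ V H
  spanningTree {χ = χ} H₀ (conn₀ , mono₀) = go (suc (edgeCount (E H₀))) H₀ ℕ.≤-refl conn₀ mono₀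
    where
      go : ∀ m (H : Subgraph G) → edgeCount (E H) ℕ.< m → Connected H → Monochromatic χ H →
        ¬ ¬ Σ (Subgraph G) λ T → (Tree T × Monochromatic χ T) × V T ≡ V H
      go (suc m) H (ℕ.s≤s bound) conn@(nonempty , path) mono@(c , colour) none = none (H , ((conn , acyclic) , mono) , ≡.refl)
        where
          acyclic : ¬ Cycle H
          acyclic (v , w ∷ [] , ℕ.s≤s () , _)
          acyclic (v , w ∷ w′ ∷ ws , _ , (v≢w ∷ v≢w′ ∷ v∉ws) ∷ (w≢w′ ∷ w∉ws) ∷ _ , vw ∷ ww′ ∷ rest) =
            go m H′ (ℕ.<-≤-trans fewer bound) (nonempty , λ u∈ v∈ → Star.kleisliStar id replace (path u∈ v∈))
              (c , λ e → colour (F⊆E e)) none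
            where
              f : Fin n → Fin n → Bool
              f i j = adj (E H) i j ∧ not (isPair v w i j)
              f-sym : ∀ i j → f i j ≡ f j i
              f-sym i j = cong₂ (λ a b → a ∧ not b) (adj-sym (E H) i j) (isPair-sym v w i j)
              F : Graph n
              F = table f
              F⊆E : ∀ {i j} → Adj F i j → Adj (E H) i j
              F⊆E e = adj⇒Adj (E H) (∧-trueˡ (table-Adj⁻ f f-sym e))
              H′ : Subgraph G
              H′ = record { V = V H ; E = F ; E⊆G = λ e → E⊆G H (F⊆E e) ; ends = λ e → ends H (F⊆E e) }
              keep : ∀ {i j} → isPair v w i j ≡ false → Adj (E H) i j → Adj F i j
              keep q e = table-Adj⁺ f f-sym (Adj⇒≢ (E H) e) (∧-true (Adj⇒adj (E H) e) (cong not q))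
              avoid : ∀ {z j} → v ≢ z → w ≢ z → Adj (E H) z j → Adj F z j
              avoid {z} {j} p q = keep (≡.trans (cong₂ (λ a b → (a ∧ eq j w) ∨ (b ∧ eq j v)) (dec-false (z ≟ v) (p ∘ ≡.sym)) (dec-false (z ≟ w) (q ∘ ≡.sym))) ≡.refl)
              walk : ∀ z zs → v ≢ z → w ≢ z → All (v ≢_) zs → All (w ≢_) zs → Linked (Adj (E H)) (z ∷ (zs ∷ʳ v)) → Star (Adj F) z v
              walk z []        p q _        _        (e ∷ [-]) = avoid p q e ◅ ε
              walk z (z′ ∷ zs) p q (a ∷ as) (b ∷ bs) (e ∷ es) = avoid p q e ◅ walk z′ zs a b as bs es
              detour : Star (Adj F) w v
              detour = Adj-sym F (avoid v≢w′ w≢w′ (Adj-sym (E H) ww′)) ◅ walk w′ ws v≢w′ w≢w′ v∉ws w∉ws rest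
              replace : ∀ {i j} → Adj (E H) i j → Star (Adj F) i j
              replace {i} {j} e with isPair v w i j in q
              ... | false = keep q e ◅ ε
              ... | true with isPair⁻ v w i j q
              ...   | inj₁ (≡.refl , ≡.refl) = Star.reverse (Adj-sym F) detour
              ...   | inj₂ (≡.refl , ≡.refl) = detour
              adjF⇒ : ∀ i j → adj F i j ≡ true → adj (E H) i j ≡ true
              adjF⇒ i j e = Adj⇒adj (E H) (F⊆E (adj⇒Adj F e))
              removed : adj F v w ≡ false
              removed = ¬-not λ e → true≢false (∧-trueʳ (table-Adj⁻ f f-sym (adj⇒Adj F e)))
                (cong not (cong₂ (λ a b → (a ∧ b) ∨ (eq v w ∧ eq w v)) (dec-true (v ≟ v) ≡.refl) (dec-true (w ≟ w) ≡.refl)))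
              fewer : edgeCount F ℕ.< edgeCount (E H)
              fewer = sum-mono-< (λ i → #-mono (adjF⇒ i)) v (#-mono-< (adjF⇒ v) w removed (Adj⇒adj (E H) vw))

-- Stars with hanging leaves

module _ {n r : ℕ} (G : Graph n) (χ : Colouring r n) where

  Links-cong : ∀ {c D D′} → (∀ v → D v ≡ D′ v) → Rooted G χ c D → Rooted G χ c D′
  Links-cong e (x , x∈D , reach) = x , ≡.trans (≡.sym (e x)) x∈D , λ v v∈D′ →
    Star.map (λ { (p , q , j) → ≡.trans (≡.sym (e _)) p , ≡.trans (≡.sym (e _)) q , j }) (reach v (≡.trans (e v) v∈D′))

  -- Every vertex of W is joined to the centre x c in colour c for all c in S,
  -- so it may be put into the tree of any colour of S: s records the choice.
  -- A further vertex then hangs on w if it is joined to w in colour s w.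
  -- The set D is a class of its own, of a colour d outside S.
  module Hang (S : Fin r → Bool) (x : Fin r → Fin n) (W : Fin n → Bool) (s : Fin n → Fin r)
    (D : Fin n → Bool) (d c₀ : Fin r) (w₀ : Fin n)
    (c₀∈S : S c₀ ≡ true) (w₀∈W : W w₀ ≡ true)
    (star : ∀ c w → S c ≡ true → W w ≡ true → joined G χ c (x c) w ≡ true)
    (D-class : (∀ v → D v ≡ false) ⊎ (S d ≡ false × Rooted G χ d D))
    (D∩W : ∀ v → D v ≡ true → W v ≡ true → s v ≡ d)
    (D∩x : ∀ c → S c ≡ true → D (x c) ≡ false) where

    Centre Leaf : Fin n → Set
    Centre v = ∃ λ c → S c ≡ true × x c ≡ v
    Leaf v = ∃ λ w → W w ≡ true × S (s w) ≡ true × joined G χ (s w) v w ≡ true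

    centre? : ∀ v → Dec (Centre v)
    centre? v = any? λ c → (S c ≟ᵇ true) ×-dec (x c ≟ v)

    leaf? : ∀ v → Dec (Leaf v)
    leaf? v = any? λ w → (W w ≟ᵇ true) ×-dec ((S (s w) ≟ᵇ true) ×-dec (joined G χ (s w) v w ≟ᵇ true))

    ℓ : Fin n → Maybe (Fin r)
    ℓ v with D v | centre? v | W v | leaf? v
    ... | true  | _           | _     | _           = just d
    ... | false | yes (c , _) | _     | _           = just c
    -- A vertex of W whose chosen colour is not in S can go to any flexible colour, since it is
    -- joined to every centre; `c₀` is that default.
    ... | false | no _        | true  | _           = just (if S (s v) then s v else c₀)
    ... | false | no _        | false | yes (w , _) = just (s w)
    ... | false | no _        | false | no _        = nothing

    data Reason (v : Fin n) (c : Fin r) : Set where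
      inD      : D v ≡ true → d ≡ c → Reason v c
      isCentre : S c ≡ true → x c ≡ v → Reason v c
      inW      : W v ≡ true → S c ≡ true → Reason v c
      isLeaf   : ∀ w → W w ≡ true → s w ≡ c → S c ≡ true → joined G χ c v w ≡ true → Reason v c

    private
      default∈S : ∀ c → S (if S c then c else c₀) ≡ true
      default∈S c with S c in e
      ... | true  = e
      ... | false = c₀∈S

    reason : ∀ v {c} → ℓ v ≡ just c → Reason v c
    reason v e with D v in D≡ | centre? v | W v in W≡ | leaf? v
    reason v e | true  | _                   | _     | _ = inD D≡ (just-injective e)
    reason v ≡.refl | false | yes (c , c∈S , xc≡v) | _ | _ = isCentre c∈S xc≡v
    reason v ≡.refl | false | no _ | true  | _ = inW W≡ (default∈S (s v))
    reason v ≡.refl | false | no _ | false | yes (w , w∈W , sw∈S , j) = isLeaf w w∈W ≡.refl sw∈S j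

    centre∉W : ∀ c → S c ≡ true → W (x c) ≢ true
    centre∉W c c∈S xc∈W = joined⇒≢ G χ {c} (star c (x c) c∈S xc∈W) ≡.refl

    ℓ-D : ∀ v → D v ≡ true → ℓ v ≡ just d
    ℓ-D v e with D v
    ℓ-D v e | true = ≡.refl

    -- No vertex is the centre of two colours: its one edge to `w₀` would have both of them.
    ℓ-centre : ∀ c → S c ≡ true → ℓ (x c) ≡ just c
    ℓ-centre c c∈S with D (x c) in D≡ | centre? (x c)
    ... | true  | _ = true≢false D≡ (D∩x c c∈S)
    ℓ-centre c c∈S | false | no ¬centre = contradiction (c , c∈S , ≡.refl) ¬centre
    ℓ-centre c c∈S | false | yes (c′ , c′∈S , xc′≡xc) = cong just (joined-unique G χ
      (≡.subst (λ y → joined G χ c′ y w₀ ≡ true) xc′≡xc (star c′ w₀ c′∈S w₀∈W)) (star c w₀ c∈S w₀∈W))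

    -- A leaf may hang on w only if w itself sits in the star of colour `s w`. The clauses with
    -- higher priority do not interfere: W contains no centre, as there are no loops, and D meets W
    -- only where the choice is d.
    ℓ-W : ∀ w → W w ≡ true → S (s w) ≡ true → ℓ w ≡ just (s w)
    ℓ-W w w∈W sw∈S with D w in D≡ | centre? w | W w in W≡
    ... | true | _ | _ = cong just (≡.sym (D∩W w D≡ (≡.trans W≡ w∈W)))
    ... | false | yes (c , c∈S , xc≡w) | _ = contradiction (≡.trans (cong W xc≡w) (≡.trans W≡ w∈W)) (centre∉W c c∈S)
    ... | false | no _ | true = cong (λ b → just (if b then s w else c₀)) sw∈S

    labelled : ∀ v → D v ≡ true ⊎ Centre v ⊎ W v ≡ true ⊎ Leaf v → ∃ λ c → ℓ v ≡ just c
    labelled v p with D v | centre? v | W v | leaf? v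
    ... | true  | _           | _     | _           = d , ≡.refl
    ... | false | yes (c , _) | _     | _           = c , ≡.refl
    ... | false | no _        | true  | _           = _ , ≡.refl
    ... | false | no _        | false | yes (w , _) = s w , ≡.refl
    labelled v (inj₂ (inj₁ q))        | false | no ¬q | false | no _  = contradiction q ¬q
    labelled v (inj₂ (inj₂ (inj₂ q))) | false | no _  | false | no ¬q = contradiction q ¬q

    outsideS : ∀ {v c} → S c ≡ false → Reason v c → d ≡ c × D v ≡ true
    outsideS c∉S (inD v∈D d≡c)      = d≡c , v∈D
    outsideS c∉S (isCentre c∈S _)   = true≢false c∈S c∉S
    outsideS c∉S (inW _ c∈S)        = true≢false c∈S c∉S
    outsideS c∉S (isLeaf _ _ _ c∈S _) = true≢false c∈S c∉S

    class-S : ∀ c → S c ≡ true → Rooted G χ c (λ v → hasLabel c (ℓ v))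
    class-S c c∈S = x c , hasLabel⁺ c (ℓ-centre c c∈S) , λ v e → reach v (hasLabel⁻ c (ℓ v) e)
      where
        L = Link G χ c (λ v → hasLabel c (ℓ v))
        spoke : ∀ w → W w ≡ true → ℓ w ≡ just c → L (x c) w
        spoke w w∈W e = hasLabel⁺ c (ℓ-centre c c∈S) , hasLabel⁺ c e , star c w c∈S w∈W
        reach : ∀ v → ℓ v ≡ just c → Star L (x c) v
        reach v e with reason v e
        ... | isCentre _ ≡.refl = ε
        ... | inW v∈W _ = spoke v v∈W e ◅ ε
        ... | isLeaf w w∈W ≡.refl _ j = spoke w w∈W (ℓ-W w w∈W c∈S) ◅
          Link-sym G χ {c} {λ v → hasLabel c (ℓ v)} (hasLabel⁺ c e , hasLabel⁺ c (ℓ-W w w∈W c∈S) , j) ◅ ε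
        ... | inD v∈D ≡.refl = go D-class
          where
            go : (∀ v → D v ≡ false) ⊎ (S d ≡ false × Rooted G χ d D) → Star L (x c) v
            go (inj₁ D-empty)   = true≢false v∈D (D-empty v)
            go (inj₂ (d∉S , _)) = true≢false c∈S d∉S

    class-D : S d ≡ false → ∀ v → D v ≡ hasLabel d (ℓ v)
    class-D d∉S v = ≡-from-⇔ (λ e → hasLabel⁺ d (ℓ-D v e))
      (λ e → proj₂ (outsideS d∉S (reason v (hasLabel⁻ d (ℓ v) e))))

    classes : ∀ c → (∀ v → ℓ v ≢ just c) ⊎ Rooted G χ c (λ v → hasLabel c (ℓ v))
    classes c = go (S c ≟ᵇ true) D-class
      where
        go : Dec (S c ≡ true) → (∀ v → D v ≡ false) ⊎ (S d ≡ false × Rooted G χ d D) →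
          (∀ v → ℓ v ≢ just c) ⊎ Rooted G χ c (λ v → hasLabel c (ℓ v))
        go (yes c∈S) _ = inj₂ (class-S c c∈S)
        go (no c∉S) (inj₁ D-empty) = inj₁ λ v e → true≢false (proj₂ (outsideS (¬-not c∉S) (reason v e))) (D-empty v)
        go (no c∉S) (inj₂ (d∉S , rooted)) with d ≟ c
        ... | yes ≡.refl = inj₂ (Links-cong (class-D d∉S) rooted)
        ... | no d≢c     = inj₁ λ v e → d≢c (proj₁ (outsideS (¬-not c∉S) (reason v e)))

-- Covers by components

dec-true⁻ : ∀ {P : Set} (P? : Dec P) → does P? ≡ true → P
dec-true⁻ (yes p) _ = p

covered-tabulate : ∀ {n k} {G : Graph n} (h : Fin k → Subgraph G) q {v} → v ∈ V (h q) → v ∈ covered (List.tabulate h)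
covered-tabulate h zero    p = x∈p∪q⁺ (inj₁ p)
covered-tabulate h (suc q) p = x∈p∪q⁺ (inj₂ (covered-tabulate (λ i → h (suc i)) q p))

module _ {n r : ℕ} (G : Graph n) (χ : Colouring r n) where

  Reach : Fin r → Fin n → Fin n → Set
  Reach c = Star λ u w → joined G χ c u w ≡ true

  Reach-sym : ∀ {c u w} → Reach c u w → Reach c w u
  Reach-sym {c} = Star.reverse λ {u} {w} e → ≡.trans (joined-sym G χ c w u) e

  Related : Fin n → Fin n → Set
  Related u w = ∃ λ c → Reach c u w

  common-neighbour : ∀ {k d} → CommonNeighbours k d G → (f : Fin k → Fin n) → ∃ λ w → ∀ i → adj G (f i) w ≡ true
  common-neighbour common f = let (w , e) = #>0⇒∃ _ (ℕ.≤-<-trans ℕ.z≤n (common f _ λ w h → dec-true (adjacent? w) h))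
                              in w , dec-true⁻ (adjacent? w) e
    where
      adjacent? : ∀ w → Dec (∀ i → adj G (f i) w ≡ true)
      adjacent? w = all? λ i → adj G (f i) w ≟ᵇ true

  -- Of the r + 1 edges at a common neighbour two have the same colour.
  related-pair : ∀ {d} → CommonNeighbours (suc r) d G → (f : Fin (suc r) → Fin n) →
    ∃ λ i → ∃ λ j → i ≢ j × Related (f i) (f j)
  related-pair common f =
    let (i , j , i<j , e) = pigeonhole ℕ.≤-refl (λ i → proj₁ (colour i))
    in i , j , <⇒≢ i<j , proj₁ (colour i) , proj₁ (proj₂ (colour i)) ◅
      ≡.trans (joined-sym G χ _ w (f j)) (≡.subst (λ c → joined G χ c (f j) w ≡ true) (≡.sym e) (proj₁ (proj₂ (colour j)))) ◅ ε
    where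
      w = proj₁ (common-neighbour common f)
      colour : ∀ i → ∃ λ c → joined G χ c (f i) w ≡ true × at χ (f i) w ≡ just c
      colour i = joined⁺ G χ (proj₂ (common-neighbour common f) i)

  -- Stated for a general J so as to cover both the components of a colour in the whole graph and
  -- those inside a given vertex set.
  closure-rooted : ∀ {c} {J : Fin n → Fin n → Set} → (∀ {u w} → J u w → joined G χ c u w ≡ true) →
    (reach? : ∀ u w → Dec (Star J u w)) → ∀ u → Rooted G χ c (λ w → does (reach? u w))
  closure-rooted {c} {J} J⇒ reach? u = u , inside ε , λ v e → go ε (dec-true⁻ (reach? u v) e)
    where
      inside : ∀ {v} → Star J u v → does (reach? u v) ≡ true
      inside {v} = dec-true (reach? u v)
      go : ∀ {w v} → Star J u w → Star J w v → Star (Link G χ c (λ w → does (reach? u w))) w v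
      go p ε       = ε
      go p (e ◅ q) = (inside p , inside (p ◅◅ e ◅ ε) , J⇒ e) ◅ go (p ◅◅ e ◅ ε) q

  module _ (reach? : ∀ c u w → Dec (Reach c u w)) where

    component : Fin r → Fin n → Fin n → Bool
    component c u w = does (reach? c u w)

    component-rooted : ∀ c u → Rooted G χ c (component c u)
    component-rooted c u = closure-rooted (λ e → e) (reach? c) u

    related? : ∀ u w → Dec (Related u w)
    related? u w = any? λ c → reach? c u w

    Independent : ∀ {k} → (Fin k → Fin n) → Set
    Independent f = ∀ i j → i ≢ j → ¬ Related (f i) (f j)

    Dominating : ∀ {k} → (Fin k → Fin n) → Set
    Dominating f = ∀ v → ∃ λ i → Related (f i) v

    extend : ∀ {k} (f : Fin k → Fin n) → Independent f → ∀ v → (∀ i → ¬ Related (f i) v) → Independent (v Vector.∷ f)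
    extend f ind v new zero    zero    p = contradiction ≡.refl p
    extend f ind v new zero    (suc j) p = λ { (c , q) → new j (c , Reach-sym q) }
    extend f ind v new (suc i) zero    p = new i
    extend f ind v new (suc i) (suc j) p = ind i j (λ e → p (cong suc e))

    dominatingSet : ∀ {d} → CommonNeighbours (suc r) d G → ∃ λ k → k ℕ.≤ r × Σ (Fin k → Fin n) Dominating
    dominatingSet common = go r 0 (ℕ.+-identityʳ r) (λ ()) (λ ())
      where
        go : ∀ fuel k → fuel ℕ.+ k ≡ r → (f : Fin k → Fin n) → Independent f →
          ∃ λ k → k ℕ.≤ r × Σ (Fin k → Fin n) Dominating
        step : ∀ fuel k → fuel ℕ.+ k ≡ r → (f : Fin k → Fin n) → Independent f → Dec (Dominating f) →
          ∃ λ k → k ℕ.≤ r × Σ (Fin k → Fin n) Dominating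
        go fuel k q f ind = step fuel k q f ind (all? λ v → any? λ i → related? (f i) v)
        step fuel k q f ind (yes dom) = k , ℕ.≤-trans (ℕ.m≤n+m k fuel) (ℕ.≤-reflexive q) , f , dom
        -- Here k = r, and one more independent vertex contradicts `related-pair`.
        step zero k ≡.refl f ind (no ¬dom) =
          let (v , new) = ¬∀⟶∃¬ n _ (λ v → any? λ i → related? (f i) v) ¬dom
              (i , j , i≢j , rel) = related-pair common (v Vector.∷ f)
          in contradiction rel (extend f ind v (λ i q → new (i , q)) i j i≢j)
        step (suc fuel) k q f ind (no ¬dom) =
          let (v , new) = ¬∀⟶∃¬ n _ (λ v → any? λ i → related? (f i) v) ¬dom
          in go fuel (suc k) (≡.trans (ℕ.+-suc fuel k) q) (v Vector.∷ f) (extend f ind v λ i q → new (i , q))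

    coverable : ∀ {d} → CommonNeighbours (suc r) d G → Σ (List (Subgraph G)) λ Hs →
      length Hs ℕ.≤ r ℕ.^ 2 × All (λ H → Connected H × Monochromatic χ H) Hs × Covering Hs
    coverable common = List.tabulate h ,
      ℕ.≤-trans (ℕ.≤-reflexive (length-tabulate h)) (ℕ.≤-trans (ℕ.*-monoˡ-≤ r k≤r) (ℕ.≤-reflexive (cong (r ℕ.*_) (≡.sym (ℕ.*-identityʳ r))))) ,
      tabulate⁺ (λ q → proj₁ (proj₂ (piece′ (remQuot r q)))) ,
      covering (List.tabulate h) (λ v → inCover v (dom v))
      where
        k = proj₁ (dominatingSet common)
        k≤r = proj₁ (proj₂ (dominatingSet common))
        f = proj₁ (proj₂ (proj₂ (dominatingSet common)))
        dom = proj₂ (proj₂ (proj₂ (dominatingSet common)))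
        piece′ : (q : Fin k × Fin r) → _
        piece′ (i , c) = piece G χ c (component c (f i)) (component-rooted c (f i))
        h : Fin (k ℕ.* r) → Subgraph G
        h q = proj₁ (piece′ (remQuot r q))
        inCover : ∀ v → (∃ λ i → Related (f i) v) → v ∈ covered (List.tabulate h)
        inCover v (i , c , p) = covered-tabulate h (combine i c) (≡.subst (λ q → v ∈ V (proj₁ (piece′ q))) (≡.sym (remQuot-combine i c))
          (∈-tabulate⁺ (component c (f i)) (dec-true (reach? c (f i) v) p)))

  reach-decidable : ¬ ¬ (∀ c u w → Dec (Reach c u w))
  reach-decidable = Fin-shift r _ λ c → decidable₂ (Reach c)

tc-bound : ∀ {n r d} (G : Graph n) → CommonNeighbours (suc r) d G → ¬ ¬ (tc[ r ] G ≤ (r ℕ.^ 2))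
tc-bound {n} {r} G common k = Pairs-shift (Fin-shift r) n _
  (λ χ none → reach-decidable G χ λ reach? → none (coverable G χ reach? common)) λ c → minimum c k

-- Two colours

module _ {n r : ℕ} (G : Graph n) (χ : Colouring r n) where

  select : (Fin r → Bool) → Bool → Maybe (Fin r) → Maybe (Fin r)
  select S true (just c) = if S c then just c else nothing
  select S _    _        = nothing

  -- The literal of v at w for `assignment`: the colour which the star of w must get in order that v
  -- can hang on w, if there is one in S.
  clause : (Fin r → Bool) → (Fin n → Bool) → Fin n → Fin n → Maybe (Fin r)
  clause S W v w = select S (W w ∧ adj G v w) (at χ v w)

  clause⁻ : ∀ S W v w {c} → clause S W v w ≡ just c → W w ≡ true × S c ≡ true × joined G χ c v w ≡ true
  clause⁻ S W v w e with W w | adj G v w | at χ v w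
  ... | true | true | just d with S d in S≡
  clause⁻ S W v w ≡.refl | true | true | just d | true = ≡.refl , S≡ , dec-true (d ≟ d) ≡.refl

  clause⁺ : ∀ S W v w {c} → W w ≡ true → S c ≡ true → joined G χ c v w ≡ true → is-just (clause S W v w) ≡ true
  clause⁺ S W v w {c} p q j = selected p (∧-trueˡ j) (hasLabel⁻ c (at χ v w) (∧-trueʳ {adj G v w} j))
    where
      selected : ∀ {a b m} → a ≡ true → b ≡ true → m ≡ just c → is-just (select S (a ∧ b) m) ≡ true
      selected ≡.refl ≡.refl ≡.refl rewrite q = ≡.refl

noTriple : ∀ {n d} (G : Graph n) (χ : Colouring 2 n) → CommonNeighbours 3 d G → ∀ x y z →
  Related G χ x y ⊎ Related G χ x z ⊎ Related G χ y z
noTriple {n} G χ common x y z = go (related-pair G χ common f)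
  where
    f : Fin 3 → Fin n
    f zero             = x
    f (suc zero)       = y
    f (suc (suc zero)) = z
    sym : ∀ {u w} → Related G χ u w → Related G χ w u
    sym (c , q) = c , Reach-sym G χ q
    go : (∃ λ i → ∃ λ j → i ≢ j × Related G χ (f i) (f j)) → Related G χ x y ⊎ Related G χ x z ⊎ Related G χ y z
    go (zero , zero , p , _) = contradiction ≡.refl p
    go (zero , suc zero , _ , q) = inj₁ q
    go (zero , suc (suc zero) , _ , q) = inj₂ (inj₁ q)
    go (suc zero , zero , _ , q) = inj₁ (sym q)
    go (suc zero , suc zero , p , _) = contradiction ≡.refl p
    go (suc zero , suc (suc zero) , _ , q) = inj₂ (inj₂ q)
    go (suc (suc zero) , zero , _ , q) = inj₂ (inj₁ (sym q))
    go (suc (suc zero) , suc zero , _ , q) = inj₂ (inj₂ (sym q))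
    go (suc (suc zero) , suc (suc zero) , p , _) = contradiction ≡.refl p

-- König's theorem for red and blue classes

red blue : Fin 2
red  = zero
blue = suc zero

-- Think of a vertex as an edge between its R-class and its B-class in a
-- bipartite graph.  There is no matching of size three, so two classes cover
-- everything (König).
module Konig {A : Set} (R B : A → A → Set)
  (R-sym : ∀ {u w} → R u w → R w u) (B-sym : ∀ {u w} → B u w → B w u)
  (R-trans : ∀ {u v w} → R u v → R v w → R u w) (B-trans : ∀ {u v w} → B u v → B v w → B u w)
  (triple : ∀ x y z → (R x y ⊎ B x y) ⊎ (R x z ⊎ B x z) ⊎ (R y z ⊎ B y z)) where

  noMatching : ∀ {x y z} → ¬ R x y → ¬ B x y → ¬ R x z → ¬ B x z → ¬ R y z → ¬ ¬ B y z
  noMatching {x} {y} {z} a b c d e f with triple x y z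
  ... | inj₁ (inj₁ p) = a p
  ... | inj₁ (inj₂ p) = b p
  ... | inj₂ (inj₁ (inj₁ p)) = c p
  ... | inj₂ (inj₁ (inj₂ p)) = d p
  ... | inj₂ (inj₂ (inj₁ p)) = e p
  ... | inj₂ (inj₂ (inj₂ p)) = f p

  private
    -- An augmenting path through x and y with `v₄` in the middle. If neither x, y, v₄ nor v₁, v₂,
    -- v₄ is a matching, then one of the triples x, v₂, v₄ and y, v₁, v₄ is.
    crossed : ∀ {x y v₁ v₂ v₄} → ¬ R x y → ¬ B x y → ¬ R x v₁ → ¬ R y v₁ → ¬ B x v₂ → ¬ B y v₂ →
      ¬ B x v₄ → ¬ R y v₄ → B x v₁ → ¬ R y v₂
    crossed {x} {y} {v₁} {v₂} {v₄} xRy xBy xRv₁ yRv₁ xBv₂ yBv₂ xBv₄ yRv₄ xv₁ yv₂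
      with triple x y v₄ | triple v₁ v₂ v₄
    ... | inj₁ (inj₁ p) | _ = xRy p
    ... | inj₁ (inj₂ p) | _ = xBy p
    ... | inj₂ (inj₁ (inj₂ p)) | _ = xBv₄ p
    ... | inj₂ (inj₂ (inj₁ p)) | _ = yRv₄ p
    ... | inj₂ _ | inj₁ (inj₁ q) = yRv₁ (R-trans yv₂ (R-sym q))
    ... | inj₂ _ | inj₁ (inj₂ q) = xBv₂ (B-trans xv₁ q)
    ... | inj₂ _ | inj₂ (inj₁ (inj₂ q)) = xBv₄ (B-trans xv₁ q)
    ... | inj₂ _ | inj₂ (inj₂ (inj₁ q)) = yRv₄ (R-trans yv₂ q)
    ... | inj₂ (inj₁ (inj₁ p)) | inj₂ (inj₁ (inj₁ q)) = xRv₁ (R-trans p (R-sym q))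
    ... | inj₂ (inj₂ (inj₂ p)) | inj₂ (inj₂ (inj₂ q)) = yBv₂ (B-trans p (B-sym q))
    ... | inj₂ (inj₂ (inj₂ p)) | inj₂ (inj₁ (inj₁ q)) = noMatching {x} {v₂} {v₄}
      (λ s → xRy (R-trans s (R-sym yv₂))) xBv₂ (λ s → xRv₁ (R-trans s (R-sym q))) xBv₄
      (λ s → yRv₄ (R-trans yv₂ s)) (λ s → yBv₂ (B-trans p (B-sym s)))
    ... | inj₂ (inj₁ (inj₁ p)) | inj₂ (inj₂ (inj₂ q)) = noMatching {y} {v₁} {v₄}
      yRv₁ (λ s → xBy (B-trans xv₁ (B-sym s))) yRv₄ (λ s → yBv₂ (B-trans s (B-sym q)))
      (λ s → xRv₁ (R-trans p (R-sym s))) (λ s → xBv₄ (B-trans xv₁ s))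

    -- The short augmenting path: `v₁` and `v₂` hang on the two ends of x, so replacing x by both of
    -- them, next to y, gives a matching of size three.
    parallel : ∀ {x y v₁ v₂} → ¬ R x y → ¬ B x y → ¬ R y v₁ → ¬ R x v₁ → ¬ B x v₂ → ¬ B y v₂ → B x v₁ → ¬ R x v₂
    parallel {x} {y} {v₁} {v₂} xRy xBy yRv₁ xRv₁ xBv₂ yBv₂ xv₁ xv₂ = noMatching {y} {v₁} {v₂}
      yRv₁ (λ s → xBy (B-trans xv₁ (B-sym s))) (λ s → xRy (R-trans xv₂ (R-sym s))) yBv₂
      (λ s → xRv₁ (R-trans xv₂ (R-sym s))) (λ s → xBv₂ (B-trans xv₁ s))

  -- A cover by two classes must contain one end of x and one end of y, which leaves four
  -- candidates; v₁, ..., v₄ witness that each of them fails. Since v₁ meets the matching in blue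
  -- only and v₂ in red only, they hang on the same edge (`parallel`) or on different ones
  -- (`crossed`).
  uncovered : ∀ {x y v₁ v₂ v₃ v₄} → ¬ R x y → ¬ B x y → ¬ R x v₁ → ¬ R y v₁ → ¬ B x v₂ → ¬ B y v₂ →
    ¬ R x v₃ → ¬ B y v₃ → ¬ B x v₄ → ¬ ¬ R y v₄
  uncovered {x} {y} {v₁} {v₂} {v₃} {v₄} xRy xBy xRv₁ yRv₁ xBv₂ yBv₂ xRv₃ yBv₃ xBv₄ yRv₄
    with triple x y v₁ | triple x y v₂
  ... | inj₁ (inj₁ p) | _ = xRy p
  ... | inj₁ (inj₂ p) | _ = xBy p
  ... | inj₂ _ | inj₁ (inj₁ p) = xRy p
  ... | inj₂ _ | inj₁ (inj₂ p) = xBy p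
  ... | inj₂ (inj₁ (inj₁ p)) | _ = xRv₁ p
  ... | inj₂ (inj₂ (inj₁ p)) | _ = yRv₁ p
  ... | inj₂ _ | inj₂ (inj₁ (inj₂ q)) = xBv₂ q
  ... | inj₂ _ | inj₂ (inj₂ (inj₂ q)) = yBv₂ q
  ... | inj₂ (inj₁ (inj₂ p)) | inj₂ (inj₁ (inj₁ q)) = parallel xRy xBy yRv₁ xRv₁ xBv₂ yBv₂ p q
  ... | inj₂ (inj₂ (inj₂ p)) | inj₂ (inj₂ (inj₁ q)) =
    parallel (λ s → xRy (R-sym s)) (λ s → xBy (B-sym s)) xRv₁ yRv₁ yBv₂ xBv₂ p q
  ... | inj₂ (inj₁ (inj₂ p)) | inj₂ (inj₂ (inj₁ q)) = crossed xRy xBy xRv₁ yRv₁ xBv₂ yBv₂ xBv₄ yRv₄ p q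
  ... | inj₂ (inj₂ (inj₂ p)) | inj₂ (inj₁ (inj₁ q)) =
    crossed (λ s → xRy (R-sym s)) (λ s → xBy (B-sym s)) yRv₁ xRv₁ yBv₂ xBv₂ yBv₃ xRv₃ p q

other : ∀ {a b c : Fin 2} → a ≢ b → c ≢ a → c ≡ b
other {zero}     {zero}     {_}        p q = contradiction ≡.refl p
other {zero}     {suc zero} {zero}     p q = contradiction ≡.refl q
other {zero}     {suc zero} {suc zero} p q = ≡.refl
other {suc zero} {zero}     {zero}     p q = ≡.refl
other {suc zero} {zero}     {suc zero} p q = contradiction ≡.refl q
other {suc zero} {suc zero} {_}        p q = contradiction ≡.refl p

-- Partitions into two monochromatic pieces

Partition : ∀ {n r} (G : Graph n) → Colouring r n → ℕ → Set
Partition {n} G χ s = Σ (List (Subgraph G)) λ Hs → length Hs ℕ.≤ s ×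
  All (λ H → Connected H × Monochromatic χ H) Hs × Covering Hs × VertexDisjoint Hs

partitionFromLabels : ∀ {n r s} (G : Graph n) (χ : Colouring r n) (ℓ : Fin n → Maybe (Fin s)) →
  (∀ i → (∀ v → ℓ v ≢ just i) ⊎ ∃ λ c → Rooted G χ c (λ v → hasLabel i (ℓ v))) →
  (∀ v → ∃ λ i → ℓ v ≡ just i) → Partition G χ s
partitionFromLabels G χ ℓ classes total =
  let (Hs , len , good , disjoint , cover) = assemble G χ (λ H → Connected H × Monochromatic χ H) ℓ (λ i → toPiece i (classes i))
  in Hs , len , good , covering Hs (λ v → cover v (proj₁ (total v)) (proj₂ (total v))) , disjoint
  where
    toPiece : ∀ i → (∀ v → ℓ v ≢ just i) ⊎ (∃ λ c → Rooted G χ c (λ v → hasLabel i (ℓ v))) → _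
    toPiece i (inj₁ empty)      = inj₁ empty
    toPiece i (inj₂ (c , root)) = inj₂ (piece G χ c _ root)

module TwoTrees (ℝ : RealNumbers) {n : ℕ} (G : Graph n) (χ : Colouring 2 n) (l : ℕ) (n<2^ : n ℕ.< 2 ℕ.^ suc l)
  (common : CommonNeighbours 3 ((2 ℕ.+ l) ℕ.+ (2 ℕ.+ l)) G)
  (reach? : ∀ c u w → Dec (Reach G χ c u w)) where
  open Assignments ℝ

  private
    R : Fin 2 → Fin n → Fin n → Set
    R = Reach G χ

    single : ∀ a u → (∀ v → R a u v) → Partition G χ 2
    single a u all = partitionFromLabels G χ (λ _ → just red) classes (λ v → red , ≡.refl)
      where
        classes : ∀ i → (∀ v → just red ≢ just i) ⊎ ∃ λ c → Rooted G χ c (λ v → hasLabel i (just red))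
        classes zero = inj₂ (a , Links-cong G χ (λ v → dec-true (reach? a u v) (all v)) (component-rooted G χ reach? a u))
        classes (suc zero) = inj₁ λ v ()

    sameColour : ∀ a x y → ¬ R a x y → (∀ v → R a x v ⊎ R a y v) → Partition G χ 2
    sameColour a x y xy cover = partitionFromLabels G χ ℓ classes (λ v → _ , ≡.refl)
      where
        label : Bool → Fin 2
        label b = if b then red else blue
        ℓ : Fin n → Maybe (Fin 2)
        ℓ v = just (label (component G χ reach? a x v))
        isRed : ∀ b → b ≡ hasLabel red (just (label b))
        isRed true  = ≡.refl
        isRed false = ≡.refl
        isBlue : ∀ b c → (b ≡ true → c ≡ false) → (b ≡ false → c ≡ true) → c ≡ hasLabel blue (just (label b))
        isBlue true  c p q = p ≡.refl
        isBlue false c p q = q ≡.refl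
        classes : ∀ i → (∀ v → ℓ v ≢ just i) ⊎ ∃ λ c → Rooted G χ c (λ v → hasLabel i (ℓ v))
        classes zero = inj₂ (a , Links-cong G χ (λ v → isRed _) (component-rooted G χ reach? a x))
        classes (suc zero) = inj₂ (a , Links-cong G χ (λ v → isBlue (component G χ reach? a x v) _ (fromX v) (fromY v)) (component-rooted G χ reach? a y))
          where
            fromX : ∀ v → component G χ reach? a x v ≡ true → component G χ reach? a y v ≡ false
            fromX v p = dec-false (reach? a y v) λ q → xy (dec-true⁻ (reach? a x v) p ◅◅ Reach-sym G χ q)
            fromY : ∀ v → component G χ reach? a x v ≡ false → component G χ reach? a y v ≡ true
            fromY v p with cover v
            ... | inj₁ q = true≢false (dec-true (reach? a x v) q) p
            ... | inj₂ q = dec-true (reach? a y v) q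

    -- The common neighbours of x and y are all joined to x in colour a and to
    -- y in colour b, so each of them may join either tree.
    mixed : ∀ a b → a ≢ b → ∀ x y → (∀ c → ¬ R c x y) → (∀ v → R a x v ⊎ R b y v) → ¬ ¬ Partition G χ 2
    mixed a b a≢b x y xy cover none = assignment 1 l (clause G χ S W) W a 0 n<2^ 4≤W λ (s , hit , _) →
      none (build s λ v → hit v (many v))
      where
        S : Fin 2 → Bool
        S _ = true
        W : Fin n → Bool
        W w = adj G x w ∧ adj G y w
        centre : Fin 2 → Fin n
        centre c = if does (c ≟ a) then x else y
        toClass : ∀ {c ℓ} → (∀ v → ℓ v ≢ just c) ⊎ Rooted G χ c (λ v → hasLabel c (ℓ v)) →
          (∀ v → ℓ v ≢ just c) ⊎ ∃ λ d → Rooted G χ d (λ v → hasLabel c (ℓ v))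
        toClass (inj₁ e) = inj₁ e
        toClass {c} (inj₂ p) = inj₂ (c , p)
        -- The edges from w to x and to y have different colours, because x and y are unrelated. The
        -- opposite order of colours is impossible as well: w lies in one of the two covering
        -- components, which would then relate x to y.
        colours : ∀ w → W w ≡ true → joined G χ a x w ≡ true × joined G χ b y w ≡ true
        colours w w∈W with joined⁺ G χ (∧-trueˡ {adj G x w} w∈W) | joined⁺ G χ (∧-trueʳ {adj G x w} w∈W)
        ... | c , p , _ | d , q , _ with c ≟ d
        ... | yes ≡.refl = contradiction (p ◅ ≡.trans (joined-sym G χ c w y) q ◅ ε) (xy c)
        ... | no c≢d with c ≟ a
        ...   | yes ≡.refl rewrite ≡.sym (other {c} {b} {d} a≢b (λ e → c≢d (≡.sym e))) = p , q
        ...   | no c≢a with other a≢b c≢a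
        ...     | ≡.refl with other {b} {a} {d} (λ e → a≢b (≡.sym e)) (λ e → c≢d (≡.sym e))
        ...       | ≡.refl with cover w
        ...         | inj₁ r = contradiction (r ◅◅ ≡.trans (joined-sym G χ d w y) q ◅ ε) (xy d)
        ...         | inj₂ r = contradiction (p ◅ Reach-sym G χ r) (xy b)
        star : ∀ c w → S c ≡ true → W w ≡ true → joined G χ c (centre c) w ≡ true
        star c w _ w∈W with c ≟ a
        ... | yes ≡.refl = proj₁ (colours w w∈W)
        ... | no c≢a with other a≢b c≢a
        ...   | ≡.refl = proj₂ (colours w w∈W)
        triple : Fin n → Fin 3 → Fin n
        triple v zero             = v
        triple v (suc zero)       = x
        triple v (suc (suc zero)) = y
        inW : ∀ v w → (∀ i → adj G (triple v i) w ≡ true) → W w ≡ true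
        inW v w h = ∧-true (h (suc zero)) (h (suc (suc zero)))
        few : 2 ℕ.* (2 ℕ.+ l) ℕ.≤ (2 ℕ.+ l) ℕ.+ (2 ℕ.+ l)
        few = ℕ.≤-reflexive (cong ((2 ℕ.+ l) ℕ.+_) (ℕ.+-identityʳ (2 ℕ.+ l)))
        many : ∀ v → 2 ℕ.* (2 ℕ.+ l) ℕ.≤ # (λ w → is-just (clause G χ S W v w))
        many v = ℕ.≤-trans few (ℕ.<⇒≤ (common (triple v) _ λ w h →
          clause⁺ G χ S W v w {proj₁ (joined⁺ G χ (h zero))} (inW v w h) ≡.refl (proj₁ (proj₂ (joined⁺ G χ (h zero))))))
        -- A reserve of size 0 asks for 2 * 2 * 1 vertices in W. They are found with the triple x,
        -- x, y, as repetitions are allowed.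
        4≤W : 4 ℕ.≤ # W
        4≤W = ℕ.≤-trans (ℕ.*-monoʳ-≤ 2 (ℕ.m≤m+n 2 l)) (ℕ.≤-trans few (ℕ.<⇒≤ (common (triple x) W (inW x))))

        build : (s : Fin n → Fin 2) → (∀ v → ∃ λ w → clause G χ S W v w ≡ just (s w)) → Partition G χ 2
        build s hit = partitionFromLabels G χ H.ℓ (λ c → toClass {c} {H.ℓ} (H.classes c)) λ v → H.labelled v (inj₂ (inj₂ (inj₂ (leaf v))))
          where
            w₀ = proj₁ (hit x)
            module H = Hang G χ S centre W s (λ _ → false) a a w₀ ≡.refl (proj₁ (clause⁻ G χ S W x w₀ (proj₂ (hit x))))
              star (inj₁ λ _ → ≡.refl) (λ _ ()) (λ _ _ → ≡.refl)
            leaf : ∀ v → H.Leaf v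
            leaf v = let (w∈W , _ , j) = clause⁻ G χ S W v (proj₁ (hit v)) (proj₂ (hit v))
                     in proj₁ (hit v) , w∈W , ≡.refl , j

    cover? : ∀ a b x y → Dec (∀ v → R a x v ⊎ R b y v)
    cover? a b x y = all? λ v → reach? a x v ⊎-dec reach? b y v

    counterexample : ∀ a b x y → ¬ (∀ v → R a x v ⊎ R b y v) → ∃ λ v → ¬ R a x v × ¬ R b y v
    counterexample a b x y p =
      let (v , q) = ¬∀⟶∃¬ n _ (λ v → reach? a x v ⊎-dec reach? b y v) p
      in v , (λ r → q (inj₁ r)) , (λ r → q (inj₂ r))

    split : ∀ {u w} → Related G χ u w → R red u w ⊎ R blue u w
    split (zero , p)     = inj₁ p
    split (suc zero , p) = inj₂ p

    triples : ∀ x y z → (R red x y ⊎ R blue x y) ⊎ (R red x z ⊎ R blue x z) ⊎ (R red y z ⊎ R blue y z)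
    triples x y z = Sum.map split (Sum.map split split) (noTriple G χ common x y z)

    module K = Konig (R red) (R blue) (Reach-sym G χ) (Reach-sym G χ) _◅◅_ _◅◅_ triples

    unrelatedPair : ∀ x y → ¬ Related G χ x y → ¬ ¬ Partition G χ 2
    unrelatedPair x y xy = go (cover? red red x y) (cover? blue blue x y) (cover? red blue x y) (cover? blue red x y)
      where
        Cover : Fin 2 → Fin 2 → Set
        Cover a b = ∀ v → R a x v ⊎ R b y v
        go : Dec (Cover red red) → Dec (Cover blue blue) → Dec (Cover red blue) → Dec (Cover blue red) → ¬ ¬ Partition G χ 2
        go (yes p) _ _ _ = λ k → k (sameColour red x y (λ q → xy (red , q)) p)
        go (no _) (yes p) _ _ = λ k → k (sameColour blue x y (λ q → xy (blue , q)) p)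
        go (no _) (no _) (yes p) _ = mixed red blue (λ ()) x y (λ c q → xy (c , q)) p
        go (no _) (no _) (no _) (yes p) = mixed blue red (λ ()) x y (λ c q → xy (c , q)) p
        go (no a) (no b) (no c) (no d) =
          let (_ , p , q) = counterexample red red x y a
              (_ , s , t) = counterexample blue blue x y b
              (_ , u , v) = counterexample red blue x y c
              (_ , w , z) = counterexample blue red x y d
          in contradiction z (K.uncovered (λ e → xy (red , e)) (λ e → xy (blue , e)) p q s t u v w)

    -- A disconnected graph has a connected complement. If y is not red to x, then a vertex red to x
    -- is not red to y, hence blue to y, and y is blue to x.
    allRelated : (∀ x y → Related G χ x y) → ∀ x → Partition G χ 2
    allRelated rel x = go (all? λ v → reach? red x v)
      where
        go : Dec (∀ v → R red x v) → Partition G χ 2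
        go (yes p) = single red x p
        go (no ¬p) = let (y , xy) = ¬∀⟶∃¬ n _ (λ v → reach? red x v) ¬p
                     in single blue x λ v → blueTo xy v (split (rel x v)) (split (rel v y)) (split (rel x y))
          where
            blueTo : ∀ {y} → ¬ R red x y → ∀ v → R red x v ⊎ R blue x v → R red v y ⊎ R blue v y →
              R red x y ⊎ R blue x y → R blue x v
            blueTo xy v (inj₂ p) _        _        = p
            blueTo xy v (inj₁ p) (inj₁ q) _        = contradiction (p ◅◅ q) xy
            blueTo xy v (inj₁ p) (inj₂ q) (inj₁ s) = contradiction s xy
            blueTo xy v (inj₁ p) (inj₂ q) (inj₂ s) = s ◅◅ Reach-sym G χ q

  twoPieces : Fin n → ¬ ¬ Partition G χ 2
  twoPieces x₀ = go (all? λ x → all? λ y → related? G χ reach? x y)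
    where
      go : Dec (∀ x y → Related G χ x y) → ¬ ¬ Partition G χ 2
      go (yes rel) = λ k → k (allRelated rel x₀)
      go (no ¬rel) =
        let (x , ¬relx) = ¬∀⟶∃¬ n _ (λ x → all? λ y → related? G χ reach? x y) ¬rel
            (y , xy) = ¬∀⟶∃¬ n _ (λ y → related? G χ reach? x y) ¬relx
        in unrelatedPair x y xy

tp-bound : ∀ (ℝ : RealNumbers) {n} l (G : Graph n) → n ℕ.< 2 ℕ.^ suc l →
  CommonNeighbours 3 ((2 ℕ.+ l) ℕ.+ (2 ℕ.+ l)) G → ¬ ¬ (tp[ 2 ] G ≤ 2)
tp-bound ℝ {zero}  l [] _ _ k = minimum {λ s → PartitionableBy 2 [] s} {2} (λ χ → [] , ℕ.z≤n , [] , ≡.refl , []) k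
tp-bound ℝ {suc n} l G n<2^ common k = Pairs-shift (Fin-shift 2) (suc n) _
  (λ χ none → reach-decidable G χ λ reach? → TwoTrees.twoPieces ℝ G χ l n<2^ common reach? zero none) λ p → minimum p k

-- Forests covering almost everything

not-true⁻ : ∀ {b} → not b ≡ true → b ≡ false
not-true⁻ {false} _ = ≡.refl

not-true⁺ : ∀ {b} → b ≡ false → not b ≡ true
not-true⁺ ≡.refl = ≡.refl

does-false⁻ : ∀ {P : Set} (P? : Dec P) → does P? ≡ false → ¬ P
does-false⁻ (no ¬p) _ = ¬p

∨-true⁻ : ∀ {a b} → a ∨ b ≡ true → a ≡ true ⊎ b ≡ true
∨-true⁻ {true}  _ = inj₁ ≡.refl
∨-true⁻ {false} p = inj₂ p

ColouredForest : ∀ {n r} (G : Graph n) → Colouring r n → ℕ → Set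
ColouredForest {n} {r} G χ m = Σ (List (Subgraph G)) λ Ts → length Ts ℕ.≤ r ×
  All (λ T → Tree T × Monochromatic χ T) Ts × VertexDisjoint Ts × ∣ ∁ (covered Ts) ∣ ℕ.≤ m

forestFromLabels : ∀ {n r} (G : Graph n) (χ : Colouring r n) (ℓ : Fin n → Maybe (Fin r)) {m} →
  (∀ c → (∀ v → ℓ v ≢ just c) ⊎ Rooted G χ c (λ v → hasLabel c (ℓ v))) →
  # (λ v → not (is-just (ℓ v))) ℕ.≤ m → ¬ ¬ ColouredForest G χ m
forestFromLabels {n} {r} G χ ℓ {m} classes few none = Fin-shift r _ (λ c → toTree c (classes c)) λ trees →
  let (Ts , len , good , disjoint , cover) = assemble G χ (λ T → Tree T × Monochromatic χ T) ℓ trees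
  in none (Ts , len , good , disjoint , ℕ.≤-trans (ℕ.≤-reflexive (∣∣≡# (∁ (covered Ts))))
       (ℕ.≤-trans (#-mono {n} λ v → unlabelled Ts v (cover v)) few))
  where
    TreeOf : Fin r → Set
    TreeOf c = (∀ v → ℓ v ≢ just c) ⊎ Σ (Subgraph G) λ T → (Tree T × Monochromatic χ T) × V T ≡ class G χ (λ T → Tree T × Monochromatic χ T) ℓ c
    toTree : ∀ c → (∀ v → ℓ v ≢ just c) ⊎ Rooted G χ c (λ v → hasLabel c (ℓ v)) → ¬ ¬ TreeOf c
    toTree c (inj₁ empty) k = k (inj₁ empty)
    toTree c (inj₂ root) k =
      let (H , good , VH≡) = piece G χ c _ root
      in spanningTree {χ = χ} H good λ { (T , treeT , VT≡) → k (inj₂ (T , treeT , ≡.trans VT≡ VH≡)) }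
    unlabelled : ∀ Ts v → (∀ i → ℓ v ≡ just i → v ∈ covered Ts) → lookup (∁ (covered Ts)) v ≡ true → not (is-just (ℓ v)) ≡ true
    unlabelled Ts v cover e with ℓ v
    ... | nothing = ≡.refl
    ... | just i  = true≢false ([]=⇒lookup (cover i ≡.refl)) (not-true⁻ (≡.trans (≡.sym (lookup-map v not (covered Ts))) e))

-- Greedy choice of centres and the giant component

module Forests (ℝ : RealNumbers) {n r′ : ℕ} (G : Graph n) (χ : Colouring (suc r′) n) (l a b : ℕ)
  (1≤a : 1 ℕ.≤ a) (n<2^ : n ℕ.< 2 ℕ.^ suc l) (expanding : Expanding l a b G)
  (at≤lb : a ℕ.* (suc r′ ℕ.* (2 ℕ.+ l)) ℕ.≤ l ℕ.* b)
  (l≤β : l ℕ.≤ 2 ℕ.* (a ℕ.* suc r′))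
  (t≤rω : suc r′ ℕ.* (2 ℕ.+ l) ℕ.≤ suc r′ ℕ.* ((2 ℕ.* suc r′) ℕ.* suc (b ℕ.+ b ℕ.+ b))) where
  open Assignments ℝ

  -- `t` is the number of usable edges that lets `assignment` catch a vertex. One round shrinks W by
  -- at most the factor β / l. With `ω` vertices in W, `assignment` can reserve more than 3b of them
  -- for a given colour.
  r t β ω : ℕ
  r = suc r′
  t = r ℕ.* (2 ℕ.+ l)
  β = 2 ℕ.* (a ℕ.* r)
  ω = (2 ℕ.* r) ℕ.* suc (b ℕ.+ b ℕ.+ b)

  private
    1≤ar : 1 ℕ.≤ a ℕ.* r
    1≤ar = ℕ.*-mono-≤ {1} {a} {1} {r} 1≤a (ℕ.s≤s ℕ.z≤n)

    1≤β : 1 ℕ.≤ β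
    1≤β = ℕ.≤-trans 1≤ar (ℕ.m≤m+n (a ℕ.* r) _)

    b≤ω : b ℕ.≤ ω
    b≤ω = ℕ.≤-trans (ℕ.≤-trans (ℕ.m≤n+m b (b ℕ.+ b)) (ℕ.n≤1+n _)) (ℕ.m≤n*m _ (2 ℕ.* r))

  -- The colours in S are the flexible ones: every vertex of W is joined to
  -- the centre of each of them in that colour.
  record State (k : ℕ) : Set where
    field
      S       : Fin r → Bool
      centre  : Fin r → Fin n
      W       : Fin n → Bool
      star    : ∀ c w → S c ≡ true → W w ≡ true → joined G χ c (centre c) w ≡ true
      missing : # (λ c → not (S c)) ≡ suc k
      -- With k + 1 colours missing, k rounds remain until a single one is left; W can shrink k more
      -- times and still keep ω vertices.
      rich    : β ℕ.^ k ℕ.* ω ℕ.≤ l ℕ.^ k ℕ.* # W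

    flexibleDegree : Fin n → ℕ
    flexibleDegree v = # λ w → is-just (clause G χ S W v w)

    W-large : ω ℕ.≤ # W
    W-large = ℕ.≮⇒≥ λ small → ℕ.<⇒≱ (ℕ.*-monoʳ-< (β ℕ.^ k) {{ℕ.m^n≢0 β k {{ℕ.>-nonZero 1≤β}}}} small)
      (ℕ.≤-trans rich (ℕ.*-monoˡ-≤ (# W) (ℕ.^-monoˡ-≤ k l≤β)))

    degree-split : ∀ u → # (λ w → W w ∧ adj G u w) ℕ.≤
      flexibleDegree u ℕ.+ sum (λ c → # λ w → not (S c) ∧ (W w ∧ joined G χ c u w))
    degree-split u = begin
      # (λ w → W w ∧ adj G u w)                      ≤⟨ sum-mono pointwise ⟩
      sum (λ w → ⟦ is-just (clause G χ S W u w) ⟧ ℕ.+ sum (λ c → ⟦ f c w ⟧))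
        ≡⟨ ∑-distrib-+ (λ w → ⟦ is-just (clause G χ S W u w) ⟧) (λ w → sum λ c → ⟦ f c w ⟧) ⟩
      flexibleDegree u ℕ.+ sum (λ w → sum λ c → ⟦ f c w ⟧)
        ≡⟨ cong (flexibleDegree u ℕ.+_) (∑-comm (λ w c → ⟦ f c w ⟧)) ⟩
      flexibleDegree u ℕ.+ sum (λ c → # (f c))       ∎
      where
        open ℕ.≤-Reasoning
        f : Fin r → Fin n → Bool
        f c w = not (S c) ∧ (W w ∧ joined G χ c u w)
        oneOf : ∀ w c → W w ≡ true → joined G χ c u w ≡ true → ∀ s → S c ≡ s →
          1 ℕ.≤ ⟦ is-just (clause G χ S W u w) ⟧ ℕ.+ sum (λ c → ⟦ f c w ⟧)
        oneOf w c w∈W j true  e = ℕ.≤-trans (ℕ.≤-reflexive (cong ⟦_⟧ (≡.sym (clause⁺ G χ S W u w w∈W e j)))) (ℕ.m≤m+n _ _)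
        oneOf w c w∈W j false e = ℕ.≤-trans (ℕ.≤-reflexive (cong ⟦_⟧ (≡.sym (∧-true (not-true⁺ e) (∧-true w∈W j)))))
          (ℕ.≤-trans (term≤sum (λ c → ⟦ f c w ⟧) c) (ℕ.m≤n+m _ ⟦ is-just (clause G χ S W u w) ⟧))
        pointwise : ∀ w → ⟦ W w ∧ adj G u w ⟧ ℕ.≤ ⟦ is-just (clause G χ S W u w) ⟧ ℕ.+ sum (λ c → ⟦ f c w ⟧)
        pointwise w = ⟦⟧≤ (W w ∧ adj G u w) λ e →
          let (c , j , _) = joined⁺ G χ (∧-trueʳ {W w} e) in oneOf w c (∧-trueˡ e) j (S c) ≡.refl

  private
    -- The factor 2 in β splits the budget: one half covers the flexible edges, d ≤ t ≤ r ω, and the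
    -- other half the edges of the chosen colour. Were w′ too small, both halves together would
    -- contradict the invariant.
    step-arithmetic : ∀ k {w w′ d} → β ℕ.^ suc k ℕ.* ω ℕ.≤ l ℕ.^ suc k ℕ.* w → l ℕ.* w ℕ.< a ℕ.* (d ℕ.+ r ℕ.* w′) → d ℕ.≤ t →
      β ℕ.^ k ℕ.* ω ℕ.≤ l ℕ.^ k ℕ.* w′
    step-arithmetic k {w} {w′} {d} inv h d≤t = ℕ.≮⇒≥ λ small → ℕ.<⇒≱ (begin-strict
      l ℕ.^ suc k ℕ.* w                          ≡⟨ solve 3 (λ l L w → l :* L :* w := L :* (l :* w)) ≡.refl l L w ⟩
      L ℕ.* (l ℕ.* w)                            ≤⟨ ℕ.*-monoʳ-≤ L (ℕ.<⇒≤ h) ⟩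
      L ℕ.* (a ℕ.* (d ℕ.+ r ℕ.* w′))             ≤⟨ ℕ.*-monoʳ-≤ L (ℕ.*-monoʳ-≤ a (ℕ.+-monoˡ-≤ (r ℕ.* w′) (ℕ.≤-trans d≤t t≤rω))) ⟩
      L ℕ.* (a ℕ.* (r ℕ.* ω ℕ.+ r ℕ.* w′))
        ≡⟨ solve 5 (λ L a r ω w → L :* (a :* (r :* ω :+ r :* w)) := (a :* r) :* (L :* ω) :+ (a :* r) :* (L :* w)) ≡.refl L a r ω w′ ⟩
      (a ℕ.* r) ℕ.* (L ℕ.* ω) ℕ.+ (a ℕ.* r) ℕ.* (L ℕ.* w′)
        <⟨ ℕ.+-mono-≤-< (ℕ.*-monoʳ-≤ (a ℕ.* r) (ℕ.*-monoˡ-≤ ω (ℕ.^-monoˡ-≤ k l≤β))) (ℕ.*-monoʳ-< (a ℕ.* r) {{ℕ.>-nonZero 1≤ar}} small) ⟩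
      (a ℕ.* r) ℕ.* (B ℕ.* ω) ℕ.+ (a ℕ.* r) ℕ.* (B ℕ.* ω)
        ≡⟨ solve 3 (λ x B ω → x :* (B :* ω) :+ x :* (B :* ω) := (con 2 :* x) :* B :* ω) ≡.refl (a ℕ.* r) B ω ⟩
      β ℕ.^ suc k ℕ.* ω                          ∎) inv
      where
        open ℕ.≤-Reasoning
        open +-*-Solver
        L = l ℕ.^ k
        B = β ℕ.^ k

  NonEmpty : ∀ {k} → State k → Set
  NonEmpty st = ∃ λ c → State.S st c ≡ true

  module _ {k} (st : State (suc k)) where
    open State st

    newColour : ∀ u c → S c ≡ false → flexibleDegree u ℕ.< t →
      l ℕ.* # W ℕ.< a ℕ.* (flexibleDegree u ℕ.+ r ℕ.* # (λ w → W w ∧ joined G χ c u w)) → Σ (State k) NonEmpty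
    newColour u c c∉S low rich′ = record
      { S       = λ i → S i ∨ does (c ≟ i)
      ; centre  = λ i → if does (c ≟ i) then u else centre i
      ; W       = λ w → W w ∧ joined G χ c u w
      ; star    = star′
      ; missing = ℕ.suc-injective (≡.trans (≡.sym (#-insert S c c∉S)) missing)
      ; rich    = step-arithmetic k rich rich′ (ℕ.<⇒≤ low)
      } , c , ∨-trueʳ (S c) (dec-true (c ≟ c) ≡.refl)
      where
        ∨-trueʳ : ∀ x {y} → y ≡ true → x ∨ y ≡ true
        ∨-trueʳ true  _ = ≡.refl
        ∨-trueʳ false p = p
        star′ : ∀ i w → S i ∨ does (c ≟ i) ≡ true → W w ∧ joined G χ c u w ≡ true →
          joined G χ i (if does (c ≟ i) then u else centre i) w ≡ true
        star′ i w i∈S w∈W′ with c ≟ i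
        ... | yes ≡.refl = ∧-trueʳ {W w} w∈W′
        ... | no _ with S i in e
        ...   | true = star i w e (∧-trueˡ w∈W′)

    -- By expansion some u in A sends more than l |W| / a edges to W. Fewer than t of these are
    -- flexible, so the most frequent missing colour at u retains a share of at least l / β of what
    -- the invariant guarantees, and u becomes its centre.
    extend-state : (A : Fin n → Bool) → # A ≡ a → (∀ u → A u ≡ true → W u ≡ false) →
      (∀ u → A u ≡ true → flexibleDegree u ℕ.< t) → Σ (State k) NonEmpty
    extend-state A #A≡a A∩W low =
      let (u , u∈A , dense) = exceedsAverage A F (ℕ.≤-trans 1≤a (ℕ.≤-reflexive (≡.sym #A≡a))) F-off
            (expanding A W A∩W #A≡a (ℕ.≤-trans b≤ω W-large))
          (c₁ , c₁∉S) = #>0⇒∃ (λ c → not (S c)) (ℕ.≤-trans (ℕ.s≤s ℕ.z≤n) (ℕ.≤-reflexive (≡.sym missing)))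
          (c , c∉S , popular) = majority (λ c → not (S c)) (g u) c₁ c₁∉S (g-off u)
      in newColour u c (not-true⁻ c∉S) (low u u∈A) (dense-enough u c dense popular)
      where
        F : Fin n → ℕ
        F u = # λ w → A u ∧ (W w ∧ adj G u w)
        F-off : ∀ u → A u ≡ false → F u ≡ 0
        F-off u e = ≡.trans (#-cong {n} λ w → cong (_∧ (W w ∧ adj G u w)) e) (sum-zero n)
        g : Fin n → Fin r → ℕ
        g u c = # λ w → not (S c) ∧ (W w ∧ joined G χ c u w)
        g-off : ∀ u c → not (S c) ≡ false → g u c ≡ 0
        g-off u c e = ≡.trans (#-cong {n} λ w → cong (_∧ (W w ∧ joined G χ c u w)) e) (sum-zero n)
        dense-enough : ∀ u c → l ℕ.* # W ℕ.< # A ℕ.* F u → sum (g u) ℕ.≤ r ℕ.* g u c →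
          l ℕ.* # W ℕ.< a ℕ.* (flexibleDegree u ℕ.+ r ℕ.* # (λ w → W w ∧ joined G χ c u w))
        dense-enough u c dense popular = begin-strict
          l ℕ.* # W                                        <⟨ dense ⟩
          # A ℕ.* F u                                      ≡⟨ cong (ℕ._* F u) #A≡a ⟩
          a ℕ.* F u                                        ≤⟨ ℕ.*-monoʳ-≤ a (#-mono {n} λ w e → ∧-trueʳ {A u} e) ⟩
          a ℕ.* # (λ w → W w ∧ adj G u w)                  ≤⟨ ℕ.*-monoʳ-≤ a (degree-split u) ⟩
          a ℕ.* (flexibleDegree u ℕ.+ sum (g u))           ≤⟨ ℕ.*-monoʳ-≤ a (ℕ.+-monoʳ-≤ (flexibleDegree u) popular) ⟩
          a ℕ.* (flexibleDegree u ℕ.+ r ℕ.* g u c)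
            ≤⟨ ℕ.*-monoʳ-≤ a (ℕ.+-monoʳ-≤ (flexibleDegree u) (ℕ.*-monoʳ-≤ r (#-mono {n} λ w e → ∧-trueʳ {not (S c)} e))) ⟩
          a ℕ.* (flexibleDegree u ℕ.+ r ℕ.* # (λ w → W w ∧ joined G χ c u w)) ∎
          where open ℕ.≤-Reasoning

  module Finish {k} (st : State k) (c₀ : Fin r) (c₀∈S : State.S st c₀ ≡ true) where
    open State st

    Centre : Fin n → Set
    Centre v = ∃ λ c → S c ≡ true × centre c ≡ v

    centre? : ∀ v → Dec (Centre v)
    centre? v = any? λ c → (S c ≟ᵇ true) ×-dec (centre c ≟ v)

    -- The vertices that the distribution of W over the stars is not sure to catch. All others
    -- receive a label under every s with `Hits s`.
    U : Fin n → Bool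
    U v = not (W v) ∧ (not (does (centre? v)) ∧ does (flexibleDegree v ℕ.<? t))

    U⁺ : ∀ v → W v ≢ true → ¬ Centre v → ¬ t ℕ.≤ flexibleDegree v → U v ≡ true
    U⁺ v p q s = ∧-true (not-true⁺ (¬-not p)) (∧-true (not-true⁺ (dec-false (centre? v) q)) (dec-true (flexibleDegree v ℕ.<? t) (ℕ.≰⇒> s)))

    U⇒∉W : ∀ v → U v ≡ true → W v ≡ false
    U⇒∉W v e = not-true⁻ (∧-trueˡ e)

    U⇒¬centre : ∀ v → U v ≡ true → ¬ Centre v
    U⇒¬centre v e = does-false⁻ (centre? v) (not-true⁻ (∧-trueˡ (∧-trueʳ {not (W v)} e)))

    U⇒low : ∀ v → U v ≡ true → flexibleDegree v ℕ.< t
    U⇒low v e = dec-true⁻ (flexibleDegree v ℕ.<? t) (∧-trueʳ {not (does (centre? v))} (∧-trueʳ {not (W v)} e))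

    Hits : (Fin n → Fin r) → Set
    Hits s = ∀ v → t ℕ.≤ flexibleDegree v → ∃ λ w → clause G χ S W v w ≡ just (s w)

    someW : ∃ λ w → W w ≡ true
    someW = #>0⇒∃ W (ℕ.≤-trans (ℕ.s≤s ℕ.z≤n) (ℕ.≤-trans (ℕ.*-mono-≤ {1} {2 ℕ.* r} {1} (ℕ.s≤s ℕ.z≤n) (ℕ.s≤s ℕ.z≤n)) W-large))

    module WithSet (s : Fin n → Fin r) (hits : Hits s) (D : Fin n → Bool) (d : Fin r)
      (D-class : (∀ v → D v ≡ false) ⊎ (S d ≡ false × Rooted G χ d D))
      (D∩W : ∀ v → D v ≡ true → W v ≡ true → s v ≡ d)
      (D∩x : ∀ c → S c ≡ true → D (centre c) ≡ false) where

      module H = Hang G χ S centre W s D d c₀ (proj₁ someW) c₀∈S (proj₂ someW) star D-class D∩W D∩x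

      leaf : ∀ v → (∃ λ w → clause G χ S W v w ≡ just (s w)) → H.Leaf v
      leaf v (w , e) = w , clause⁻ G χ S W v w e

      unlabelled⇒ : ∀ v → not (is-just (H.ℓ v)) ≡ true → U v ∧ not (D v) ≡ true
      unlabelled⇒ v e = ∧-true
        (U⁺ v (λ p → no-label (inj₂ (inj₂ (inj₁ p)))) (λ p → no-label (inj₂ (inj₁ p)))
          (λ p → no-label (inj₂ (inj₂ (inj₂ (leaf v (hits v p)))))))
        (not-true⁺ (¬-not λ p → no-label (inj₁ p)))
        where
          no-label : ¬ (D v ≡ true ⊎ H.Centre v ⊎ W v ≡ true ⊎ H.Leaf v)
          no-label p = true≢false (cong is-just (proj₂ (H.labelled v p))) (not-true⁻ e)

      forest : ∀ m → # (λ v → U v ∧ not (D v)) ℕ.≤ m → ¬ ¬ ColouredForest G χ m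
      forest m small = forestFromLabels G χ H.ℓ H.classes (ℕ.≤-trans (#-mono {n} unlabelled⇒) small)

    assigned : ∀ c → ¬ ¬ Σ (Fin n → Fin r) λ s → Hits s × b ℕ.+ b ℕ.+ b ℕ.< # (λ w → W w ∧ does (c ≟ s w))
    assigned c = assignment r′ l (clause G χ S W) W c (b ℕ.+ b ℕ.+ b) n<2^ W-large

    finishSmall : ∀ {m} → # U ℕ.≤ m → ¬ ¬ ColouredForest G χ m
    finishSmall {m} small none = assigned c₀ λ (s , hits , _) →
      WithSet.forest s hits (λ _ → false) c₀ (inj₁ λ _ → ≡.refl) (λ _ ()) (λ _ _ → ≡.refl) m
        (ℕ.≤-trans (#-mono {n} λ v e → ∧-trueˡ e) small) none

    -- With a single colour d left, almost all edges from U to W have colour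
    -- d, so the d-coloured graph between U and the reserved part P of W has
    -- a giant component.
    module Giant (d : Fin r) (d∉S : S d ≡ false) (only : ∀ c → c ≢ d → S c ≡ true)
      (s : Fin n → Fin r) (hits : Hits s) (reserved : b ℕ.+ b ℕ.+ b ℕ.< # (λ w → W w ∧ does (d ≟ s w)))
      (U-large : a ℕ.+ a ℕ.≤ # U) where

      P Q : Fin n → Bool
      P w = W w ∧ does (d ≟ s w)
      Q v = U v ∨ P v

      J : Fin n → Fin n → Set
      J = Link G χ d Q

      U⇒Q : ∀ {v} → U v ≡ true → Q v ≡ true
      U⇒Q {v} e = cong (_∨ P v) e

      P⇒Q : ∀ {v} → P v ≡ true → Q v ≡ true
      P⇒Q {v} e with U v
      ... | true  = ≡.refl
      ... | false = e

      -- Some u in A has more than l |B| / a edges to B. This exceeds t because a t ≤ l b, while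
      -- fewer than t edges from u to W are flexible; so one of its edges to B has the only
      -- remaining colour d.
      crossing : ∀ A B → (∀ u → A u ≡ true → U u ≡ true) → (∀ w → B w ≡ true → P w ≡ true) → a ℕ.≤ # A → b ℕ.≤ # B →
        ∃ λ u → ∃ λ w → A u ≡ true × B w ≡ true × J u w
      crossing A B A⊆U B⊆P a≤#A b≤#B =
        let (A′ , A′⊆A , #A′≡a) = shrink A a≤#A
            (u , u∈A′ , dense) = exceedsAverage A′ (F A′) (ℕ.≤-trans 1≤a (ℕ.≤-reflexive (≡.sym #A′≡a))) (F-off A′)
              (expanding A′ B (λ v e → disjoint v (A′⊆A v e)) #A′≡a b≤#B)
        in fromDense u (A′⊆A u u∈A′) (begin-strict
             l ℕ.* # B                       <⟨ dense ⟩
             # A′ ℕ.* F A′ u                 ≡⟨ cong (ℕ._* F A′ u) #A′≡a ⟩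
             a ℕ.* F A′ u                    ≤⟨ ℕ.*-monoʳ-≤ a (#-mono {n} λ w e → ∧-trueʳ {A′ u} e) ⟩
             a ℕ.* # (λ w → B w ∧ adj G u w) ∎)
        where
          open ℕ.≤-Reasoning
          F : (Fin n → Bool) → Fin n → ℕ
          F A′ u = # λ w → A′ u ∧ (B w ∧ adj G u w)
          F-off : ∀ A′ u → A′ u ≡ false → F A′ u ≡ 0
          F-off A′ u e = ≡.trans (#-cong {n} λ w → cong (_∧ (B w ∧ adj G u w)) e) (sum-zero n)
          disjoint : ∀ u → A u ≡ true → B u ≡ false
          disjoint u e = ¬-not λ p → true≢false (∧-trueˡ (B⊆P u p)) (U⇒∉W u (A⊆U u e))
          fromDense : ∀ u → A u ≡ true → l ℕ.* # B ℕ.< a ℕ.* # (λ w → B w ∧ adj G u w) →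
            ∃ λ u → ∃ λ w → A u ≡ true × B w ≡ true × J u w
          fromDense u u∈A dense = go (any? λ w → (B w ≟ᵇ true) ×-dec (joined G χ d u w ≟ᵇ true))
            where
              go : Dec (∃ λ w → B w ≡ true × joined G χ d u w ≡ true) → ∃ λ u → ∃ λ w → A u ≡ true × B w ≡ true × J u w
              go (yes (w , w∈B , j)) = u , w , u∈A , w∈B , U⇒Q (A⊆U u u∈A) , P⇒Q (B⊆P w w∈B) , j
              go (no none) = contradiction (begin-strict
                l ℕ.* # B                                <⟨ dense ⟩
                a ℕ.* # (λ w → B w ∧ adj G u w)          ≤⟨ ℕ.*-monoʳ-≤ a (#-mono {n} flexible) ⟩
                a ℕ.* flexibleDegree u                   ≤⟨ ℕ.*-monoʳ-≤ a (ℕ.<⇒≤ (U⇒low u (A⊆U u u∈A))) ⟩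
                a ℕ.* t                                  ≤⟨ at≤lb ⟩
                l ℕ.* b                                  ≤⟨ ℕ.*-monoʳ-≤ l b≤#B ⟩
                l ℕ.* # B                                ∎) (ℕ.<-irrefl ≡.refl)
                where
                  flexible : ∀ w → B w ∧ adj G u w ≡ true → is-just (clause G χ S W u w) ≡ true
                  flexible w e =
                    let (c , j , _) = joined⁺ G χ (∧-trueʳ {B w} e)
                    in clause⁺ G χ S W u w (∧-trueˡ (B⊆P w (∧-trueˡ e)))
                         (only c λ c≡d → none (w , ∧-trueˡ e , ≡.subst (λ c → joined G χ c u w ≡ true) c≡d j)) j

      module _ (reach? : ∀ u w → Dec (Star J u w)) where

        comp : Fin n → Fin n → Bool
        comp z v = does (reach? z v)

        comp-closed : ∀ z u w → comp z u ≡ true → J u w → comp z w ≡ true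
        comp-closed z u w p j = dec-true (reach? z w) (dec-true⁻ (reach? z u) p ◅◅ j ◅ ε)

        union : List (Fin n) → Fin n → Bool
        union []       v = false
        union (z ∷ zs) v = (P z ∧ comp z v) ∨ union zs v

        union-closed : ∀ zs u w → union zs u ≡ true → J u w → union zs w ≡ true
        union-closed (z ∷ zs) u w p j with ∨-true⁻ {P z ∧ comp z u} p
        ... | inj₁ q = cong (_∨ union zs w) (∧-true (∧-trueˡ q) (comp-closed z u w (∧-trueʳ {P z} q) j))
        ... | inj₂ q with P z ∧ comp z w
        ...   | true  = ≡.refl
        ...   | false = union-closed zs u w q j

        union-all : ∀ zs z → z List.∈ zs → P z ≡ true → union zs z ≡ true
        union-all (z ∷ zs) .z (here ≡.refl) z∈P = cong (_∨ union zs z) (∧-true z∈P (dec-true (reach? z z) ε))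
        union-all (y ∷ zs) z  (there z∈) z∈P with P y ∧ comp y z
        ... | true  = ≡.refl
        ... | false = union-all zs z z∈ z∈P

        Closed : (Fin n → Bool) → Set
        Closed T = ∀ u w → T u ≡ true → J u w → T w ≡ true

        -- Otherwise `crossing` would link the part of P inside T with the part of U outside it,
        -- although T is closed under links.
        closed-separation : ∀ T → Closed T → b ℕ.≤ # (λ w → P w ∧ T w) → # (λ u → U u ∧ not (T u)) ℕ.< a
        closed-separation T closed big = ℕ.≰⇒> λ rest →
          let (u , w , u∈ , w∈ , j) = crossing (λ u → U u ∧ not (T u)) (λ w → P w ∧ T w) (λ u e → ∧-trueˡ e) (λ w e → ∧-trueˡ e) rest big
          in true≢false (closed w u (∧-trueʳ {P w} w∈) (Link-sym G χ {d} {Q} j)) (not-true⁻ (∧-trueʳ {U u} u∈))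

        closed-separation′ : ∀ T → Closed T → a ℕ.≤ # (λ u → U u ∧ T u) → # (λ w → P w ∧ not (T w)) ℕ.< b
        closed-separation′ T closed big = ℕ.≰⇒> λ rest →
          let (u , w , u∈ , w∈ , j) = crossing (λ u → U u ∧ T u) (λ w → P w ∧ not (T w)) (λ u e → ∧-trueˡ e) (λ w e → ∧-trueˡ e) big rest
          in true≢false (closed u w (∧-trueʳ {U u} u∈) j) (not-true⁻ (∧-trueʳ {P w} w∈))

        -- Components are added one at a time. When the union first reaches b vertices of P, it has
        -- at most 2b of them. It then misses fewer than a vertices of U, hence contains at least a
        -- since |U| ≥ 2a, hence misses fewer than b vertices of P. So |P| ≤ 3b, against the reserve
        -- of more than 3b.
        all-small⇒ : (∀ z → P z ≡ true → # (λ w → P w ∧ comp z w) ℕ.< b) → ∀ zs → 1 ℕ.≤ b → # (λ w → P w ∧ union zs w) ℕ.< b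
        all-small⇒ small [] 1≤b = ℕ.≤-trans (ℕ.s≤s (ℕ.≤-reflexive (≡.trans (#-cong {n} λ w → ∧-zeroʳ (P w)) (sum-zero n)))) 1≤b
        all-small⇒ small (z ∷ zs) 1≤b = ℕ.≰⇒> λ big → contradiction (begin-strict
          # P                                                              ≡⟨ #-split P T ⟩
          # (λ w → P w ∧ T w) ℕ.+ # (λ w → P w ∧ not (T w))
            ≤⟨ ℕ.+-mono-≤ (ℕ.≤-trans (#-mono {n} part) (#-∨ (λ w → (P z ∧ (P w ∧ comp z w))) (λ w → P w ∧ union zs w)))
                 (ℕ.<⇒≤ (closed-separation′ T (union-closed (z ∷ zs)) (half big))) ⟩
          (# (λ w → P z ∧ (P w ∧ comp z w)) ℕ.+ # (λ w → P w ∧ union zs w)) ℕ.+ b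
            ≤⟨ ℕ.+-monoˡ-≤ b (ℕ.+-mono-≤ (first (P z) ≡.refl) (ℕ.<⇒≤ (all-small⇒ small zs 1≤b))) ⟩
          (b ℕ.+ b) ℕ.+ b                                                  <⟨ reserved ⟩
          # P                                                              ∎) (ℕ.<-irrefl ≡.refl)
          where
            open ℕ.≤-Reasoning
            T = union (z ∷ zs)
            part : ∀ w → P w ∧ T w ≡ true → (P z ∧ (P w ∧ comp z w)) ∨ (P w ∧ union zs w) ≡ true
            part w e with P w | P z | comp z w
            ... | true | true  | true  = ≡.refl
            ... | true | true  | false = e
            ... | true | false | _     = e
            first : ∀ x → P z ≡ x → # (λ w → P z ∧ (P w ∧ comp z w)) ℕ.≤ b
            first true  e = ℕ.≤-trans (#-mono {n} λ w q → ∧-trueʳ {P z} q) (ℕ.<⇒≤ (small z e))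
            first false e = ℕ.≤-trans (ℕ.≤-reflexive (≡.trans (#-cong {n} λ w → cong (_∧ (P w ∧ comp z w)) e) (sum-zero n))) ℕ.z≤n
            half : b ℕ.≤ # (λ w → P w ∧ T w) → a ℕ.≤ # (λ u → U u ∧ T u)
            half big = ℕ.+-cancelʳ-≤ a a _ (ℕ.≤-trans U-large (ℕ.≤-trans (ℕ.≤-reflexive (#-split U T))
              (ℕ.+-monoʳ-≤ _ (ℕ.<⇒≤ (closed-separation T (union-closed (z ∷ zs)) big)))))

        -- If every component failed, then by `closed-separation` each would have fewer than b
        -- vertices of P, and so would their union, which is all of P.
        giant : 1 ℕ.≤ b → ∃ λ z → P z ≡ true × # (λ u → U u ∧ not (comp z u)) ℕ.< a
        giant 1≤b = go (any? λ z → (P z ≟ᵇ true) ×-dec (# (λ u → U u ∧ not (comp z u)) ℕ.<? a))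
          where
            go : Dec (∃ λ z → P z ≡ true × # (λ u → U u ∧ not (comp z u)) ℕ.< a) → ∃ λ z → P z ≡ true × # (λ u → U u ∧ not (comp z u)) ℕ.< a
            go (yes p) = p
            go (no ¬p) = contradiction (ℕ.<-trans (ℕ.≤-<-trans (ℕ.m≤n+m b (b ℕ.+ b)) reserved)
              (ℕ.≤-<-trans (#-mono {n} λ w e → ∧-true e (union-all (allFin n) w (∈-allFin w) e))
                (all-small⇒ (λ z z∈P → ℕ.≰⇒> λ big → ¬p (z , z∈P , closed-separation (comp z) (comp-closed z) big)) (allFin n) 1≤b)))
              (ℕ.<-irrefl ≡.refl)

        finishGiant : ∀ {m} → 1 ℕ.≤ b → a ℕ.≤ m → ¬ ¬ ColouredForest G χ m
        finishGiant {m} 1≤b a≤m = WithSet.forest s hits D d (inj₂ (d∉S , closure-rooted G χ (λ j → proj₂ (proj₂ j)) reach? z))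
          D∩W D∩x m (ℕ.≤-trans (ℕ.<⇒≤ (proj₂ (proj₂ (giant 1≤b)))) a≤m)
          where
            z = proj₁ (giant 1≤b)
            D : Fin n → Bool
            D = comp z
            D⇒Q : ∀ {u v} → Q u ≡ true → Star J u v → Q v ≡ true
            D⇒Q q ε       = q
            D⇒Q q (j ◅ p) = D⇒Q (proj₁ (proj₂ j)) p
            inQ : ∀ v → D v ≡ true → U v ≡ true ⊎ P v ≡ true
            inQ v e = ∨-true⁻ (D⇒Q (P⇒Q (proj₁ (proj₂ (giant 1≤b)))) (dec-true⁻ (reach? z v) e))
            D∩W : ∀ v → D v ≡ true → W v ≡ true → s v ≡ d
            D∩W v e w with inQ v e
            ... | inj₁ p = true≢false w (U⇒∉W v p)
            ... | inj₂ p = ≡.sym (dec-true⁻ (d ≟ s v) (∧-trueʳ {W v} p))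
            D∩x : ∀ c → S c ≡ true → D (centre c) ≡ false
            D∩x c c∈S = ¬-not λ e → Sum.[ (λ p → U⇒¬centre (centre c) p (c , c∈S , ≡.refl)) ,
              (λ p → joined⇒≢ G χ {c} (star c (centre c) c∈S (∧-trueˡ p)) ≡.refl) ] (inQ (centre c) e)

  module _ (1≤b : 1 ℕ.≤ b) where

    -- The procedure stops as soon as U has fewer than 2a vertices, since these may stay uncovered.
    -- Otherwise U is large enough for the next centre, or, when one colour is left, for both uses
    -- of expansion in `Giant`.
    run : ∀ k (st : State k) → NonEmpty st → ¬ ¬ ColouredForest G χ (a ℕ.+ a)
    step : ∀ k (st : State k) (ne : NonEmpty st) → Dec (# (Finish.U st (proj₁ ne) (proj₂ ne)) ℕ.< a ℕ.+ a) →
      ¬ ¬ ColouredForest G χ (a ℕ.+ a)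
    run k st ne = step k st ne (# (Finish.U st (proj₁ ne) (proj₂ ne)) ℕ.<? a ℕ.+ a)
    step k st (c₀ , c₀∈S) (yes small) = Finish.finishSmall st c₀ c₀∈S (ℕ.<⇒≤ small)
    step (suc k) st (c₀ , c₀∈S) (no large) =
      let (A , A⊆U , #A≡a) = shrink U (ℕ.≤-trans (ℕ.m≤m+n a a) (ℕ.≮⇒≥ large))
          (st′ , ne′) = extend-state st A #A≡a (λ u e → U⇒∉W u (A⊆U u e)) (λ u e → U⇒low u (A⊆U u e))
      in run k st′ ne′
      where open Finish st c₀ c₀∈S
    step zero st (c₀ , c₀∈S) (no large) none = assigned d λ (s , hits , reserved) →
      let open Giant d (not-true⁻ (proj₂ missingColour)) only s hits reserved (ℕ.≮⇒≥ large)
      in decidable₂ (Star J) λ reach? → finishGiant reach? 1≤b (ℕ.m≤m+n a a) none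
      where
        open State st
        open Finish st c₀ c₀∈S
        missingColour : ∃ λ c → not (S c) ≡ true
        missingColour = #>0⇒∃ (λ c → not (S c)) (ℕ.≤-reflexive (≡.sym missing))
        d = proj₁ missingColour
        only : ∀ c → c ≢ d → S c ≡ true
        only c c≢d = ¬-not λ c∉S → contradiction (ℕ.≤-trans
          (ℕ.≤-trans (ℕ.≤-reflexive (cong (λ b → ⟦ not b ⟧) (≡.sym (cong₂ _∨_ c∉S (dec-false (d ≟ c) λ e → c≢d (≡.sym e))))))
            (term≤sum (λ i → ⟦ not (S i ∨ does (d ≟ i)) ⟧) c))
          (ℕ.≤-reflexive (ℕ.suc-injective (≡.trans (≡.sym (#-insert S d (not-true⁻ (proj₂ missingColour)))) missing)))) λ ()

    forest : ∀ {r″} → r′ ≡ suc r″ → a ℕ.≤ n → β ℕ.^ r′ ℕ.* ω ℕ.≤ l ℕ.^ r′ ℕ.* (n ℕ.∸ a) → ¬ ¬ ColouredForest G χ (a ℕ.+ a)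
    forest {r″} r′≡ a≤n start =
      -- The first centre is sought among `a` arbitrary vertices, with W everything else. No colour
      -- is flexible yet, so all flexible degrees are 0, and `u` is a dummy value for the centres.
      let (A , _ , #A≡a) = shrink {n} (λ _ → true) (ℕ.≤-trans a≤n (ℕ.≤-reflexive (≡.sym (#-all n))))
          (u , _) = #>0⇒∃ A (ℕ.≤-trans 1≤a (ℕ.≤-reflexive (≡.sym #A≡a)))
          (st , ne) = extend-state (initial A #A≡a u) A #A≡a (λ u e → cong not e) (λ u _ → flexible u A #A≡a u)
      in run r″ st ne
      where
        initial : (A : Fin n → Bool) → # A ≡ a → Fin n → State (suc r″)
        initial A #A≡a u = record
          { S       = λ _ → false
          ; centre  = λ _ → u
          ; W       = λ w → not (A w)
          ; star    = λ _ _ ()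
          ; missing = ≡.trans (#-all r) (cong suc r′≡)
          ; rich    = ≡.subst (λ k → β ℕ.^ k ℕ.* ω ℕ.≤ l ℕ.^ k ℕ.* # (λ w → not (A w))) r′≡
              (ℕ.≤-trans start (ℕ.*-monoʳ-≤ (l ℕ.^ r′) (ℕ.≤-reflexive complement)))
          }
          where
            complement : n ℕ.∸ a ≡ # (λ w → not (A w))
            complement = ≡.trans (cong₂ ℕ._∸_ (≡.trans (≡.sym (#-all n)) (#-split (λ _ → true) A)) (≡.sym #A≡a)) (ℕ.m+n∸m≡n (# A) _)
        select-none : ∀ x m → is-just (select G χ (λ _ → false) x m) ≡ false
        select-none false m        = ≡.refl
        select-none true  nothing  = ≡.refl
        select-none true  (just c) = ≡.refl
        flexible : ∀ x A #A≡a u → State.flexibleDegree (initial A #A≡a x) u ℕ.< t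
        flexible x A #A≡a u = ℕ.≤-<-trans
          (ℕ.≤-reflexive (≡.trans (#-cong {n} λ w → select-none (not (A w) ∧ adj G u w) (at χ u w)) (sum-zero n)))
          (ℕ.*-mono-≤ {1} {r} {1} {2 ℕ.+ l} (ℕ.s≤s ℕ.z≤n) (ℕ.s≤s ℕ.z≤n))

-- The thresholds

^-distribʳ-* : ∀ m n k → (m ℕ.* n) ℕ.^ k ≡ m ℕ.^ k ℕ.* n ℕ.^ k
^-distribʳ-* m n zero    = ≡.refl
^-distribʳ-* m n (suc k) = ≡.trans (cong (m ℕ.* n ℕ.*_) (^-distribʳ-* m n k))
  (solve 4 (λ m n M N → m :* n :* (M :* N) := m :* M :* (n :* N)) ≡.refl m n (m ℕ.^ k) (n ℕ.^ k))
  where open +-*-Solver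

-- The lower bound on l^r′ n / a^r under which W survives all r′ rounds. It is β^r′ ω with ω ≤ 20
-- r^2 a, divided by a^r; the `suc` makes up for the a vertices set aside at the start.
ratioBound : ℕ → ℕ
ratioBound r′ = suc ((2 ℕ.* suc r′) ℕ.^ r′ ℕ.* (20 ℕ.* (suc r′ ℕ.* suc r′)))

module Sizes (r′ n l a : ℕ) (1≤r′ : 1 ℕ.≤ r′) (2≤l : 2 ℕ.≤ l) (2l<a : 2 ℕ.* l ℕ.< a)
  (sparse : ratioBound r′ ℕ.* a ℕ.^ suc r′ ℕ.≤ l ℕ.^ r′ ℕ.* n) where
  open ℕ.≤-Reasoning
  open +-*-Solver

  r b : ℕ
  r = suc r′
  b = 3 ℕ.* (r ℕ.* a)

  1≤a : 1 ℕ.≤ a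
  1≤a = ℕ.≤-trans (ℕ.s≤s ℕ.z≤n) 2l<a

  l≤a : l ℕ.≤ a
  l≤a = ℕ.≤-trans (ℕ.m≤m+n l _) (ℕ.<⇒≤ 2l<a)

  ra≤b : r ℕ.* a ℕ.≤ b
  ra≤b = ℕ.m≤m+n (r ℕ.* a) _

  a≤b : a ℕ.≤ b
  a≤b = ℕ.≤-trans (ℕ.m≤m+n a _) ra≤b

  1≤b : 1 ℕ.≤ b
  1≤b = ℕ.≤-trans 1≤a a≤b

  2a<b : a ℕ.+ a ℕ.< b
  2a<b = begin
    1 ℕ.+ (a ℕ.+ a)    ≤⟨ ℕ.+-monoˡ-≤ (a ℕ.+ a) 1≤a ⟩
    a ℕ.+ (a ℕ.+ a)    ≡⟨ solve 1 (λ a → a :+ (a :+ a) := con 3 :* (con 1 :* a)) ≡.refl a ⟩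
    3 ℕ.* (1 ℕ.* a)    ≤⟨ ℕ.*-monoʳ-≤ 3 (ℕ.*-monoˡ-≤ a {1} {r} (ℕ.s≤s ℕ.z≤n)) ⟩
    b                  ∎

  2+l≤2l : 2 ℕ.+ l ℕ.≤ 2 ℕ.* l
  2+l≤2l = ℕ.≤-trans (ℕ.+-monoˡ-≤ l 2≤l) (ℕ.≤-reflexive (cong (l ℕ.+_) (≡.sym (ℕ.+-identityʳ l))))

  at≤lb : a ℕ.* (r ℕ.* (2 ℕ.+ l)) ℕ.≤ l ℕ.* b
  at≤lb = begin
    a ℕ.* (r ℕ.* (2 ℕ.+ l))   ≤⟨ ℕ.*-monoʳ-≤ a (ℕ.*-monoʳ-≤ r (ℕ.≤-trans 2+l≤2l (ℕ.*-monoˡ-≤ l {2} {3} (ℕ.s≤s (ℕ.s≤s ℕ.z≤n))))) ⟩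
    a ℕ.* (r ℕ.* (3 ℕ.* l))   ≡⟨ solve 3 (λ a r l → a :* (r :* (con 3 :* l)) := l :* (con 3 :* (r :* a))) ≡.refl a r l ⟩
    l ℕ.* b                   ∎

  l≤β : l ℕ.≤ 2 ℕ.* (a ℕ.* r)
  l≤β = ℕ.≤-trans l≤a (ℕ.≤-trans (ℕ.m≤m*n a r) (ℕ.m≤m+n (a ℕ.* r) _))

  ω : ℕ
  ω = (2 ℕ.* r) ℕ.* suc (b ℕ.+ b ℕ.+ b)

  t≤rω : r ℕ.* (2 ℕ.+ l) ℕ.≤ r ℕ.* ω
  t≤rω = ℕ.*-monoʳ-≤ r (begin
    2 ℕ.+ l               ≤⟨ ℕ.≤-trans 2+l≤2l (ℕ.<⇒≤ 2l<a) ⟩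
    a                     ≤⟨ a≤b ⟩
    b                     ≤⟨ ℕ.≤-trans (ℕ.m≤n+m b (b ℕ.+ b)) (ℕ.n≤1+n _) ⟩
    suc (b ℕ.+ b ℕ.+ b)   ≤⟨ ℕ.m≤n*m _ (2 ℕ.* r) ⟩
    ω                     ∎)

  a≤n : a ℕ.≤ n
  a≤n = ℕ.*-cancelʳ-≤ a n (a ℕ.^ r′) {{ℕ.m^n≢0 a r′ {{ℕ.>-nonZero 1≤a}}}} (begin
    a ℕ.^ r                  ≤⟨ ℕ.m≤m+n _ _ ⟩
    ratioBound r′ ℕ.* a ℕ.^ r ≤⟨ sparse ⟩
    l ℕ.^ r′ ℕ.* n           ≤⟨ ℕ.*-monoˡ-≤ n (ℕ.^-monoˡ-≤ r′ l≤a) ⟩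
    a ℕ.^ r′ ℕ.* n           ≡⟨ ℕ.*-comm (a ℕ.^ r′) n ⟩
    n ℕ.* a ℕ.^ r′           ∎)

  ω≤ : ω ℕ.≤ 20 ℕ.* (r ℕ.* r) ℕ.* a
  ω≤ = begin
    (2 ℕ.* r) ℕ.* (1 ℕ.+ (b ℕ.+ b ℕ.+ b))         ≤⟨ ℕ.*-monoʳ-≤ (2 ℕ.* r) (ℕ.+-monoˡ-≤ (b ℕ.+ b ℕ.+ b) (ℕ.*-mono-≤ {1} {r} {1} {a} (ℕ.s≤s ℕ.z≤n) 1≤a)) ⟩
    (2 ℕ.* r) ℕ.* (r ℕ.* a ℕ.+ (b ℕ.+ b ℕ.+ b))
      ≡⟨ solve 2 (λ r a → (con 2 :* r) :* (r :* a :+ (con 3 :* (r :* a) :+ con 3 :* (r :* a) :+ con 3 :* (r :* a)))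
                   := con 20 :* (r :* r) :* a) ≡.refl r a ⟩
    20 ℕ.* (r ℕ.* r) ℕ.* a ∎

  startRich : (2 ℕ.* (a ℕ.* r)) ℕ.^ r′ ℕ.* ω ℕ.≤ l ℕ.^ r′ ℕ.* (n ℕ.∸ a)
  startRich = ℕ.+-cancelʳ-≤ (l ℕ.^ r′ ℕ.* a) _ _ (begin
    (2 ℕ.* (a ℕ.* r)) ℕ.^ r′ ℕ.* ω ℕ.+ l ℕ.^ r′ ℕ.* a
      ≤⟨ ℕ.+-mono-≤ (ℕ.*-mono-≤ (ℕ.≤-reflexive base) ω≤) (ℕ.*-monoˡ-≤ a (ℕ.^-monoˡ-≤ r′ l≤a)) ⟩
    ((2 ℕ.* r) ℕ.^ r′ ℕ.* a ℕ.^ r′) ℕ.* (20 ℕ.* (r ℕ.* r) ℕ.* a) ℕ.+ a ℕ.^ r′ ℕ.* a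
      ≡⟨ solve 4 (λ R A t a → (R :* A) :* (t :* a) :+ A :* a := (con 1 :+ R :* t) :* (a :* A)) ≡.refl
           ((2 ℕ.* r) ℕ.^ r′) (a ℕ.^ r′) (20 ℕ.* (r ℕ.* r)) a ⟩
    ratioBound r′ ℕ.* a ℕ.^ r                       ≤⟨ sparse ⟩
    l ℕ.^ r′ ℕ.* n                                  ≡⟨ cong (l ℕ.^ r′ ℕ.*_) (≡.sym (ℕ.m∸n+n≡m a≤n)) ⟩
    l ℕ.^ r′ ℕ.* (n ℕ.∸ a ℕ.+ a)                    ≡⟨ ℕ.*-distribˡ-+ (l ℕ.^ r′) (n ℕ.∸ a) a ⟩
    l ℕ.^ r′ ℕ.* (n ℕ.∸ a) ℕ.+ l ℕ.^ r′ ℕ.* a       ∎)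
    where
      base : (2 ℕ.* (a ℕ.* r)) ℕ.^ r′ ≡ (2 ℕ.* r) ℕ.^ r′ ℕ.* a ℕ.^ r′
      base = ≡.trans (cong (ℕ._^ r′) (solve 2 (λ a r → con 2 :* (a :* r) := (con 2 :* r) :* a) ≡.refl a r)) (^-distribʳ-* (2 ℕ.* r) a r′)

-- From the hypotheses on p to the combinatorial parameters

module Thresholds (ℝ : RealNumbers) where
  open RealNumbers ℝ
  open Analysis ℝ
  open RandomGraph ℝ
  open OrderedField ℝ
  open ExponentialSeries ℝ
  open RootsAndLogarithms ℝ
  open CommonNeighboursAAS ℝ using (log-half; log-pos; threshold; aas-commonNeighbours)
  open ExpansionAAS ℝ using (aas-expanding)
  open ≤-Reasoning

  ln : ℕ → Carrier
  ln n = log (fromℕ n)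

  ln-nonNeg : ∀ {n} → 2 ℕ.≤ n → 0# ≤ ln n
  ln-nonNeg p = <⇒≤ (log-pos p)

  0<n : ∀ {n} → 2 ℕ.≤ n → 0# < fromℕ n
  0<n p = fromℕ-pos′ (ℕ.≤-trans (ℕ.s≤s ℕ.z≤n) p)

  dense-from-root : ∀ {C p n} k → 2 ℕ.≤ n → 0# ≤ C → (C * ln n / fromℕ n) ^[ 1 / suc k ] ≤ p → C * ln n ≤ p ^ suc k * fromℕ n
  dense-from-root {C} {p} {n} k 2≤n 0≤C q = begin
    C * ln n                          ≈⟨ *-identityʳ _ ⟨
    C * ln n * 1#                     ≈⟨ *-congˡ (*-inverseˡ (0<n 2≤n)) ⟨
    C * ln n * (fromℕ n ⁻¹ * fromℕ n) ≈⟨ *-assoc _ _ _ ⟨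
    x * fromℕ n                       ≈⟨ *-congʳ (*-identityʳ x) ⟨
    x ^ 1 * fromℕ n                   ≤⟨ *-monoˡ-≤ (fromℕ-nonNeg n) (root≤⇒≤^ 1 k (^-nonNeg 1 0≤x) q) ⟩
    p ^ suc k * fromℕ n               ∎
    where
      x = C * ln n / fromℕ n
      0≤x : 0# ≤ x
      0≤x = *-nonNeg (*-nonNeg 0≤C (ln-nonNeg 2≤n)) (⁻¹-nonNeg (0<n 2≤n))

  -- Rounding up y / p. The Archimedean axiom gives only some upper bound N; descending from it with
  -- the decidable order brings the overshoot down to at most p.
  leastMultiple : ∀ {y p} N → 0# ≤ y → y < fromℕ N * p → ∃ λ a → y < fromℕ a * p × fromℕ a * p ≤ y + p
  leastMultiple zero 0≤y y<0 = contradiction 0≤y (<⇒≱ (<-≤-trans y<0 (≤-reflexive (zeroˡ _))))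
  leastMultiple {y} {p} (suc N) 0≤y y<[1+N]p = go (fromℕ N * p ≤? y)
    where
      go : Dec (fromℕ N * p ≤ y) → ∃ λ a → y < fromℕ a * p × fromℕ a * p ≤ y + p
      go (yes q) = suc N , y<[1+N]p , ≤-trans (≤-reflexive (solve 2 (λ N p → (con 1 :+ N) :* p := N :* p :+ p) refl _ p)) (+-monoˡ-≤ p q)
      go (no q)  = leastMultiple N 0≤y (≰⇒> q)

  -- The factor (5r)^r comes from a p ≤ 5 r log n, and 2^r′ from replacing r′ of the r factors log n
  -- by 2 l.
  forestConstant : ℕ → ℕ
  forestConstant r′ = ratioBound r′ ℕ.* ((5 ℕ.* suc r′) ℕ.^ suc r′ ℕ.* 2 ℕ.^ r′)

  module _ (r′ n l : ℕ) (1≤r′ : 1 ℕ.≤ r′) (4≤n : 4 ℕ.≤ n) (2^l≤n : 2 ℕ.^ l ℕ.≤ n) (n<2^ : n ℕ.< 2 ℕ.^ suc l) where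

    private
      r : ℕ
      r = suc r′
      ℓ = ln n
      2≤n = ℕ.≤-trans (ℕ.s≤s (ℕ.s≤s ℕ.z≤n)) 4≤n

    2≤l : 2 ℕ.≤ l
    2≤l = ℕ.≮⇒≥ λ l<2 → ℕ.<⇒≱ n<2^ (ℕ.≤-trans (ℕ.^-monoʳ-≤ 2 l<2) 4≤n)

    l/2≤ℓ : fromℕ l * ½ ≤ ℓ
    l/2≤ℓ = log-lower-2^ l (≤-trans (≤-reflexive (sym (fromℕ-^ 2 l))) (fromℕ-mono-≤ 2^l≤n))

    1≤ℓ : 1# ≤ ℓ
    1≤ℓ = ≤-trans (≤-trans (≤-reflexive (sym 2*½≈1)) (*-monoˡ-≤ (<⇒≤ 0<½) (fromℕ-mono-≤ 2≤l))) l/2≤ℓ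

    ℓ≤2l : ℓ ≤ fromℕ (2 ℕ.* l)
    ℓ≤2l = ≤-trans (log-upper (suc l) (≤-trans (≤-reflexive (sym fromℕ-1)) (fromℕ-mono-≤ (ℕ.≤-trans (ℕ.s≤s ℕ.z≤n) 4≤n)))
        (<-≤-trans (fromℕ-mono-< n<2^) (≤-reflexive (fromℕ-^ 2 (suc l)))))
      (fromℕ-mono-≤ (ℕ.≤-trans (ℕ.+-monoˡ-≤ l (ℕ.≤-trans (ℕ.s≤s ℕ.z≤n) 2≤l)) (ℕ.≤-reflexive (cong (l ℕ.+_) (≡.sym (ℕ.+-identityʳ l))))))

    private
      K = ratioBound r′
      C₃ = forestConstant r′

    module Budget (p : Carrier) (0≤p : 0# ≤ p) (p≤1 : p ≤ 1#) (dense : fromℕ C₃ * ℓ ≤ p ^ r * fromℕ n) where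

      private
        1≤C₃ : 1 ℕ.≤ C₃
        1≤C₃ = ℕ.*-mono-≤ {1} {K} {1} (ℕ.s≤s ℕ.z≤n) (ℕ.*-mono-≤ {1} {(5 ℕ.* r) ℕ.^ r} {1} (ℕ.m^n>0 (5 ℕ.* r) r) (ℕ.m^n>0 2 r′))

      p-pos : 0# < p
      p-pos = ≰⇒> λ p≤0 → <⇒≱ (*-pos (fromℕ-pos′ 1≤C₃) (log-pos 2≤n)) (≤-trans dense (begin
        p * p ^ r′ * fromℕ n   ≤⟨ *-monoˡ-≤ (fromℕ-nonNeg n) (*-monoˡ-≤ (^-nonNeg r′ 0≤p) p≤0) ⟩
        0# * p ^ r′ * fromℕ n  ≈⟨ trans (*-congʳ (zeroˡ _)) (zeroˡ _) ⟩
        0#                     ∎))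

      private
        y = fromℕ (4 ℕ.* r) * ℓ
        0≤y : 0# ≤ y
        0≤y = *-nonNeg (fromℕ-nonNeg (4 ℕ.* r)) (ln-nonNeg 2≤n)

      size : ∃ λ a → y < fromℕ a * p × fromℕ a * p ≤ y + p
      size = leastMultiple (suc N) 0≤y (≤-<-trans (begin
        y               ≈⟨ *-identityʳ y ⟨
        y * 1#          ≈⟨ *-congˡ (*-inverseˡ p-pos) ⟨
        y * (p ⁻¹ * p)  ≈⟨ *-assoc _ _ _ ⟨
        y * p ⁻¹ * p    ≤⟨ *-monoˡ-≤ 0≤p (proj₂ (archimedean (y * p ⁻¹))) ⟩
        fromℕ N * p     ∎) (*-monoˡ-< p-pos (fromℕ-mono-< (ℕ.n<1+n N))))
        where N = proj₁ (archimedean (y * p ⁻¹))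

      module _ (a : ℕ) (y<ap : y < fromℕ a * p) (ap≤y+p : fromℕ a * p ≤ y + p) where

        large : fromℕ 4 * ℓ < fromℕ a * (½ * p ^ 1)
        large = ≤-<-trans (begin
          fromℕ 4 * ℓ                 ≈⟨ *-identityʳ _ ⟨
          fromℕ 4 * ℓ * 1#            ≈⟨ *-congˡ 2*½≈1 ⟨
          fromℕ 4 * ℓ * (fromℕ 2 * ½) ≈⟨ solve 4 (λ f l t h → f :* l :* (t :* h) := f :* t :* l :* h) refl _ _ _ _ ⟩
          fromℕ 4 * fromℕ 2 * ℓ * ½   ≈⟨ *-congʳ (*-congʳ (fromℕ-* 4 2)) ⟨
          -- As r ≥ 2, the quantity 4 r log n is at least twice 4 log n, which makes up for the ½ of
          -- `missProbability`.
          fromℕ (4 ℕ.* 2) * ℓ * ½     ≤⟨ *-monoˡ-≤ (<⇒≤ 0<½) (*-monoˡ-≤ (ln-nonNeg 2≤n) (fromℕ-mono-≤ (ℕ.*-monoʳ-≤ 4 (ℕ.s≤s 1≤r′)))) ⟩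
          y * ½                       ∎)
          (<-≤-trans (*-monoˡ-< 0<½ y<ap) (≤-reflexive (solve 3 (λ a p h → a :* p :* h := a :* (h :* (p :* con 1))) refl _ p ½)))

        -- As p ≤ 1, a is at least a p, which exceeds 4 r log n, and log n ≥ l / 2.
        2l<a : 2 ℕ.* l ℕ.< a
        2l<a = ℕ.≰⇒> λ a≤2l → <⇒≱ y<ap (begin
          fromℕ a * p             ≤⟨ *-mono-≤ (fromℕ-nonNeg a) 0≤1 (fromℕ-mono-≤ a≤2l) p≤1 ⟩
          fromℕ (2 ℕ.* l) * 1#    ≈⟨ *-identityʳ _ ⟩
          fromℕ (2 ℕ.* l)         ≈⟨ *-identityʳ _ ⟨
          fromℕ (2 ℕ.* l) * 1#    ≈⟨ *-congˡ 2*½≈1 ⟨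
          fromℕ (2 ℕ.* l) * (fromℕ 2 * ½) ≈⟨ *-congʳ (fromℕ-* 2 l) ⟩
          fromℕ 2 * fromℕ l * (fromℕ 2 * ½) ≈⟨ solve 3 (λ t l h → t :* l :* (t :* h) := t :* t :* (l :* h)) refl _ _ _ ⟩
          fromℕ 2 * fromℕ 2 * (fromℕ l * ½) ≤⟨ *-monoʳ-≤ (*-nonNeg (fromℕ-nonNeg 2) (fromℕ-nonNeg 2)) l/2≤ℓ ⟩
          fromℕ 2 * fromℕ 2 * ℓ   ≈⟨ *-congʳ (fromℕ-* 2 2) ⟨
          fromℕ 4 * ℓ             ≤⟨ *-monoˡ-≤ (ln-nonNeg 2≤n) (fromℕ-mono-≤ (ℕ.m≤m*n 4 r)) ⟩
          y                       ∎)

        1≤a : 1 ℕ.≤ a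
        1≤a = ℕ.≤-trans (ℕ.s≤s ℕ.z≤n) 2l<a

        -- a was chosen just above 4 r log n / p, which leaves room for rounding.
        leftover : fromℕ (a ℕ.+ a) ≤ fromℕ (9 ℕ.* r) * ℓ / p
        leftover = *-cancelʳ-≤ p-pos (begin
          fromℕ (a ℕ.+ a) * p                 ≈⟨ trans (*-congʳ (fromℕ-+ a a)) (distribʳ p _ _) ⟩
          fromℕ a * p + fromℕ a * p           ≤⟨ +-mono-≤ ap≤y+ℓ ap≤y+ℓ ⟩
          (y + ℓ) + (y + ℓ)
            ≈⟨ solve 2 (λ f l → (f :* l :+ l) :+ (f :* l :+ l) := (f :+ f :+ (con 1 :+ (con 1 :+ con 0))) :* l) refl (fromℕ (4 ℕ.* r)) ℓ ⟩
          (fromℕ (4 ℕ.* r) + fromℕ (4 ℕ.* r) + fromℕ 2) * ℓ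
            ≈⟨ *-congʳ (trans (fromℕ-+ (4 ℕ.* r ℕ.+ 4 ℕ.* r) 2) (+-congʳ (fromℕ-+ (4 ℕ.* r) (4 ℕ.* r)))) ⟨
          fromℕ (4 ℕ.* r ℕ.+ 4 ℕ.* r ℕ.+ 2) * ℓ ≤⟨ *-monoˡ-≤ (ln-nonNeg 2≤n) (fromℕ-mono-≤ nine) ⟩
          fromℕ (9 ℕ.* r) * ℓ                 ≈⟨ *-identityʳ _ ⟨
          fromℕ (9 ℕ.* r) * ℓ * 1#            ≈⟨ *-congˡ (*-inverseˡ p-pos) ⟨
          fromℕ (9 ℕ.* r) * ℓ * (p ⁻¹ * p)    ≈⟨ *-assoc _ _ _ ⟨
          fromℕ (9 ℕ.* r) * ℓ / p * p         ∎)
          where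
            ap≤y+ℓ : fromℕ a * p ≤ y + ℓ
            ap≤y+ℓ = ≤-trans ap≤y+p (+-monoʳ-≤ y (≤-trans p≤1 1≤ℓ))
            nine : 4 ℕ.* r ℕ.+ 4 ℕ.* r ℕ.+ 2 ℕ.≤ 9 ℕ.* r
            nine = ℕ.≤-trans (ℕ.+-monoʳ-≤ (4 ℕ.* r ℕ.+ 4 ℕ.* r) (ℕ.s≤s 1≤r′))
              (ℕ.≤-reflexive (ℕS.solve 1 (λ r → ℕS.con 4 ℕS.:* r ℕS.:+ ℕS.con 4 ℕS.:* r ℕS.:+ r ℕS.:= ℕS.con 9 ℕS.:* r) ≡.refl r))
              where module ℕS = +-*-Solver

        Ka^r≤ : K ℕ.* a ℕ.^ r ℕ.≤ l ℕ.^ r′ ℕ.* n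
        Ka^r≤ = fromℕ-cancel-≤ (*-cancelʳ-≤ (^-pos r p-pos) (begin
          fromℕ (K ℕ.* a ℕ.^ r) * p ^ r           ≈⟨ *-congʳ (trans (fromℕ-* K (a ℕ.^ r)) (*-congˡ (fromℕ-^ a r))) ⟩
          fromℕ K * fromℕ a ^ r * p ^ r           ≈⟨ trans (*-assoc _ _ _) (*-congˡ (sym (^-distrib-* _ _ r))) ⟩
          fromℕ K * (fromℕ a * p) ^ r             ≤⟨ *-monoʳ-≤ (fromℕ-nonNeg K) (^-monoˡ-≤ r (*-nonNeg (fromℕ-nonNeg a) 0≤p) ap≤5rℓ) ⟩
          fromℕ K * (fromℕ (5 ℕ.* r) * ℓ) ^ r     ≈⟨ *-congˡ (^-distrib-* _ _ r) ⟩
          fromℕ K * (fromℕ (5 ℕ.* r) ^ r * (ℓ * ℓ ^ r′))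
            ≤⟨ *-monoʳ-≤ (fromℕ-nonNeg K) (*-monoʳ-≤ (^-nonNeg r (fromℕ-nonNeg (5 ℕ.* r))) (*-monoʳ-≤ (ln-nonNeg 2≤n)
                 (≤-trans (^-monoˡ-≤ r′ (ln-nonNeg 2≤n) ℓ≤2l) (≤-reflexive (trans (^-congˡ r′ (fromℕ-* 2 l)) (^-distrib-* _ _ r′)))))) ⟩
          fromℕ K * (fromℕ (5 ℕ.* r) ^ r * (ℓ * (fromℕ 2 ^ r′ * fromℕ l ^ r′)))
            ≈⟨ solve 5 (λ K f l t L → K :* (f :* (l :* (t :* L))) := L :* ((K :* (f :* t)) :* l)) refl _ _ _ _ _ ⟩
          fromℕ l ^ r′ * (fromℕ K * (fromℕ (5 ℕ.* r) ^ r * fromℕ 2 ^ r′) * ℓ)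
            ≈⟨ *-congˡ (*-congʳ (trans (fromℕ-* K ((5 ℕ.* r) ℕ.^ r ℕ.* 2 ℕ.^ r′)) (*-congˡ (trans (fromℕ-* ((5 ℕ.* r) ℕ.^ r) (2 ℕ.^ r′)) (*-cong (fromℕ-^ (5 ℕ.* r) r) (fromℕ-^ 2 r′)))))) ⟨
          fromℕ l ^ r′ * (fromℕ C₃ * ℓ)           ≤⟨ *-monoʳ-≤ (^-nonNeg r′ (fromℕ-nonNeg l)) dense ⟩
          fromℕ l ^ r′ * (p ^ r * fromℕ n)        ≈⟨ solve 3 (λ L P n → L :* (P :* n) := L :* n :* P) refl _ _ _ ⟩
          fromℕ l ^ r′ * fromℕ n * p ^ r          ≈⟨ *-congʳ (trans (fromℕ-* (l ℕ.^ r′) n) (*-congʳ (fromℕ-^ l r′))) ⟨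
          fromℕ (l ℕ.^ r′ ℕ.* n) * p ^ r          ∎))
          where
            ap≤5rℓ : fromℕ a * p ≤ fromℕ (5 ℕ.* r) * ℓ
            ap≤5rℓ = begin
              fromℕ a * p                        ≤⟨ ap≤y+p ⟩
              y + p                              ≤⟨ +-monoʳ-≤ y (≤-trans p≤1 1≤ℓ) ⟩
              y + ℓ                              ≈⟨ solve 2 (λ f l → f :* l :+ l := (con 1 :+ f) :* l) refl _ ℓ ⟩
              fromℕ (suc (4 ℕ.* r)) * ℓ          ≤⟨ *-monoˡ-≤ (ln-nonNeg 2≤n) (fromℕ-mono-≤ {suc (4 ℕ.* r)} {5 ℕ.* r} (ℕ.+-monoˡ-≤ (4 ℕ.* r) (ℕ.s≤s ℕ.z≤n))) ⟩
              fromℕ (5 ℕ.* r) * ℓ                ∎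

  tp-aas : ∀ (p : ℕ → Carrier) (h : ∀ n → 0# ≤ p n × p n ≤ 1#) →
    Eventually (λ n → (fromℕ 27 * ln n / fromℕ n) ^[ 1 / 3 ] ≤ p n) → AAS p (λ n G → tp[ 2 ] G ≤ 2)
  tp-aas p h (N , q) = aas-commonNeighbours 3 p h (λ n G → tp[ 2 ] G ≤ 2)
    (N ℕ.⊔ 2 , λ n N≤n → dense-from-root 2 (ℕ.≤-trans (ℕ.m≤n⊔m N 2) N≤n) (fromℕ-nonNeg 27) (q n (ℕ.≤-trans (ℕ.m≤m⊔n N 2) N≤n)))
    (λ n l G n<2^ common → tp-bound ℝ l G n<2^ common)

  tc-aas : ∀ r C (p : ℕ → Carrier) (h : ∀ n → 0# ≤ p n × p n ≤ 1#) → threshold (suc r) ℕ.≤ C →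
    Eventually (λ n → (fromℕ C * ln n / fromℕ n) ^[ 1 / suc r ] ≤ p n) → AAS p (λ n G → tc[ r ] G ≤ (r ℕ.^ 2))
  tc-aas r C p h T≤C (N , q) = aas-commonNeighbours (suc r) p h (λ n G → tc[ r ] G ≤ (r ℕ.^ 2))
    (N ℕ.⊔ 2 , λ n N≤n → ≤-trans (*-monoˡ-≤ (ln-nonNeg (ℕ.≤-trans (ℕ.m≤n⊔m N 2) N≤n)) (fromℕ-mono-≤ T≤C))
      (dense-from-root r (ℕ.≤-trans (ℕ.m≤n⊔m N 2) N≤n) (fromℕ-nonNeg C) (q n (ℕ.≤-trans (ℕ.m≤m⊔n N 2) N≤n))))
    (λ n l G _ common → tc-bound G common)

  module _ (r″ : ℕ) where
    private
      r′ r : ℕ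
      r′ = suc r″
      r = suc r′

    forest-aas : ∀ C (p : ℕ → Carrier) (h : ∀ n → 0# ≤ p n × p n ≤ 1#) → forestConstant r′ ℕ.≤ C →
      Eventually (λ n → (fromℕ C * ln n / fromℕ n) ^[ 1 / r ] ≤ p n) →
      AAS p (λ n G → AlmostCoveredByTrees r (fromℕ (9 ℕ.* r) * ln n / p n) G)
    forest-aas C p h C₃≤C (N , q) = aas-expanding p h _ (N ℕ.⊔ 4 , λ n large-n →
      let 4≤n = ℕ.≤-trans (ℕ.m≤n⊔m N 4) large-n
      in atSize n 4≤n (q n (ℕ.≤-trans (ℕ.m≤m⊔n N 4) large-n)) (floorLog n (ℕ.≤-trans (ℕ.s≤s ℕ.z≤n) 4≤n)))
      where
        Target : ∀ n → Graph n → Set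
        Target n G = AlmostCoveredByTrees r (fromℕ (9 ℕ.* r) * ln n / p n) G
        atSize : ∀ n → 4 ℕ.≤ n → (fromℕ C * ln n / fromℕ n) ^[ 1 / r ] ≤ p n → (∃ λ l → 2 ℕ.^ l ℕ.≤ n × n ℕ.< 2 ℕ.^ suc l) →
          ∃ λ l → ∃ λ a → ∃ λ b → 4 ℕ.≤ n × 2 ℕ.^ l ℕ.≤ n × a ℕ.+ a ℕ.< b ×
            fromℕ 4 * log (fromℕ n) < fromℕ a * (½ * p n ^ 1) × (∀ (G : Graph n) → Expanding l a b G → ¬ ¬ Target n G)
        atSize n 4≤n root (l , 2^l≤n , n<2^) = choose At.size
          where
            1≤r′ : 1 ℕ.≤ r′
            1≤r′ = ℕ.s≤s ℕ.z≤n
            2≤n = ℕ.≤-trans (ℕ.s≤s (ℕ.s≤s ℕ.z≤n)) 4≤n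
            0≤p = proj₁ (h n)
            p≤1 = proj₂ (h n)
            dense : fromℕ (forestConstant r′) * ln n ≤ p n ^ r * fromℕ n
            dense = ≤-trans (*-monoˡ-≤ (ln-nonNeg 2≤n) (fromℕ-mono-≤ C₃≤C)) (dense-from-root r′ 2≤n (fromℕ-nonNeg C) root)
            module At = Budget r′ n l 1≤r′ 4≤n 2^l≤n n<2^ (p n) 0≤p p≤1 dense
            choose : (∃ λ a → fromℕ (4 ℕ.* r) * ln n < fromℕ a * p n × fromℕ a * p n ≤ fromℕ (4 ℕ.* r) * ln n + p n) →
              ∃ λ l → ∃ λ a → ∃ λ b → 4 ℕ.≤ n × 2 ℕ.^ l ℕ.≤ n × a ℕ.+ a ℕ.< b ×
                fromℕ 4 * log (fromℕ n) < fromℕ a * (½ * p n ^ 1) × (∀ (G : Graph n) → Expanding l a b G → ¬ ¬ Target n G)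
            choose (a , y<ap , ap≤y+p) = l , a , Z.b , 4≤n , 2^l≤n , Z.2a<b , At.large a y<ap ap≤y+p , covers
              where
                module Z = Sizes r′ n l a 1≤r′ (2≤l r′ n l 1≤r′ 4≤n 2^l≤n n<2^) (At.2l<a a y<ap ap≤y+p) (At.Ka^r≤ a y<ap ap≤y+p)
                covers : ∀ (G : Graph n) → Expanding l a Z.b G → ¬ ¬ Target n G
                covers G expanding = Pairs-shift (Fin-shift r) n Covered λ χ none →
                  Forests.forest ℝ G χ l a Z.b Z.1≤a n<2^ expanding Z.at≤lb Z.l≤β Z.t≤rω Z.1≤b ≡.refl Z.a≤n Z.startRich
                    λ f → none (within χ f)
                  where
                    Covered : Colouring r n → Set
                    Covered χ = Σ (List (Subgraph G)) λ Ts → length Ts ℕ.≤ r ×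
                      All (λ T → Tree T × Monochromatic χ T) Ts × VertexDisjoint Ts ×
                      fromℕ ∣ ∁ (covered Ts) ∣ ≤ fromℕ (9 ℕ.* r) * ln n / p n
                    within : ∀ χ → ColouredForest G χ (a ℕ.+ a) → Covered χ
                    within χ (Ts , len , trees , disjoint , few) = Ts , len , trees , disjoint ,
                      ≤-trans (fromℕ-mono-≤ few) (At.leftover a y<ap ap≤y+p)

    -- log n ≤ p n^(1/r) (log n)^((r-1)/r) follows by comparing r-th powers.
    leftover-order : ∀ C (p : ℕ → Carrier) (h : ∀ n → 0# ≤ p n × p n ≤ 1#) → 1 ℕ.≤ C →
      Eventually (λ n → (fromℕ C * ln n / fromℕ n) ^[ 1 / r ] ≤ p n) →
      (λ n → fromℕ (9 ℕ.* r) * ln n / p n) =O (λ n → fromℕ n ^[ 1 / r ] * ln n ^[ r′ / r ])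
    leftover-order C p h 1≤C (N , q) = fromℕ (9 ℕ.* r) , N ℕ.⊔ 2 , λ n large-n →
      bound n (ℕ.≤-trans (ℕ.m≤n⊔m N 2) large-n) (q n (ℕ.≤-trans (ℕ.m≤m⊔n N 2) large-n))
      where
        bound : ∀ n → 2 ℕ.≤ n → (fromℕ C * ln n / fromℕ n) ^[ 1 / r ] ≤ p n →
          abs (fromℕ (9 ℕ.* r) * ln n / p n) ≤ fromℕ (9 ℕ.* r) * abs (fromℕ n ^[ 1 / r ] * ln n ^[ r′ / r ])
        bound n 2≤n root = abs-≤ γ≤ (≤-trans -γ≤γ γ≤)
          where
            ℓ = ln n
            P = p n
            0≤p = proj₁ (h n)
            α = fromℕ n ^[ 1 / r ]
            β = ℓ ^[ r′ / r ]
            nine = fromℕ (9 ℕ.* r)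
            0≤ℓ = ln-nonNeg 2≤n
            0≤α : 0# ≤ α
            0≤α = root-nonNeg 1 r′ (^-nonNeg 1 (fromℕ-nonNeg n))
            0≤β : 0# ≤ β
            0≤β = root-nonNeg r′ r′ (^-nonNeg r′ 0≤ℓ)
            n≤α^r : fromℕ n ≤ α ^ r
            n≤α^r = ≤-trans (≤-reflexive (sym (*-identityʳ _))) (root≤⇒≤^ 1 r′ (^-nonNeg 1 (fromℕ-nonNeg n)) ≤-refl)
            ℓ^r′≤β^r : ℓ ^ r′ ≤ β ^ r
            ℓ^r′≤β^r = root≤⇒≤^ r′ r′ (^-nonNeg r′ 0≤ℓ) ≤-refl
            dense : fromℕ 1 * ℓ ≤ P ^ r * fromℕ n
            dense = ≤-trans (*-monoˡ-≤ 0≤ℓ (fromℕ-mono-≤ 1≤C)) (dense-from-root r′ 2≤n (fromℕ-nonNeg C) root)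
            0<p : 0# < P
            0<p = ≰⇒> λ p≤0 → <⇒≱ (*-pos (fromℕ-pos 0) (log-pos 2≤n)) (≤-trans dense (begin
              P * P ^ r′ * fromℕ n   ≤⟨ *-monoˡ-≤ (fromℕ-nonNeg n) (*-monoˡ-≤ (^-nonNeg r′ 0≤p) p≤0) ⟩
              0# * P ^ r′ * fromℕ n  ≈⟨ trans (*-congʳ (zeroˡ _)) (zeroˡ _) ⟩
              0#                     ∎))
            ℓ≤pαβ : ℓ ≤ P * (α * β)
            ℓ≤pαβ = ^-cancelˡ-≤ r′ (*-nonNeg 0≤p (*-nonNeg 0≤α 0≤β)) (begin
              ℓ * ℓ ^ r′                       ≈⟨ *-congʳ (trans (*-congʳ fromℕ-1) (*-identityˡ ℓ)) ⟨
              fromℕ 1 * ℓ * ℓ ^ r′             ≤⟨ *-monoˡ-≤ (^-nonNeg r′ 0≤ℓ) dense ⟩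
              P ^ r * fromℕ n * ℓ ^ r′         ≤⟨ *-mono-≤ (*-nonNeg (^-nonNeg r 0≤p) (fromℕ-nonNeg n)) (^-nonNeg r 0≤β)
                                                    (*-monoʳ-≤ (^-nonNeg r 0≤p) n≤α^r) ℓ^r′≤β^r ⟩
              P ^ r * α ^ r * β ^ r            ≈⟨ *-assoc _ _ _ ⟩
              P ^ r * (α ^ r * β ^ r)          ≈⟨ *-congˡ (^-distrib-* α β r) ⟨
              P ^ r * (α * β) ^ r              ≈⟨ ^-distrib-* P (α * β) r ⟨
              (P * (α * β)) ^ r                ∎)
            0≤γ : 0# ≤ nine * ℓ / P
            0≤γ = *-nonNeg (*-nonNeg (fromℕ-nonNeg (9 ℕ.* r)) 0≤ℓ) (⁻¹-nonNeg 0<p)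
            -γ≤γ : - (nine * ℓ / P) ≤ nine * ℓ / P
            -γ≤γ = +-cancelʳ-≤ (nine * ℓ / P) (≤-trans (≤-reflexive (-‿inverseˡ _)) (+-nonNeg 0≤γ 0≤γ))
            γ≤ : nine * ℓ / P ≤ nine * abs (α * β)
            γ≤ = begin
              nine * ℓ * P ⁻¹               ≤⟨ *-monoˡ-≤ (⁻¹-nonNeg 0<p) (*-monoʳ-≤ (fromℕ-nonNeg (9 ℕ.* r)) ℓ≤pαβ) ⟩
              nine * (P * (α * β)) * P ⁻¹   ≈⟨ solve 4 (λ k p x i → k :* (p :* x) :* i := k :* (i :* (p :* x))) refl nine P (α * β) (P ⁻¹) ⟩
              nine * (P ⁻¹ * (P * (α * β))) ≈⟨ *-congˡ (x⁻¹*[x*y] 0<p _) ⟩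
              nine * (α * β)                ≤⟨ *-monoʳ-≤ (fromℕ-nonNeg (9 ℕ.* r)) (x≤abs _) ⟩
              nine * abs (α * β)            ∎

theorem1p6 : (ℝ : RealNumbers) →
    let open RealNumbers ℝ
        open Analysis ℝ
        open RandomGraph ℝ
        ln : ℕ → Carrier
        ln n = log (fromℕ n)
    in
    (r : ℕ) → 2 ℕ.≤ r →
    ∃ λ (C : Carrier) → fromℕ r ≤ C ×
      ((p : ℕ → Carrier) → (∀ n → 0# ≤ p n × p n ≤ 1#) →
        (Eventually (λ n → (fromℕ 27 * ln n / fromℕ n) ^[ 1 / 3 ] ≤ p n) →
          AAS p (λ n G → tp[ 2 ] G ≤ 2))
        ×
        (Eventually (λ n → (C * ln n / fromℕ n) ^[ 1 / (ℕ.suc r) ] ≤ p n) →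
          AAS p (λ n G → tc[ r ] G ≤ (r ℕ.^ 2)))
        ×
        (Eventually (λ n → (C * ln n / fromℕ n) ^[ 1 / r ] ≤ p n) →
          AAS p (λ n G → AlmostCoveredByTrees r (fromℕ (9 ℕ.* r) * ln n / p n) G)
          ×
          (λ n → fromℕ (9 ℕ.* r) * ln n / p n)
            =O (λ n → fromℕ n ^[ 1 / r ] * ln n ^[ (r ℕ.∸ 1) / r ])))
theorem1p6 ℝ (suc (suc r″)) (ℕ.s≤s (ℕ.s≤s _)) = fromℕ C , fromℕ-mono-≤ r≤C , λ p h →
    tp-aas p h
  , tc-aas r C p h T≤C
  , λ q → forest-aas r″ C p h C₃≤C q , leftover-order r″ C p h 1≤C q
  where
    open RealNumbers ℝ
    open OrderedField ℝ
    open CommonNeighboursAAS ℝ using (threshold)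
    open Thresholds ℝ
    r C : ℕ
    r = suc (suc r″)
    -- A sum in place of a maximum: it is above r and above the constants of (ii) and (iii).
    C = r ℕ.+ (threshold (suc r) ℕ.+ forestConstant (suc r″))
    r≤C : r ℕ.≤ C
    r≤C = ℕ.m≤m+n r _
    T≤C : threshold (suc r) ℕ.≤ C
    T≤C = ℕ.≤-trans (ℕ.m≤m+n (threshold (suc r)) (forestConstant (suc r″))) (ℕ.m≤n+m (threshold (suc r) ℕ.+ forestConstant (suc r″)) r)
    C₃≤C : forestConstant (suc r″) ℕ.≤ C
    C₃≤C = ℕ.≤-trans (ℕ.m≤n+m (forestConstant (suc r″)) (threshold (suc r))) (ℕ.m≤n+m (threshold (suc r) ℕ.+ forestConstant (suc r″)) r)
    1≤C : 1 ℕ.≤ C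
    1≤C = ℕ.s≤s ℕ.z≤n
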